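{- Let $V$ be a finite set with $|V|=\ell\geq 2$, let $\bm{n}\in\mathbb{Z}_{\geq 0}^{V}$, and let $G=(V,\emptyset)$ be the digraph with no edges. Then the cone $c\mathscr{A}(\bm{n},G)$ is free with exponents $\{0,1,|\bm{n}|+1,|\bm{n}|+2,\dots,|\bm{n}|+\ell-1\}$. In particular, $c\mathscr{A}(\bm{n},G)$ is inductively free.
   Context: $\mathbb{K}$ is a field of characteristic zero; $|\bm{n}|:=\sum_{i\in V}n_i$. For a digraph $G=(V,E)$ ($E\subseteq\{(i,j)\mid i\neq j\}$) let $\varepsilon_G(i,j)=1$ if $(i,j)\in E$, else $0$. $\mathscr{A}(\bm{n},G)$ is the arrangement in $\mathbb{K}^V$ of hyperplanes $\{x_i-x_j=c\}$, $i\neq j$, $c\in\mathbb{Z}$, $-n_i-\varepsilon_G(i,j)\leq c\leq n_j+\varepsilon_G(j,i)$. Its cone $c\mathscr{A}(\bm{n},G)$ is the central arrangement in $\mathbb{K}^{V}\times\mathbb{K}$ (coordinates $x_i$, $z$) consisting of $\{z=0\}$ and the hyperplanes $\{x_i-x_j=cz\}$ for each $\{x_i-x_j=c\}\in\mathscr{A}(\bm{n},G)$. A central arrangement $\mathscr{A}$ in $\mathbb{K}^N$ with polynomial ring $S=\mathbb{K}[y_1,\dots,y_N]$ is free if $D(\mathscr{A})=\{\theta\in\bigoplus_k S\partial_k\mid \theta(\alpha_H)\in\alpha_H S\ \forall H\in\mathscr{A}\}$ ($\alpha_H$ a linear form defining $H$) is a free $S$-module; its exponents are the multiset of degrees of a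 homogeneous basis. The restriction to $H\in\mathscr{A}$ is $\mathscr{A}^H=\{H'\cap H\mid H'\in\mathscr{A}\setminus\{H\}\}$. The class of inductively free arrangements is the smallest class of central arrangements containing the empty arrangements and such that if there is $H\in\mathscr{A}$ with $\mathscr{A}\setminus\{H\}$ and $\mathscr{A}^H$ in the class and $\exp(\mathscr{A}^H)\subseteq\exp(\mathscr{A}\setminus\{H\})$ (as multisets), then $\mathscr{A}$ is in the class. -}

module Defs where

open import Level using (Level; Lift; _⊔_) renaming (suc to lsuc)
open import Algebra.Bundles using (CommutativeRing)
open import Data.Nat as ℕ using (ℕ; zero; suc)
open import Data.Integer as ℤ using (ℤ; +_; -[1+_])
open import Data.Fin as Fin using (Fin; zero; suc; punchIn)
open import Data.Fin.Properties as FinP using ()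
open import Data.Vec as Vec using (Vec; lookup; tabulate; zipWith; replicate; toList)
open import Data.Vec.Properties as VecP using ()
open import Data.List as List using (List; []; _∷_; _++_; map; concat)
open import Data.List.Relation.Binary.Permutation.Propositional using (_↭_)
open import Data.Product using (Σ; ∃; _×_; _,_; proj₁; proj₂)
open import Data.Sum using (_⊎_)
open import Data.Bool using (Bool; true; false; if_then_else_)
open import Relation.Nullary using (¬_; does)
open import Relation.Binary.PropositionalEquality using (_≡_)

record Field (c ℓ : Level) : Set (lsuc (c ⊔ ℓ)) where
  field
    commutativeRing : CommutativeRing c ℓ
  open CommutativeRing commutativeRing public
  field
    inv     : (x : Carrier) → ¬ (x ≈ 0#) → Carrier
    inverse : ∀ x (nz : ¬ (x ≈ 0#)) → (x * inv x nz) ≈ 1#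
    0≉1     : ¬ (0# ≈ 1#)

module FieldOps {c ℓ} (K : Field c ℓ) where
  open Field K using (Carrier; _+_; -_; 0#; 1#)

  natK : ℕ → Carrier
  natK zero    = 0#
  natK (suc n) = 1# + natK n

  intK : ℤ → Carrier
  intK (+ n)      = natK n
  intK -[1+ n ]   = - natK (suc n)

CharZero : ∀ {c ℓ} → Field c ℓ → Set ℓ
CharZero K = ∀ (n : ℕ) → ¬ (natK (suc n) ≈ 0#)
  where open Field K using (_≈_; 0#)
        open FieldOps K

module Arrangements {c ℓ} (K : Field c ℓ) where
  open Field K using (Carrier; _≈_; _+_; _*_; -_; _-_; 0#; 1#; inv)
  open FieldOps K public

  -- linear forms α = Σ α_k y_k on K^N
  Form : ℕ → Set c
  Form N = Fin N → Carrier

  _≈F_ : ∀ {N} → Form N → Form N → Set ℓ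
  α ≈F β = ∀ k → α k ≈ β k

  -- a central arrangement, given by the (nonzero) linear forms defining
  -- its hyperplanes; proportional forms define the same hyperplane
  Arr : ℕ → Set (lsuc (c ⊔ ℓ))
  Arr N = Form N → Set (c ⊔ ℓ)

  Proportional : ∀ {N} → Form N → Form N → Set (c ⊔ ℓ)
  Proportional β α = ∃ λ t → ∀ k → β k ≈ (t * α k)

  -- Polynomial ring S = K[y_1..y_N]: a polynomial is a finite list of
  -- terms (coefficient , exponent vector); two polynomials are equal when
  -- all their coefficients agree.

  Mon : ℕ → Set
  Mon N = Vec ℕ N

  Poly : ℕ → Set c
  Poly N = List (Carrier × Mon N)

  coeff : ∀ {N} → Poly N → Mon N → Carrier
  coeff []             m = 0#
  coeff ((a , m') ∷ p) m =
    if does (VecP.≡-dec ℕ._≟_ m' m) then a + coeff p m else coeff p m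

  _≈P_ : ∀ {N} → Poly N → Poly N → Set ℓ
  p ≈P q = ∀ m → coeff p m ≈ coeff q m

  0P : ∀ {N} → Poly N
  0P = []

  _+P_ : ∀ {N} → Poly N → Poly N → Poly N
  p +P q = p ++ q

  _*P_ : ∀ {N} → Poly N → Poly N → Poly N
  p *P q = concat (map (λ t → map (λ u → (proj₁ t * proj₁ u , zipWith ℕ._+_ (proj₂ t) (proj₂ u))) q) p)

  constP : ∀ {N} → Carrier → Poly N
  constP a = (a , replicate _ 0) ∷ []

  var : ∀ {N} → Fin N → Poly N
  var k = (1# , tabulate (λ j → if does (j Fin.≟ k) then 1 else 0)) ∷ []

  sumF : ∀ {N m} → (Fin m → Poly N) → Poly N
  sumF {m = zero}  f = 0P
  sumF {m = suc m} f = f zero +P sumF (λ i → f (suc i))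

  linPoly : ∀ {N} → Form N → Poly N
  linPoly α = sumF (λ k → constP (α k) *P var k)

  Divides : ∀ {N} → Poly N → Poly N → Set (c ⊔ ℓ)
  Divides g f = ∃ λ h → f ≈P (g *P h)

  HomogP : ∀ {N} → ℕ → Poly N → Set ℓ
  HomogP d p = ∀ m → ¬ (Vec.sum m ≡ d) → coeff p m ≈ 0#

  -- Derivations θ = Σ_k θ_k ∂_k

  Der : ℕ → Set c
  Der N = Fin N → Poly N

  _≈D_ : ∀ {N} → Der N → Der N → Set ℓ
  θ ≈D φ = ∀ k → θ k ≈P φ k

  0D : ∀ {N} → Der N
  0D k = 0P

  applyD : ∀ {N} → Der N → Form N → Poly N
  applyD θ α = sumF (λ k → constP (α k) *P θ k)

  HomogD : ∀ {N} → ℕ → Der N → Set ℓ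
  HomogD d θ = ∀ k → HomogP d (θ k)

  combo : ∀ {N m} → (Fin m → Poly N) → (Fin m → Der N) → Der N
  combo f θs k = sumF (λ i → f i *P θs i k)

  InD : ∀ {N} → Arr N → Der N → Set (c ⊔ ℓ)
  InD A θ = ∀ α → A α → Divides (linPoly α) (applyD θ α)

  FreeWith : ∀ {N m} → Arr N → Vec ℕ m → Set (c ⊔ ℓ)
  FreeWith {N} {m} A e =
    Σ (Fin m → Der N) λ B →
        (∀ i → HomogD (lookup e i) (B i))
      × (∀ i → InD A (B i))
      × (∀ θ → InD A θ → ∃ λ f → θ ≈D combo f B)
      × (∀ f → combo f B ≈D 0D → ∀ i → f i ≈P 0P)

  SubBag : ∀ {m₁ m₂} → Vec ℕ m₁ → Vec ℕ m₂ → Set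
  SubBag e₁ e₂ = ∃ λ rest → toList e₂ ↭ (toList e₁ ++ rest)

  Del : ∀ {N} → Arr N → Form N → Arr N
  Del A α β = A β × ¬ Proportional β α

  -- restriction of β to H = {α = 0}, identifying H with K^N by the
  -- coordinates y_j (j ≠ k), where α_k ≠ 0 (y_k is eliminated)
  restrictF : ∀ {N} (k : Fin (suc N)) (α : Form (suc N)) → ¬ (α k ≈ 0#) →
              Form (suc N) → Form N
  restrictF k α nz β j =
    β (punchIn k j) - (β k * (α (punchIn k j) * inv (α k) nz))

  Res : ∀ {N} → Arr (suc N) → (k : Fin (suc N)) (α : Form (suc N)) →
        ¬ (α k ≈ 0#) → Arr N
  Res A k α nz γ = ∃ λ β → Del A α β × (γ ≈F restrictF k α nz β)

  data IndFree : (N : ℕ) → Arr N → Set (lsuc (c ⊔ ℓ)) where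
    empty : ∀ {N} {A : Arr N} → (∀ β → ¬ A β) → IndFree N A
    step  : ∀ {N} {A : Arr (suc N)} (α : Form (suc N)) → A α →
            (k : Fin (suc N)) (nz : ¬ (α k ≈ 0#)) →
            IndFree (suc N) (Del A α) →
            IndFree N (Res A k α nz) →
            ∀ {m₁ m₂} (e₁ : Vec ℕ m₁) (e₂ : Vec ℕ m₂) →
            FreeWith (Del A α) e₁ →
            FreeWith (Res A k α nz) e₂ →
            SubBag e₂ e₁ →
            IndFree (suc N) A

  -- The arrangement A(n,G) and its cone, V = Fin l.
  -- Coordinates of K^V × K: index zero is z, index (suc i) is x_i.

  Digraph : ℕ → Set
  Digraph l = Fin l → Fin l → Bool

  emptyGraph : ∀ {l} → Digraph l
  emptyGraph i j = false

  εG : ∀ {l} → Digraph l → Fin l → Fin l → ℕ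
  εG G i j = if G i j then 1 else 0

  δ : ∀ {l} → Fin l → Fin l → Carrier
  δ t i = if does (t Fin.≟ i) then 1# else 0#

  zForm : ∀ {l} → Form (suc l)
  zForm zero    = 1#
  zForm (suc t) = 0#

  hypForm : ∀ {l} → Fin l → Fin l → ℤ → Form (suc l)
  hypForm i j c zero    = - intK c
  hypForm i j c (suc t) = δ t i - δ t j

  coneArr : ∀ {l} → (Fin l → ℕ) → Digraph l → Arr (suc l)
  coneArr {l} n G β = Lift c
    ((β ≈F zForm) ⊎
     (∃ λ (i : Fin l) → ∃ λ (j : Fin l) → ∃ λ (cc : ℤ) →
        ¬ (i ≡ j)
      × (ℤ.- (+ (n i ℕ.+ εG G i j)) ℤ.≤ cc)
      × (cc ℤ.≤ + (n j ℕ.+ εG G j i))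
      × (β ≈F hypForm i j cc)))

sizeN : ∀ {l} → (Fin l → ℕ) → ℕ
sizeN {zero}  n = 0
sizeN {suc l} n = n zero ℕ.+ sizeN (λ i → n (suc i))

expList : ∀ {l} → (Fin l → ℕ) → List ℕ
expList {l} n = 0 ∷ 1 ∷ List.applyUpTo (λ i → sizeN n ℕ.+ suc i) (l ℕ.∸ 1)

{-# OPTIONS --safe #-}
module Submission where

-- Think of vertex i as an interval of w_i consecutive points x_i + p_i + a, 0 ≤ a < w_i;
-- the cone consists of z = 0 and the loci where points of two different intervals collide
-- (p = 0, w = n + 1). Lengthening the interval of s by one point adds, one at a time, the
-- walls α_j on which the new point meets the first point of interval j. On α_j the intervals
-- of s and j are glued end to end, so the restriction is an arrangement of the same kind with
-- one vertex less and with |n| + 1 in place of |n|.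
--
-- A basis is given by 1, the Euler derivation, and the θ_k(x_i) = F_k(x_i + p_i z), where F_k
-- has difference F_k(t + z) − F_k(t) = z t(t − z)⋯(t − (k−1)z) ∏ (t − y), y running over all
-- points but the last of each interval: summing over an interval gives zero, hence F_k is
-- constant on it. If all elements of a basis but θ preserve α, and θ(α) is prime to α, then
-- replacing θ by α θ yields a basis after adding α, so that Saito's criterion is not needed.
-- At each step θ = θ_0 while the other elements are already those for the longer interval;
-- after the last wall, ∏ α_j θ_0 is exchanged for the missing top element. The braid
-- arrangement (all w_i = 1) is reached in the same way from w = 0.

open import Defs
open import Level using (Level; _⊔_; Lift; lift) renaming (suc to lsuc)
open import Algebra.Bundles using (CommutativeRing)
open import Algebra.Solver.Ring.AlmostCommutativeRing using (fromCommutativeRing; _-Raw-AlmostCommutative⟶_)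
import Algebra.Properties.AbelianGroup
import Algebra.Properties.CommutativeSemigroup
import Algebra.Properties.Group
import Algebra.Properties.Ring
import Algebra.Properties.Semiring.Mult.TCOptimised
import Algebra.Solver.Ring
open import Data.Bool using (true; false; if_then_else_)
open import Data.Empty using (⊥; ⊥-elim)
open import Data.Fin as Fin using (Fin; zero; suc; punchIn; punchOut; toℕ; fromℕ<; inject≤)
import Data.Fin.Properties as FinP
open import Data.Integer as ℤ using (ℤ; +_; -[1+_]; +≤+)
import Data.Integer.Properties as ℤP
open import Data.List as List using (List; []; _∷_; _++_; allFin; length; map)
import Data.List.Properties as ListP
open import Data.List.Membership.Propositional using (_∈_; _∉_)
import Data.List.Membership.Propositional.Properties as ∈P
open import Data.List.Relation.Binary.Permutation.Propositional using (_↭_; ↭-prep; ↭-refl; ↭-reflexive; ↭-swap; ↭-sym; ↭-trans; module PermutationReasoning)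
import Data.List.Relation.Binary.Permutation.Propositional.Properties as ↭P
open import Data.List.Relation.Binary.Pointwise using (Pointwise; []; _∷_)
open import Data.List.Relation.Unary.All as All using (All; []; _∷_)
import Data.List.Relation.Unary.All.Properties as AllP
open import Data.List.Relation.Unary.AllPairs using ([]; _∷_)
open import Data.List.Relation.Unary.Any as Any using (Any; here; there)
import Data.List.Relation.Unary.Any.Properties as AnyP
open import Data.List.Relation.Unary.Unique.Propositional using (Unique)
import Data.List.Relation.Unary.Unique.Propositional.Properties as UniqueP
open import Data.Maybe using (Maybe; just; nothing)
open import Data.Nat as ℕ using (ℕ; zero; suc; _<_; _≤_; s≤s; z≤n)
import Data.Nat.Properties as ℕP
open import Data.Product using (Σ; ∃; _×_; _,_; proj₁; proj₂)
open import Data.Sign as Sign using (Sign)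
open import Data.Sum using (_⊎_; [_,_]′; inj₁; inj₂)
open import Data.Vec as Vec using (Vec; []; _∷_; _[_]≔_; lookup; replicate; tabulate; toList; zipWith)
import Data.Vec.Properties as VecP
open import Data.Vec.Relation.Binary.Pointwise.Inductive as VPW using ([]; _∷_)
open import Function using (_∘_; id)
open import Relation.Binary.PropositionalEquality as ≡ using (_≡_; _≢_)
import Relation.Binary.Reasoning.Setoid
open import Relation.Nullary using (¬_; Dec; contradiction; does; no; yes)
open import Relation.Nullary.Decidable using (dec-false; dec-true)

-- The offsets p are forced by restriction: gluing the interval of s in front of that of j moves its
-- starting point by -w_s, so the class is closed under restriction only if starting points are
-- arbitrary. A new point yields just one wall per interval, because its meeting with a later point
-- b is the hyperplane on which its left neighbour meets b - 1. The exponents show why a single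
-- basis element moves. With N = |n| and ℓ vertices they are 0, 1, N+1, ..., N+ℓ-1. Every
-- restriction to a wall has ℓ-1 vertices and size N+1, hence exponents 0, 1, N+2, ..., N+ℓ-1,
-- whichever wall it is. So only the element of degree N+1 is multiplied, and after ℓ-1 walls its
-- degree is N+ℓ, the exponent missing for size N+1. That the product may be exchanged for the
-- explicit top element is more than a count of degrees: one must be a nonzero constant times the
-- other modulo the remaining elements. The constant is read off from the product over all points,
-- and is minus the proportion of the points that lie on the interval of s.

-- Ring solver with integer coefficients

module ℤSolver {a b} (R : CommutativeRing a b) where
  open CommutativeRing R hiding (zero)
  open Algebra.Properties.Ring ring using (-0#≈0#; -‿involutive; -‿distribˡ-*; -‿distribʳ-*)
  open Algebra.Properties.AbelianGroup +-abelianGroup using (xyx⁻¹≈y; ⁻¹-∙-comm)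
  open Algebra.Properties.Semiring.Mult.TCOptimised semiring renaming (_×_ to _·_)
  open Relation.Binary.Reasoning.Setoid setoid

  -- With the optimised multiple, the images of 0 and 1 are `0#` and `1#` by computation, so
  -- constants in solver equations match the literal terms of a goal.
  ⟦_⟧ : ℤ → Carrier
  ⟦ + n ⟧      = n · 1#
  ⟦ -[1+ n ] ⟧ = - (suc n · 1#)

  ⟦-⟧ : ∀ i → ⟦ ℤ.- i ⟧ ≈ - ⟦ i ⟧
  ⟦-⟧ (+ zero)  = sym -0#≈0#
  ⟦-⟧ (+ suc n) = refl
  ⟦-⟧ -[1+ n ]  = sym (-‿involutive _)

  ⟦⊖⟧ : ∀ m n → ⟦ m ℤ.⊖ n ⟧ ≈ m · 1# - n · 1#
  ⟦⊖⟧ m zero = sym (trans (+-congˡ -0#≈0#) (+-identityʳ _))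
  ⟦⊖⟧ zero (suc n) = sym (+-identityˡ _)
  ⟦⊖⟧ (suc m) (suc n) = begin
    ⟦ suc m ℤ.⊖ suc n ⟧                ≡⟨ ≡.cong ⟦_⟧ (ℤP.[1+m]⊖[1+n]≡m⊖n m n) ⟩
    ⟦ m ℤ.⊖ n ⟧                        ≈⟨ ⟦⊖⟧ m n ⟩
    M - N                              ≈⟨ +-congʳ (sym (xyx⁻¹≈y 1# M)) ⟩
    1# + M - 1# - N                    ≈⟨ +-assoc _ _ _ ⟩
    1# + M + (- 1# - N)                ≈⟨ +-cong (1+× m 1#) (trans (-‿cong (1+× n 1#)) (sym (⁻¹-∙-comm 1# N))) ⟨
    suc m · 1# - suc n · 1#            ∎
    where M = m · 1#
          N = n · 1#

  ⟦+⟧ : ∀ i j → ⟦ i ℤ.+ j ⟧ ≈ ⟦ i ⟧ + ⟦ j ⟧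
  ⟦+⟧ (+ m)    (+ n)    = ×-homo-+ 1# m n
  ⟦+⟧ (+ m)    -[1+ n ] = ⟦⊖⟧ m (suc n)
  ⟦+⟧ -[1+ m ] (+ n)    = trans (⟦⊖⟧ n (suc m)) (+-comm _ _)
  ⟦+⟧ -[1+ m ] -[1+ n ] = begin
    - (suc (suc (m ℕ.+ n)) · 1#)       ≡⟨ ≡.cong (λ k → - (suc k · 1#)) (ℕP.+-suc m n) ⟨
    - ((suc m ℕ.+ suc n) · 1#)         ≈⟨ -‿cong (×-homo-+ 1# (suc m) (suc n)) ⟩
    - (suc m · 1# + suc n · 1#)        ≈⟨ ⁻¹-∙-comm _ _ ⟨
    - (suc m · 1#) - suc n · 1#        ∎

  ⟦+◃⟧ : ∀ n → ⟦ Sign.+ ℤ.◃ n ⟧ ≈ n · 1#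
  ⟦+◃⟧ zero    = refl
  ⟦+◃⟧ (suc n) = refl

  ⟦-◃⟧ : ∀ n → ⟦ Sign.- ℤ.◃ n ⟧ ≈ - (n · 1#)
  ⟦-◃⟧ zero    = sym -0#≈0#
  ⟦-◃⟧ (suc n) = refl

  ⟦*⟧ : ∀ i j → ⟦ i ℤ.* j ⟧ ≈ ⟦ i ⟧ * ⟦ j ⟧
  ⟦*⟧ (+ m)    (+ n)    = trans (⟦+◃⟧ (m ℕ.* n)) (×1-homo-* m n)
  ⟦*⟧ (+ m)    -[1+ n ] = trans (⟦-◃⟧ (m ℕ.* suc n)) (trans (-‿cong (×1-homo-* m (suc n))) (-‿distribʳ-* _ _))
  ⟦*⟧ -[1+ m ] (+ n)    = trans (⟦-◃⟧ (suc m ℕ.* n)) (trans (-‿cong (×1-homo-* (suc m) n)) (-‿distribˡ-* _ _))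
  ⟦*⟧ -[1+ m ] -[1+ n ] = begin
    ⟦ Sign.+ ℤ.◃ (suc m ℕ.* suc n) ⟧   ≈⟨ ⟦+◃⟧ (suc m ℕ.* suc n) ⟩
    (suc m ℕ.* suc n) · 1#             ≈⟨ ×1-homo-* (suc m) (suc n) ⟩
    M * N                              ≈⟨ -‿involutive _ ⟨
    - - (M * N)                        ≈⟨ -‿cong (-‿distribˡ-* _ _) ⟩
    - (- M * N)                        ≈⟨ -‿distribʳ-* _ _ ⟩
    - M * - N                          ∎
    where M = suc m · 1#
          N = suc n · 1#

  ℤ⟶R : ℤ.+-*-rawRing -Raw-AlmostCommutative⟶ fromCommutativeRing R
  ℤ⟶R = record
    { ⟦_⟧ = ⟦_⟧ ; +-homo = ⟦+⟧ ; *-homo = ⟦*⟧ ; -‿homo = ⟦-⟧ ; 0-homo = refl ; 1-homo = refl }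

  coeff≟ : ∀ i j → Maybe (⟦ i ⟧ ≈ ⟦ j ⟧)
  coeff≟ i j with i ℤ.≟ j
  ... | yes i≡j = just (reflexive (≡.cong ⟦_⟧ i≡j))
  ... | no  _   = nothing

  open Algebra.Solver.Ring ℤ.+-*-rawRing (fromCommutativeRing R) ℤ⟶R coeff≟ public
    using (solve; con; _:=_; _:+_; _:*_; _:-_; :-_; Polynomial)

  :1 : ∀ {n} → Polynomial n
  :1 = con (+ 1)

-- Polynomials as lists of terms

module FieldLemmas {c ℓ} (K : Field c ℓ) where
  open Field K hiding (zero)
  open ℤSolver commutativeRing using (solve; _:=_; _:*_)
  open Relation.Binary.Reasoning.Setoid setoid

  *-cancel-nonzero : ∀ {x y} → ¬ x ≈ 0# → x * y ≈ 0# → y ≈ 0#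
  *-cancel-nonzero {x} {y} x≉0 xy≈0 = begin
    y                      ≈⟨ *-identityˡ y ⟨
    1# * y                 ≈⟨ *-congʳ (inverse x x≉0) ⟨
    x * inv x x≉0 * y      ≈⟨ solve 3 (λ x i y → x :* i :* y := i :* (x :* y)) refl x (inv x x≉0) y ⟩
    inv x x≉0 * (x * y)    ≈⟨ *-congˡ xy≈0 ⟩
    inv x x≉0 * 0#         ≈⟨ zeroʳ _ ⟩
    0#                     ∎

module Polynomials {c ℓ} (K : Field c ℓ) where
  open Field K hiding (zero)
  open Arrangements K
  open Algebra.Properties.Ring ring using (-0#≈0#; -‿distribˡ-*; -‿+-comm)
  open Algebra.Properties.Group +-group using () renaming (x∙y⁻¹≈ε⇒x≈y to x-y≈0⇒x≈y; x≈y⇒x∙y⁻¹≈ε to x≈y⇒x-y≈0)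
  open ℤSolver commutativeRing using (solve; _:=_; _:*_; _:+_)
  open Relation.Binary.Reasoning.Setoid setoid

  infixl 6 _⊕_
  _⊕_ : ∀ {N} → Mon N → Mon N → Mon N
  _⊕_ = zipWith ℕ._+_

  unit : ∀ {N} → Fin N → Mon N
  unit k = tabulate (λ j → if does (j Fin.≟ k) then 1 else 0)

  _≟M_ : ∀ {N} (u v : Mon N) → Dec (u ≡ v)
  _≟M_ = VecP.≡-dec ℕ._≟_

  -- A polynomial is handled through the functionals Σ a y^u ↦ Σ a g(u) on it.
  pair : ∀ {N} → Poly N → (Mon N → Carrier) → Carrier
  pair []            g = 0#
  pair ((a , u) ∷ p) g = a * g u + pair p g

  dirac : ∀ {N} → Mon N → Mon N → Carrier
  dirac m u = if does (u ≟M m) then 1# else 0#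

  dirac-≡ : ∀ {N} (m u : Mon N) → u ≡ m → dirac m u ≈ 1#
  dirac-≡ m u u≡m rewrite dec-true (u ≟M m) u≡m = refl

  dirac-≢ : ∀ {N} (m u : Mon N) → u ≢ m → dirac m u ≈ 0#
  dirac-≢ m u u≢m rewrite dec-false (u ≟M m) u≢m = refl

  coeff≈pair : ∀ {N} (p : Poly N) m → coeff p m ≈ pair p (dirac m)
  coeff≈pair []            m = refl
  coeff≈pair ((a , u) ∷ p) m with u ≟M m
  ... | yes _ = +-cong (sym (*-identityʳ a)) (coeff≈pair p m)
  ... | no  _ = trans (coeff≈pair p m) (sym (trans (+-congʳ (zeroʳ a)) (+-identityˡ _)))

  pair-congʳ : ∀ {N} (p : Poly N) {g h} → (∀ u → g u ≈ h u) → pair p g ≈ pair p h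
  pair-congʳ []            e = refl
  pair-congʳ ((a , u) ∷ p) e = +-cong (*-congˡ (e u)) (pair-congʳ p e)

  pair-0 : ∀ {N} (p : Poly N) → pair p (λ _ → 0#) ≈ 0#
  pair-0 []            = refl
  pair-0 ((a , u) ∷ p) = trans (+-cong (zeroʳ a) (pair-0 p)) (+-identityˡ 0#)

  pair-+ : ∀ {N} (p : Poly N) g h → pair p (λ u → g u + h u) ≈ pair p g + pair p h
  pair-+ []            g h = sym (+-identityˡ 0#)
  pair-+ ((a , u) ∷ p) g h = trans (+-congˡ (pair-+ p g h))
    (solve 5 (λ a x y s t → a :* (x :+ y) :+ (s :+ t) := (a :* x :+ s) :+ (a :* y :+ t)) refl
      a (g u) (h u) (pair p g) (pair p h))

  pair-* : ∀ {N} (p : Poly N) b g → pair p (λ u → b * g u) ≈ b * pair p g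
  pair-* []            b g = sym (zeroʳ b)
  pair-* ((a , u) ∷ p) b g = trans (+-congˡ (pair-* p b g))
    (solve 4 (λ a b x s → a :* (b :* x) :+ b :* s := b :* (a :* x :+ s)) refl a b (g u) (pair p g))

  pair-swap : ∀ {M N} (p : Poly M) (q : Poly N) (h : Mon M → Mon N → Carrier) →
              pair p (λ u → pair q (h u)) ≈ pair q (λ v → pair p (λ u → h u v))
  pair-swap []            q h = sym (pair-0 q)
  pair-swap ((a , u) ∷ p) q h = begin
    a * pair q (h u) + pair p (λ u → pair q (h u))
      ≈⟨ +-cong (sym (pair-* q a (h u))) (pair-swap p q h) ⟩
    pair q (λ v → a * h u v) + pair q (λ v → pair p (λ u → h u v))
      ≈⟨ pair-+ q _ _ ⟨
    pair q (λ v → a * h u v + pair p (λ u → h u v)) ∎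

  pair-++ : ∀ {N} (p q : Poly N) g → pair (p ++ q) g ≈ pair p g + pair q g
  pair-++ []            q g = sym (+-identityˡ _)
  pair-++ ((a , u) ∷ p) q g = trans (+-congˡ (pair-++ p q g)) (sym (+-assoc _ _ _))

  pair-mul : ∀ {N} (p q : Poly N) g → pair (p *P q) g ≈ pair p (λ u → pair q (λ v → g (u ⊕ v)))
  pair-mul []            q g = refl
  pair-mul ((a , u) ∷ p) q g = trans (pair-++ (map _ q) (p *P q) g) (+-cong (term q) (pair-mul p q g))
    where
    term : ∀ q → pair (map (λ t → a * proj₁ t , u ⊕ proj₂ t) q) g ≈ a * pair q (λ v → g (u ⊕ v))
    term []            = sym (zeroʳ a)
    term ((b , v) ∷ q) = trans (+-congˡ (term q))
      (solve 4 (λ a b x s → a :* b :* x :+ a :* s := a :* (b :* x :+ s)) refl a b (g (u ⊕ v)) (pair q (λ v → g (u ⊕ v))))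

  negP : ∀ {N} → Poly N → Poly N
  negP = map (λ t → - proj₁ t , proj₂ t)

  pair-neg : ∀ {N} (p : Poly N) g → pair (negP p) g ≈ - pair p g
  pair-neg []            g = sym -0#≈0#
  pair-neg ((a , u) ∷ p) g = trans (+-cong (sym (-‿distribˡ-* a (g u))) (pair-neg p g)) (-‿+-comm _ _)

  private
    remove : ∀ {N} → Mon N → Poly N → Poly N
    remove u []            = []
    remove u ((a , v) ∷ p) with v ≟M u
    ... | yes _ = remove u p
    ... | no  _ = (a , v) ∷ remove u p

    length-remove : ∀ {N} (u : Mon N) p → length (remove u p) ℕ.≤ length p
    length-remove u []            = ℕ.z≤n
    length-remove u ((a , v) ∷ p) with v ≟M u
    ... | yes _ = ℕP.m≤n⇒m≤1+n (length-remove u p)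
    ... | no  _ = ℕ.s≤s (length-remove u p)

    pair-remove : ∀ {N} (u : Mon N) p g → pair p g ≈ coeff p u * g u + pair (remove u p) g
    pair-remove u []            g = sym (trans (+-identityʳ _) (zeroˡ _))
    pair-remove u ((a , v) ∷ p) g with v ≟M u
    ... | yes ≡.refl = trans (+-congˡ (pair-remove u p g))
            (solve 4 (λ a x k r → a :* x :+ (k :* x :+ r) := (a :+ k) :* x :+ r) refl a (g u) (coeff p u) (pair (remove u p) g))
    ... | no  _ = trans (+-congˡ (pair-remove u p g))
            (solve 3 (λ x y r → x :+ (y :+ r) := y :+ (x :+ r)) refl (a * g v) (coeff p u * g u) (pair (remove u p) g))

    coeff-remove-≡ : ∀ {N} (u : Mon N) p → coeff (remove u p) u ≈ 0#
    coeff-remove-≡ u []            = refl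
    coeff-remove-≡ u ((a , v) ∷ p) with v ≟M u
    ... | yes _ = coeff-remove-≡ u p
    ... | no v≢u rewrite dec-false (v ≟M u) v≢u = coeff-remove-≡ u p

    coeff-remove-≢ : ∀ {N} (u : Mon N) {w} p → w ≢ u → coeff (remove u p) w ≈ coeff p w
    coeff-remove-≢ u     []            w≢u = refl
    coeff-remove-≢ u {w} ((a , v) ∷ p) w≢u with v ≟M u
    ... | yes ≡.refl rewrite dec-false (u ≟M w) (λ e → w≢u (≡.sym e)) = coeff-remove-≢ u p w≢u
    ... | no  _ with does (v ≟M w)
    ...   | true  = +-congˡ (coeff-remove-≢ u p w≢u)
    ...   | false = coeff-remove-≢ u p w≢u

    -- A monomial may occur in several terms, so all terms carrying the monomial of the head are
    -- collected at once. What remains is shorter but not structurally smaller, hence the bound `n`.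
    pair-vanish′ : ∀ {N} n (p : Poly N) g → length p ℕ.≤ n →
                   (∀ u → coeff p u * g u ≈ 0#) → pair p g ≈ 0#
    pair-vanish′ n       []              g _ z = refl
    pair-vanish′ (suc n) p@((a , u) ∷ p′) g (ℕ.s≤s le) z = begin
      pair p g                            ≈⟨ pair-remove u p g ⟩
      coeff p u * g u + pair (remove u p) g ≈⟨ +-cong (z u) (pair-vanish′ n (remove u p) g len z′) ⟩
      0# + 0#                             ≈⟨ +-identityˡ 0# ⟩
      0#                                  ∎
      where
      len : length (remove u p) ℕ.≤ n
      len with u ≟M u
      ... | yes _  = ℕP.≤-trans (length-remove u p′) le
      ... | no u≢u = contradiction ≡.refl u≢u
      z′ : ∀ w → coeff (remove u p) w * g w ≈ 0#
      z′ w with w ≟M u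
      ... | yes ≡.refl = trans (*-congʳ (coeff-remove-≡ u p)) (zeroˡ _)
      ... | no w≢u     = trans (*-congʳ (coeff-remove-≢ u p w≢u)) (z w)

  pair-vanish : ∀ {N} (p : Poly N) g → (∀ u → coeff p u * g u ≈ 0#) → pair p g ≈ 0#
  pair-vanish p g = pair-vanish′ (length p) p g ℕP.≤-refl

  pair-ext : ∀ {N} {p q : Poly N} → (∀ g → pair p g ≈ pair q g) → p ≈P q
  pair-ext {p = p} {q} e m = trans (coeff≈pair p m) (trans (e (dirac m)) (sym (coeff≈pair q m)))

  coeff-+ : ∀ {N} (p q : Poly N) m → coeff (p +P q) m ≈ coeff p m + coeff q m
  coeff-+ p q m = trans (coeff≈pair (p ++ q) m)
    (trans (pair-++ p q _) (+-cong (sym (coeff≈pair p m)) (sym (coeff≈pair q m))))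

  coeff-neg : ∀ {N} (p : Poly N) m → coeff (negP p) m ≈ - coeff p m
  coeff-neg p m = trans (coeff≈pair (negP p) m) (trans (pair-neg p _) (-‿cong (sym (coeff≈pair p m))))

  -- All coefficients of `p − q` vanish, hence so does every functional on it. Together with
  -- `pair-ext` this makes `≈P` the same as agreement of all functionals, and the ring laws become
  -- identities between iterated sums.
  pair-congˡ : ∀ {N} {p q : Poly N} → p ≈P q → ∀ g → pair p g ≈ pair q g
  pair-congˡ {p = p} {q} p≈q g = x-y≈0⇒x≈y _ _ (begin
    pair p g - pair q g          ≈⟨ +-congˡ (pair-neg q g) ⟨
    pair p g + pair (negP q) g   ≈⟨ pair-++ p (negP q) g ⟨
    pair (p ++ negP q) g         ≈⟨ pair-vanish (p ++ negP q) g (λ u → trans (*-congʳ (diff u)) (zeroˡ _)) ⟩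
    0#                           ∎)
    where
    diff : ∀ u → coeff (p ++ negP q) u ≈ 0#
    diff u = trans (coeff-+ p (negP q) u) (trans (+-congˡ (coeff-neg q u)) (x≈y⇒x-y≈0 (p≈q u)))

  ⊕-identityˡ : ∀ {N} (u : Mon N) → replicate _ 0 ⊕ u ≡ u
  ⊕-identityˡ = VecP.zipWith-identityˡ ℕP.+-identityˡ

  ⊕-comm : ∀ {N} (u v : Mon N) → u ⊕ v ≡ v ⊕ u
  ⊕-comm = VecP.zipWith-comm ℕP.+-comm

  ⊕-assoc : ∀ {N} (u v w : Mon N) → (u ⊕ v) ⊕ w ≡ u ⊕ (v ⊕ w)
  ⊕-assoc = VecP.zipWith-assoc ℕP.+-assoc

  pair-const : ∀ {N} a (g : Mon N → Carrier) → pair (constP a) g ≈ a * g (replicate _ 0)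
  pair-const a g = +-identityʳ _

  polyRing : ℕ → CommutativeRing c ℓ
  polyRing N = record
    { Carrier = Poly N ; _≈_ = _≈P_ ; _+_ = _+P_ ; _*_ = _*P_ ; -_ = negP ; 0# = 0P ; 1# = constP 1#
    ; isCommutativeRing = record
      { isRing = record
        { +-isAbelianGroup = record
          { isGroup = record
            { isMonoid = record
              { isSemigroup = record
                { isMagma = record
                  { isEquivalence = record
                    { refl = λ m → refl ; sym = λ e m → sym (e m) ; trans = λ e f m → trans (e m) (f m) }
                  ; ∙-cong = λ {p} {q} {r} {s} e f → pair-ext {p = p +P r} {q +P s} λ g →
                      trans (pair-++ p r g) (trans (+-cong (pair-congˡ {p = p} {q} e g) (pair-congˡ {p = r} {s} f g)) (sym (pair-++ q s g)))
                  }
                ; assoc = λ p q r → pair-ext {p = (p +P q) +P r} {p +P (q +P r)} λ g → begin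
                    pair ((p ++ q) ++ r) g            ≈⟨ pair-++ (p ++ q) r g ⟩
                    pair (p ++ q) g + pair r g        ≈⟨ +-congʳ (pair-++ p q g) ⟩
                    pair p g + pair q g + pair r g    ≈⟨ +-assoc _ _ _ ⟩
                    pair p g + (pair q g + pair r g)  ≈⟨ +-congˡ (pair-++ q r g) ⟨
                    pair p g + pair (q ++ r) g        ≈⟨ pair-++ p (q ++ r) g ⟨
                    pair (p ++ (q ++ r)) g            ∎
                }
              ; identity = (λ p m → refl) , λ p → pair-ext {p = p +P 0P} {p} λ g → trans (pair-++ p [] g) (+-identityʳ _)
              }
            ; inverse = (λ p → pair-ext {p = negP p +P p} {0P} λ g →
                          trans (pair-++ (negP p) p g) (trans (+-congʳ (pair-neg p g)) (-‿inverseˡ _)))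
                      , (λ p → pair-ext {p = p +P negP p} {0P} λ g →
                          trans (pair-++ p (negP p) g) (trans (+-congˡ (pair-neg p g)) (-‿inverseʳ _)))
            ; ⁻¹-cong = λ {p} {q} e → pair-ext {p = negP p} {negP q} λ g →
                trans (pair-neg p g) (trans (-‿cong (pair-congˡ {p = p} {q} e g)) (sym (pair-neg q g)))
            }
          ; comm = λ p q → pair-ext {p = p +P q} {q +P p} λ g →
              trans (pair-++ p q g) (trans (+-comm _ _) (sym (pair-++ q p g)))
          }
        ; *-cong = λ {p} {q} {r} {s} e f → pair-ext {p = p *P r} {q *P s} λ g → begin
            pair (p *P r) g                             ≈⟨ pair-mul p r g ⟩
            pair p (λ u → pair r (λ v → g (u ⊕ v)))     ≈⟨ pair-congˡ {p = p} {q} e _ ⟩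
            pair q (λ u → pair r (λ v → g (u ⊕ v)))     ≈⟨ pair-congʳ q (λ u → pair-congˡ {p = r} {s} f _) ⟩
            pair q (λ u → pair s (λ v → g (u ⊕ v)))     ≈⟨ pair-mul q s g ⟨
            pair (q *P s) g                             ∎
        ; *-assoc = λ p q r → pair-ext {p = (p *P q) *P r} {p *P (q *P r)} λ g → begin
            pair ((p *P q) *P r) g                      ≈⟨ pair-mul (p *P q) r g ⟩
            pair (p *P q) (λ u → pair r (λ w → g (u ⊕ w)))  ≈⟨ pair-mul p q _ ⟩
            pair p (λ u → pair q (λ v → pair r (λ w → g (u ⊕ v ⊕ w))))
              ≈⟨ pair-congʳ p (λ u → pair-congʳ q (λ v → pair-congʳ r (λ w → reflexive (≡.cong g (⊕-assoc u v w))))) ⟩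
            pair p (λ u → pair q (λ v → pair r (λ w → g (u ⊕ (v ⊕ w)))))
              ≈⟨ pair-congʳ p (λ u → pair-mul q r _) ⟨
            pair p (λ u → pair (q *P r) (λ v → g (u ⊕ v)))  ≈⟨ pair-mul p (q *P r) g ⟨
            pair (p *P (q *P r)) g                      ∎
        ; *-identity = (λ p → trans-comm p) , λ p m → trans (mul-comm p (constP 1#) m) (trans-comm p m)
        ; distrib = (λ p q r m → trans (mul-comm p (q +P r) m) (trans (distribʳ′ p q r m)
                       (trans (coeff-+ (q *P p) (r *P p) m) (trans (+-cong (mul-comm q p m) (mul-comm r p m)) (sym (coeff-+ (p *P q) (p *P r) m))))))
                  , distribʳ′
        }
      ; *-comm = mul-comm
      }
    }
    where
    mul-comm : ∀ p q → (p *P q) ≈P (q *P p)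
    mul-comm p q = pair-ext {p = p *P q} {q *P p} λ g → begin
      pair (p *P q) g                          ≈⟨ pair-mul p q g ⟩
      pair p (λ u → pair q (λ v → g (u ⊕ v)))  ≈⟨ pair-swap p q _ ⟩
      pair q (λ v → pair p (λ u → g (u ⊕ v)))  ≈⟨ pair-congʳ q (λ v → pair-congʳ p (λ u → reflexive (≡.cong g (⊕-comm u v)))) ⟩
      pair q (λ v → pair p (λ u → g (v ⊕ u)))  ≈⟨ pair-mul q p g ⟨
      pair (q *P p) g                          ∎
    trans-comm : ∀ p → (constP 1# *P p) ≈P p
    trans-comm p = pair-ext {p = constP 1# *P p} {p} λ g → begin
      pair (constP 1# *P p) g                    ≈⟨ pair-mul (constP 1#) p g ⟩
      pair (constP 1#) (λ u → pair p (λ v → g (u ⊕ v)))  ≈⟨ pair-const 1# (λ u → pair p (λ v → g (u ⊕ v))) ⟩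
      1# * pair p (λ v → g (replicate _ 0 ⊕ v))  ≈⟨ *-identityˡ _ ⟩
      pair p (λ v → g (replicate _ 0 ⊕ v))       ≈⟨ pair-congʳ p (λ v → reflexive (≡.cong g (⊕-identityˡ v))) ⟩
      pair p g                                   ∎
    distribʳ′ : ∀ p q r → ((q +P r) *P p) ≈P ((q *P p) +P (r *P p))
    distribʳ′ p q r = pair-ext {p = (q +P r) *P p} {(q *P p) +P (r *P p)} λ g → begin
      pair ((q ++ r) *P p) g             ≈⟨ pair-mul (q ++ r) p g ⟩
      pair (q ++ r) _                    ≈⟨ pair-++ q r _ ⟩
      pair q _ + pair r _                ≈⟨ +-cong (pair-mul q p g) (pair-mul r p g) ⟨
      pair (q *P p) g + pair (r *P p) g  ≈⟨ pair-++ (q *P p) (r *P p) g ⟨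
      pair ((q *P p) ++ (r *P p)) g      ∎

-- Divisibility in a commutative ring

module Divisibility {a b} (R : CommutativeRing a b) where
  open CommutativeRing R hiding (zero)
  open ℤSolver R

  infix 4 _∣_
  _∣_ : Carrier → Carrier → Set (a ⊔ b)
  g ∣ f = ∃ λ h → f ≈ g * h

  ∣-resp : ∀ {g g′ f f′} → g ≈ g′ → f ≈ f′ → g ∣ f → g′ ∣ f′
  ∣-resp g≈ f≈ (h , e) = h , trans (sym f≈) (trans e (*-congʳ g≈))

  ∣-respʳ : ∀ {g f f′} → f ≈ f′ → g ∣ f → g ∣ f′
  ∣-respʳ = ∣-resp refl

  ∣-0 : ∀ g → g ∣ 0#
  ∣-0 g = 0# , sym (zeroʳ g)

  ∣-refl : ∀ g → g ∣ g
  ∣-refl g = 1# , sym (*-identityʳ g)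

  ∣-+ : ∀ {g x y} → g ∣ x → g ∣ y → g ∣ x + y
  ∣-+ {g} (h , e) (k , f) = h + k , trans (+-cong e f) (sym (distribˡ g h k))

  ∣-*ʳ : ∀ {g x} → g ∣ x → ∀ y → g ∣ x * y
  ∣-*ʳ {g} (h , e) y = h * y , trans (*-congʳ e) (*-assoc g h y)

  ∣-*ˡ : ∀ {g y} x → g ∣ y → g ∣ x * y
  ∣-*ˡ x d = ∣-respʳ (*-comm _ _) (∣-*ʳ d x)

  ∣-neg : ∀ {g x} → g ∣ x → g ∣ - x
  ∣-neg {g} (h , e) = - h , trans (-‿cong e) (solve 2 (λ g h → :- (g :* h) := g :* :- h) refl g h)

  ∣-- : ∀ {g x y} → g ∣ x → g ∣ y → g ∣ x - y
  ∣-- d e = ∣-+ d (∣-neg e)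

  ∣-sym-diff : ∀ {g x y} → g ∣ x - y → g ∣ y - x
  ∣-sym-diff {x = x} {y} d = ∣-respʳ (solve 2 (λ x y → :- (x :- y) := y :- x) refl x y) (∣-neg d)

  ∣-mul-diff : ∀ {g x x′ y y′} → g ∣ x - x′ → g ∣ y - y′ → g ∣ x * y - x′ * y′
  ∣-mul-diff {x = x} {x′} {y} {y′} d e = ∣-respʳ
    (solve 4 (λ x x′ y y′ → (x :- x′) :* y :+ x′ :* (y :- y′) := x :* y :- x′ :* y′) refl x x′ y y′)
    (∣-+ (∣-*ʳ d y) (∣-*ˡ x′ e))

  pow : Carrier → ℕ → Carrier
  pow x zero    = 1#
  pow x (suc n) = x * pow x n

  pow-+ : ∀ x m n → pow x (m ℕ.+ n) ≈ pow x m * pow x n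
  pow-+ x zero    n = sym (*-identityˡ _)
  pow-+ x (suc m) n = trans (*-congˡ (pow-+ x m n)) (sym (*-assoc _ _ _))

  ∣-pow : ∀ x y n → x - y ∣ pow x n - pow y n
  ∣-pow x y zero    = ∣-respʳ (sym (-‿inverseʳ 1#)) (∣-0 _)
  ∣-pow x y (suc n) = ∣-mul-diff (∣-refl _) (∣-pow x y n)

-- The polynomial ring K[y₁,…,y_N], abstracted from its representation by lists of terms.
record PolyLike {c ℓ} (K : Field c ℓ) (N : ℕ) : Set (lsuc (c ⊔ ℓ)) where
  private module K = Field K
  field
    R : CommutativeRing c ℓ
  open CommutativeRing R public hiding (zero)
  open Divisibility R public
  field
    ∑       : ∀ {m} → (Fin m → Carrier) → Carrier
    ∑-zero  : (f : Fin 0 → Carrier) → ∑ f ≈ 0#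
    ∑-suc   : ∀ {m} (f : Fin (suc m) → Carrier) → ∑ f ≈ f zero + ∑ (f ∘ suc)
    ι       : K.Carrier → Carrier
    ι-cong  : ∀ {a b} → a K.≈ b → ι a ≈ ι b
    ι-0     : ι K.0# ≈ 0#
    ι-1     : ι K.1# ≈ 1#
    ι-+     : ∀ a b → ι (a K.+ b) ≈ ι a + ι b
    ι-*     : ∀ a b → ι (a K.* b) ≈ ι a * ι b
    y       : Fin N → Carrier
    Homog   : ℕ → Carrier → Set ℓ
    homog-cong : ∀ {d f g} → f ≈ g → Homog d f → Homog d g
    homog-0 : ∀ d → Homog d 0#
    homog-+ : ∀ {d f g} → Homog d f → Homog d g → Homog d (f + g)
    homog-* : ∀ {d e f g} → Homog d f → Homog e g → Homog (d ℕ.+ e) (f * g)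
    homog-ι : ∀ a → Homog 0 (ι a)
    homog-y : ∀ k → Homog 1 (y k)

  lin : (Fin N → K.Carrier) → Carrier
  lin α = ∑ (λ k → ι (α k) * y k)

  field
    regular : ∀ γ k → ¬ γ k K.≈ K.0# → ∀ g → lin γ * g ≈ 0# → g ≈ 0#
    -- the endomorphism y_s ↦ r, y_k ↦ y_k (k ≠ s)
    subst       : Fin N → Carrier → Carrier → Carrier
    subst-cong  : ∀ s r {f g} → f ≈ g → subst s r f ≈ subst s r g
    subst-+     : ∀ s r f g → subst s r (f + g) ≈ subst s r f + subst s r g
    subst-*     : ∀ s r f g → subst s r (f * g) ≈ subst s r f * subst s r g
    subst-ι     : ∀ s r a → subst s r (ι a) ≈ ι a
    subst-y-≡   : ∀ s r → subst s r (y s) ≈ r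
    subst-y-≢   : ∀ s r k → k ≢ s → subst s r (y k) ≈ y k
    subst-diff  : ∀ s r f → y s - r ∣ f - subst s r f

module Instance {c ℓ} (K : Field c ℓ) (N : ℕ) where
  open Field K hiding (zero)
  open Arrangements K
  open FieldLemmas K
  open Polynomials K
  private
    module P = CommutativeRing (polyRing N)
    module S = ℤSolver (polyRing N)
    module PR = Relation.Binary.Reasoning.Setoid P.setoid
  open Divisibility (polyRing N)
  open ℤSolver commutativeRing using (solve; _:=_; _:*_; _:+_; _:-_; :-_)
  open Relation.Binary.Reasoning.Setoid setoid

  mon : Mon N → Poly N
  mon u = (1# , u) ∷ []

  pair-mon : ∀ u g → pair (mon u) g ≈ g u
  pair-mon u g = trans (+-identityʳ _) (*-identityˡ _)

  pair-scale : ∀ a (p : Poly N) g → pair (constP a *P p) g ≈ a * pair p g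
  pair-scale a p g = begin
    pair (constP a *P p) g                     ≈⟨ pair-mul (constP a) p g ⟩
    pair (constP a) (λ u → pair p (λ v → g (u ⊕ v))) ≈⟨ pair-const a (λ u → pair p (λ v → g (u ⊕ v))) ⟩
    a * pair p (λ v → g (replicate _ 0 ⊕ v))   ≈⟨ *-congˡ (pair-congʳ p (λ v → reflexive (≡.cong g (⊕-identityˡ v)))) ⟩
    a * pair p g                               ∎

  private
    ext : ∀ {p q : Poly N} → (∀ g → pair p g ≈ pair q g) → p ≈P q
    ext {p} {q} = pair-ext {p = p} {q}

  const-cong : ∀ {a b} → a ≈ b → constP {N} a ≈P constP b
  const-cong {a} {b} e = ext {constP a} {constP b} λ g → +-congʳ (*-congʳ e)

  const-0 : constP {N} 0# ≈P 0P
  const-0 = ext {constP 0#} {0P} λ g → trans (+-identityʳ _) (zeroˡ _)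

  const-+ : ∀ a b → constP {N} (a + b) ≈P (constP a +P constP b)
  const-+ a b = ext {constP (a + b)} {constP a +P constP b} λ g →
    solve 3 (λ a b x → (a :+ b) :* x :+ con (+ 0) := a :* x :+ (b :* x :+ con (+ 0))) refl a b (g (replicate _ 0))
    where open ℤSolver commutativeRing using (con)

  const-* : ∀ a b → constP {N} (a * b) ≈P (constP a *P constP b)
  const-* a b = ext {constP (a * b)} {constP a *P constP b} λ g → begin
    pair (constP (a * b)) g         ≈⟨ pair-const (a * b) g ⟩
    a * b * g (replicate _ 0)       ≈⟨ *-assoc _ _ _ ⟩
    a * (b * g (replicate _ 0))     ≈⟨ *-congˡ (pair-const b g) ⟨
    a * pair (constP b) g           ≈⟨ pair-scale a (constP b) g ⟨
    pair (constP a *P constP b) g   ∎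

  lookup-⊕ : ∀ k (u v : Mon N) → lookup (u ⊕ v) k ≡ lookup u k ℕ.+ lookup v k
  lookup-⊕ k u v = VecP.lookup-zipWith ℕ._+_ k u v

  sum-⊕ : ∀ {M} (u v : Mon M) → Vec.sum (u ⊕ v) ≡ Vec.sum u ℕ.+ Vec.sum v
  sum-⊕ []      []      = ≡.refl
  sum-⊕ (a ∷ u) (b ∷ v) = ≡.trans (≡.cong (a ℕ.+ b ℕ.+_) (sum-⊕ u v)) (+-interchange a b (Vec.sum u) (Vec.sum v))
    where open Algebra.Properties.CommutativeSemigroup ℕP.+-commutativeSemigroup using () renaming (interchange to +-interchange)

  sum-zeros : ∀ M → Vec.sum (replicate M 0) ≡ 0
  sum-zeros zero    = ≡.refl
  sum-zeros (suc M) = sum-zeros M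

  sum-unit : ∀ {M} (k : Fin M) → Vec.sum (unit k) ≡ 1
  sum-unit {suc M} zero    = ≡.cong suc (≡.trans (≡.cong Vec.sum (tabulate-const M)) (sum-zeros M))
    where
    tabulate-const : ∀ M → tabulate {n = M} (λ _ → 0) ≡ replicate M 0
    tabulate-const zero    = ≡.refl
    tabulate-const (suc M) = ≡.cong (0 ∷_) (tabulate-const M)
  sum-unit (suc k) = sum-unit k

  lookup-unit-≡ : ∀ (k : Fin N) → lookup (unit k) k ≡ 1
  lookup-unit-≡ k = ≡.trans (VecP.lookup∘tabulate _ k) (≡.cong (if_then 1 else 0) (dec-true (k Fin.≟ k) ≡.refl))

  lookup-unit-≢ : ∀ {k j : Fin N} → j ≢ k → lookup (unit k) j ≡ 0
  lookup-unit-≢ {k} {j} j≢k = ≡.trans (VecP.lookup∘tabulate _ j) (≡.cong (if_then 1 else 0) (dec-false (j Fin.≟ k) j≢k))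

  lookup≤sum : ∀ {M} (u : Mon M) k → lookup u k ℕ.≤ Vec.sum u
  lookup≤sum (a ∷ u) zero    = ℕP.m≤m+n a _
  lookup≤sum (a ∷ u) (suc k) = ℕP.≤-trans (lookup≤sum u k) (ℕP.m≤n+m _ a)

  homogP-vanish : ∀ {d p} g → HomogP {N} d p → (∀ u → Vec.sum u ≡ d → g u ≈ 0#) → pair p g ≈ 0#
  homogP-vanish {d} {p} g hom z = pair-vanish p g go
    where
    go : ∀ u → coeff p u * g u ≈ 0#
    go u with Vec.sum u ℕ.≟ d
    ... | yes e = trans (*-congˡ (z u e)) (zeroʳ _)
    ... | no ne = trans (*-congʳ (hom u ne)) (zeroˡ _)

  homogP-* : ∀ {d e} p q → HomogP {N} d p → HomogP e q → HomogP (d ℕ.+ e) (p *P q)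
  homogP-* {d} {e} p q hp hq m m≢ = begin
    coeff (p *P q) m                                ≈⟨ coeff≈pair (p *P q) m ⟩
    pair (p *P q) (dirac m)                         ≈⟨ pair-mul p q _ ⟩
    pair p (λ u → pair q (λ v → dirac m (u ⊕ v)))
      ≈⟨ homogP-vanish {d} {p} _ hp (λ u eu → homogP-vanish {e} {q} _ hq (λ v ev →
           dirac-≢ m (u ⊕ v) (λ uv≡m → m≢ (≡.trans (≡.sym (≡.cong Vec.sum uv≡m)) (≡.trans (sum-⊕ u v) (≡.cong₂ ℕ._+_ eu ev)))))) ⟩
    0#                                              ∎

  homogP-term : ∀ a (u : Mon N) → HomogP (Vec.sum u) ((a , u) ∷ [])
  homogP-term a u m m≢ with u ≟M m
  ... | yes u≡m = contradiction (≡.cong Vec.sum (≡.sym u≡m)) m≢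
  ... | no  _   = refl

  homogP-const : ∀ a → HomogP {N} 0 (constP a)
  homogP-const a = ≡.subst (λ d → HomogP {N} d (constP a)) (sum-zeros N) (homogP-term a (replicate N 0))

  homogP-var : ∀ k → HomogP {N} 1 (var k)
  homogP-var k = ≡.subst (λ d → HomogP {N} d (var k)) (sum-unit k) (homogP-term 1# (unit k))

  pair-sumF : ∀ {m} (f : Fin m → Poly N) g (h : Fin m → Carrier) → (∀ i → pair (f i) g ≈ h i) →
              ∀ k → (∀ i → i ≢ k → h i ≈ 0#) → pair (sumF f) g ≈ h k
  pair-sumF {suc m} f g h e zero z = begin
    pair (f zero ++ sumF (f ∘ suc)) g        ≈⟨ pair-++ (f zero) _ g ⟩
    pair (f zero) g + pair (sumF (f ∘ suc)) g ≈⟨ +-cong (e zero) (all-zero (f ∘ suc) λ i → trans (e (suc i)) (z (suc i) λ ())) ⟩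
    h zero + 0#                              ≈⟨ +-identityʳ _ ⟩
    h zero                                   ∎
    where
    all-zero : ∀ {m} (f : Fin m → Poly N) → (∀ i → pair (f i) g ≈ 0#) → pair (sumF f) g ≈ 0#
    all-zero {zero}  f z = refl
    all-zero {suc m} f z = trans (pair-++ (f zero) _ g) (trans (+-cong (z zero) (all-zero (f ∘ suc) (z ∘ suc))) (+-identityˡ 0#))
  pair-sumF {suc m} f g h e (suc k) z = begin
    pair (f zero ++ sumF (f ∘ suc)) g        ≈⟨ pair-++ (f zero) _ g ⟩
    pair (f zero) g + pair (sumF (f ∘ suc)) g
      ≈⟨ +-cong (trans (e zero) (z zero λ ())) (pair-sumF (f ∘ suc) g (h ∘ suc) (e ∘ suc) k (λ i i≢k → z (suc i) (i≢k ∘ FinP.suc-injective))) ⟩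
    0# + h (suc k)                           ≈⟨ +-identityˡ _ ⟩
    h (suc k)                                ∎

  pair-linterm : ∀ a k g → pair (constP a *P var k) g ≈ a * g (unit k)
  pair-linterm a k g = trans (pair-scale a (var k) g) (*-congˡ (pair-mon (unit k) g))

  -- The coefficient of γ g at m + e_k, when γ_k ≠ 0, gives coeff g m in terms of
  -- coefficients at monomials of the same degree with a larger exponent of y_k.
  linPoly-regular : ∀ γ k → ¬ γ k ≈ 0# → ∀ g → (linPoly γ *P g) ≈P 0P → g ≈P 0P
  linPoly-regular γ k γk≉0 g γg≈0 m = coeff≈0 (Vec.sum m ℕ.∸ lookup m k) m (ℕP.m+[n∸m]≡n (lookup≤sum m k))
    where
    coeff≈0 : ∀ n m → lookup m k ℕ.+ n ≡ Vec.sum m → coeff g m ≈ 0#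
    coeff≈0 n m eq = *-cancel-nonzero γk≉0 (begin
      γ k * coeff g m                    ≈⟨ *-congˡ (coeff≈pair g m) ⟩
      γ k * pair g (dirac m)             ≈⟨ *-congˡ (pair-congʳ g shift) ⟨
      h k                                ≈⟨ pair-sumF (λ i → constP (γ i) *P var i) G h (λ i → pair-linterm (γ i) i G) k other ⟨
      pair (linPoly γ) G                 ≈⟨ pair-mul (linPoly γ) g _ ⟨
      pair (linPoly γ *P g) (dirac M)    ≈⟨ coeff≈pair (linPoly γ *P g) M ⟨
      coeff (linPoly γ *P g) M           ≈⟨ γg≈0 M ⟩
      0#                                 ∎)
      where
      M = unit k ⊕ m
      G : Mon N → Carrier
      G u = pair g (λ v → dirac M (u ⊕ v))
      h : Fin N → Carrier
      h i = γ i * G (unit i)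
      shift : ∀ v → dirac M (unit k ⊕ v) ≈ dirac m v
      shift v with v ≟M m
      ... | yes ≡.refl = dirac-≡ M (unit k ⊕ v) ≡.refl
      ... | no v≢m     = dirac-≢ M (unit k ⊕ v) (λ e → v≢m (⊕-cancel (unit k) e))
        where
        ⊕-cancel : ∀ {M} (u : Mon M) {v w} → u ⊕ v ≡ u ⊕ w → v ≡ w
        ⊕-cancel [] {[]} {[]} _ = ≡.refl
        ⊕-cancel (a ∷ u) {b ∷ v} {c ∷ w} e =
          ≡.cong₂ _∷_ (ℕP.+-cancelˡ-≡ a b c (VecP.∷-injectiveˡ e)) (⊕-cancel u (VecP.∷-injectiveʳ e))
      smaller : ∀ i → i ≢ k → ∀ v → unit i ⊕ v ≡ M → coeff g v ≈ 0#
      smaller i i≢k v e = descend n eq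
        where
        sum-eq : Vec.sum v ≡ Vec.sum m
        sum-eq = ℕP.suc-injective (≡.trans (≡.sym (≡.trans (sum-⊕ (unit i) v) (≡.cong (ℕ._+ Vec.sum v) (sum-unit i))))
                   (≡.trans (≡.cong Vec.sum e) (≡.trans (sum-⊕ (unit k) m) (≡.cong (ℕ._+ Vec.sum m) (sum-unit k)))))
        lookup-eq : lookup v k ≡ suc (lookup m k)
        lookup-eq = ≡.trans (≡.sym (≡.trans (lookup-⊕ k (unit i) v) (≡.cong (ℕ._+ lookup v k) (lookup-unit-≢ (i≢k ∘ ≡.sym)))))
                      (≡.trans (≡.cong (λ w → lookup w k) e) (≡.trans (lookup-⊕ k (unit k) m) (≡.cong (ℕ._+ lookup m k) (lookup-unit-≡ k))))
        descend : ∀ n → lookup m k ℕ.+ n ≡ Vec.sum m → coeff g v ≈ 0#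
        -- Here `y_k` already carries the whole degree of `m`, and `v` would have an exponent larger
        -- than its degree.
        descend zero eq = contradiction (lookup≤sum v k) (ℕP.<⇒≱ (≡.subst₂ ℕ._<_
          (≡.trans (≡.sym (ℕP.+-identityʳ _)) (≡.trans eq (≡.sym sum-eq))) (≡.sym lookup-eq) (ℕP.n<1+n _)))
        descend (suc n) eq = coeff≈0 n v (≡.trans (≡.cong (ℕ._+ n) lookup-eq)
          (≡.trans (≡.sym (ℕP.+-suc _ n)) (≡.trans eq (≡.sym sum-eq))))
      other : ∀ i → i ≢ k → h i ≈ 0#
      other i i≢k = trans (*-congˡ (pair-vanish g _ go)) (zeroʳ _)
        where
        go : ∀ v → coeff g v * dirac M (unit i ⊕ v) ≈ 0#
        go v with (unit i ⊕ v) ≟M M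
        ... | yes e = trans (*-congʳ (smaller i i≢k v e)) (zeroˡ _)
        ... | no ne = zeroʳ _

  private
    mono : Fin N → Poly N → Mon N → Poly N
    mono s r u = pow r (lookup u s) *P mon (u [ s ]≔ 0)

  substP : Fin N → Poly N → Poly N → Poly N
  substP s r []            = 0P
  substP s r ((a , u) ∷ p) = (constP a *P mono s r u) +P substP s r p

  private
    pair-substP : ∀ s r p g → pair (substP s r p) g ≈ pair p (λ u → pair (mono s r u) g)
    pair-substP s r []            g = refl
    pair-substP s r ((a , u) ∷ p) g =
      trans (pair-++ (constP a *P mono s r u) _ g) (+-cong (pair-scale a (mono s r u) g) (pair-substP s r p g))

    mon-⊕ : ∀ u v → mon (u ⊕ v) ≈P (mon u *P mon v)
    mon-⊕ u v = ext {mon (u ⊕ v)} {mon u *P mon v} λ g → begin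
      pair (mon (u ⊕ v)) g                                 ≈⟨ pair-mon (u ⊕ v) g ⟩
      g (u ⊕ v)                                            ≈⟨ pair-mon v (λ w → g (u ⊕ w)) ⟨
      pair (mon v) (λ w → g (u ⊕ w))                       ≈⟨ pair-mon u (λ z → pair (mon v) (λ w → g (z ⊕ w))) ⟨
      pair (mon u) (λ z → pair (mon v) (λ w → g (z ⊕ w)))  ≈⟨ pair-mul (mon u) (mon v) g ⟨
      pair (mon u *P mon v) g                              ∎

    ≔0-⊕ : ∀ {M} (u v : Mon M) s → (u ⊕ v) [ s ]≔ 0 ≡ (u [ s ]≔ 0) ⊕ (v [ s ]≔ 0)
    ≔0-⊕ (a ∷ u) (b ∷ v) zero    = ≡.refl
    ≔0-⊕ (a ∷ u) (b ∷ v) (suc s) = ≡.cong (a ℕ.+ b ∷_) (≔0-⊕ u v s)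

    mono-⊕ : ∀ s r u v → mono s r (u ⊕ v) ≈P (mono s r u *P mono s r v)
    mono-⊕ s r u v = PR.begin
      pow r (lookup (u ⊕ v) s) *P mon ((u ⊕ v) [ s ]≔ 0)
        PR.≡⟨ ≡.cong₂ (λ n w → pow r n *P mon w) (lookup-⊕ s u v) (≔0-⊕ u v s) ⟩
      pow r (lookup u s ℕ.+ lookup v s) *P mon ((u [ s ]≔ 0) ⊕ (v [ s ]≔ 0))
        PR.≈⟨ P.*-cong {pow r (lookup u s ℕ.+ lookup v s)} {A *P B} {mon ((u [ s ]≔ 0) ⊕ (v [ s ]≔ 0))} {C *P D}
              (pow-+ r (lookup u s) (lookup v s)) (mon-⊕ (u [ s ]≔ 0) (v [ s ]≔ 0)) ⟩
      (A *P B) *P (C *P D)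
        PR.≈⟨ S.solve 4 (λ A B C D → (A S.:* B) S.:* (C S.:* D) S.:= (A S.:* C) S.:* (B S.:* D)) (λ {_} m → refl) A B C D ⟩
      mono s r u *P mono s r v PR.∎
      where
      A = pow r (lookup u s)
      B = pow r (lookup v s)
      C = mon (u [ s ]≔ 0)
      D = mon (v [ s ]≔ 0)

    pow-var : ∀ s n u → (pow (var s) n *P mon (u [ s ]≔ 0)) ≈P mon (u [ s ]≔ n)
    pow-var s zero    u = P.*-identityˡ (mon (u [ s ]≔ 0))
    pow-var s (suc n) u = PR.begin
      (var s *P pow (var s) n) *P mon (u [ s ]≔ 0)  PR.≈⟨ P.*-assoc (var s) (pow (var s) n) (mon (u [ s ]≔ 0)) ⟩
      var s *P (pow (var s) n *P mon (u [ s ]≔ 0))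
        PR.≈⟨ P.*-congˡ {var s} {pow (var s) n *P mon (u [ s ]≔ 0)} {mon (u [ s ]≔ n)} (pow-var s n u) ⟩
      var s *P mon (u [ s ]≔ n)                     PR.≈⟨ mon-⊕ (unit s) (u [ s ]≔ n) ⟨
      mon (unit s ⊕ (u [ s ]≔ n))                   PR.≡⟨ ≡.cong mon (unit-⊕-≔ s u) ⟩
      mon (u [ s ]≔ suc n)                          PR.∎
      where
      zeros-⊕ : ∀ {M} (u : Mon M) → tabulate (λ _ → 0) ⊕ u ≡ u
      zeros-⊕ []      = ≡.refl
      zeros-⊕ (a ∷ u) = ≡.cong (a ∷_) (zeros-⊕ u)
      unit-⊕-≔ : ∀ {M} (s : Fin M) u → unit s ⊕ (u [ s ]≔ n) ≡ u [ s ]≔ suc n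
      unit-⊕-≔ zero    (a ∷ u) = ≡.cong (suc n ∷_) (zeros-⊕ u)
      unit-⊕-≔ (suc s) (a ∷ u) = ≡.cong (a ∷_) (unit-⊕-≔ s u)

    mono-var : ∀ s u → mono s (var s) u ≈P mon u
    mono-var s u = PR.begin
      mono s (var s) u            PR.≈⟨ pow-var s (lookup u s) u ⟩
      mon (u [ s ]≔ lookup u s)   PR.≡⟨ ≡.cong mon (VecP.[]≔-lookup u s) ⟩
      mon u                       PR.∎

  substP-cong : ∀ s r {p q} → p ≈P q → substP s r p ≈P substP s r q
  substP-cong s r {p} {q} e = ext {substP s r p} {substP s r q} λ g →
    trans (pair-substP s r p g) (trans (pair-congˡ {p = p} {q} e _) (sym (pair-substP s r q g)))

  substP-+ : ∀ s r p q → substP s r (p +P q) ≈P (substP s r p +P substP s r q)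
  substP-+ s r p q = ext {substP s r (p +P q)} {substP s r p +P substP s r q} λ g → begin
    pair (substP s r (p ++ q)) g                          ≈⟨ pair-substP s r (p ++ q) g ⟩
    pair (p ++ q) (λ u → pair (mono s r u) g)             ≈⟨ pair-++ p q _ ⟩
    pair p _ + pair q _                                   ≈⟨ +-cong (pair-substP s r p g) (pair-substP s r q g) ⟨
    pair (substP s r p) g + pair (substP s r q) g         ≈⟨ pair-++ (substP s r p) (substP s r q) g ⟨
    pair (substP s r p ++ substP s r q) g                 ∎

  substP-* : ∀ s r p q → substP s r (p *P q) ≈P (substP s r p *P substP s r q)
  substP-* s r p q = ext {substP s r (p *P q)} {substP s r p *P substP s r q} λ g → begin
    pair (substP s r (p *P q)) g
      ≈⟨ pair-substP s r (p *P q) g ⟩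
    pair (p *P q) (λ u → pair (mono s r u) g)
      ≈⟨ pair-mul p q _ ⟩
    pair p (λ u → pair q (λ v → pair (mono s r (u ⊕ v)) g))
      ≈⟨ pair-congʳ p (λ u → pair-congʳ q (λ v → trans
           (pair-congˡ {p = mono s r (u ⊕ v)} {mono s r u *P mono s r v} (mono-⊕ s r u v) g) (pair-mul (mono s r u) (mono s r v) g))) ⟩
    pair p (λ u → pair q (λ v → pair (mono s r u) (λ a → pair (mono s r v) (λ b → g (a ⊕ b)))))
      ≈⟨ pair-congʳ p (λ u → pair-swap q (mono s r u) _) ⟩
    pair p (λ u → pair (mono s r u) (λ a → pair q (λ v → pair (mono s r v) (λ b → g (a ⊕ b)))))
      ≈⟨ pair-congʳ p (λ u → pair-congʳ (mono s r u) (λ a → pair-substP s r q (λ b → g (a ⊕ b)))) ⟨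
    pair p (λ u → pair (mono s r u) (λ a → pair (substP s r q) (λ b → g (a ⊕ b))))
      ≈⟨ pair-substP s r p (λ a → pair (substP s r q) (λ b → g (a ⊕ b))) ⟨
    pair (substP s r p) (λ a → pair (substP s r q) (λ b → g (a ⊕ b)))
      ≈⟨ pair-mul (substP s r p) (substP s r q) g ⟨
    pair (substP s r p *P substP s r q) g ∎

  substP-const : ∀ s r a → substP s r (constP a) ≈P constP a
  substP-const s r a = ext {substP s r (constP a)} {constP a} λ g → begin
    pair (substP s r (constP a)) g              ≈⟨ pair-substP s r (constP a) g ⟩
    a * pair (mono s r (replicate N 0)) g + 0#  ≈⟨ +-congʳ (*-congˡ (pair-congˡ {p = mono s r (replicate N 0)} {mon (replicate N 0)} mono-0 g)) ⟩
    a * pair (mon (replicate N 0)) g + 0#       ≈⟨ +-congʳ (*-congˡ (pair-mon (replicate N 0) g)) ⟩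
    a * g (replicate N 0) + 0#                  ∎
    where
    ≔0 : ∀ {M} (s : Fin M) → replicate M 0 [ s ]≔ 0 ≡ replicate M 0
    ≔0 zero    = ≡.refl
    ≔0 (suc s) = ≡.cong (0 ∷_) (≔0 s)
    mono-0 : mono s r (replicate N 0) ≈P mon (replicate N 0)
    mono-0 rewrite VecP.lookup-replicate s 0 | ≔0 s = P.*-identityˡ (mon (replicate N 0))

  substP-mon : ∀ s r u → substP s r (mon u) ≈P mono s r u
  substP-mon s r u = ext {substP s r (mon u)} {mono s r u} λ g →
    trans (pair-substP s r (mon u) g) (pair-mon u (λ u → pair (mono s r u) g))

  substP-var-≡ : ∀ s r → substP s r (var s) ≈P r
  substP-var-≡ s r = P.trans {substP s r (var s)} {mono s r (unit s)} {r} (substP-mon s r (unit s)) (go (unit s) (lookup-unit-≡ s) (≔0 s))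
    where
    ≔0 : ∀ {M} (s : Fin M) → unit s [ s ]≔ 0 ≡ replicate M 0
    ≔0 {suc M} zero = ≡.cong (0 ∷_) (tabulate-const M)
      where
      tabulate-const : ∀ M → tabulate {n = M} (λ _ → 0) ≡ replicate M 0
      tabulate-const zero    = ≡.refl
      tabulate-const (suc M) = ≡.cong (0 ∷_) (tabulate-const M)
    ≔0 (suc s) = ≡.cong (0 ∷_) (≔0 s)
    go : ∀ u → lookup u s ≡ 1 → u [ s ]≔ 0 ≡ replicate N 0 → mono s r u ≈P r
    go u e f rewrite e | f = S.solve 1 (λ r → (r S.:* S.:1) S.:* S.:1 S.:= r) (λ {_} m → refl) r

  substP-var-≢ : ∀ s r k → k ≢ s → substP s r (var k) ≈P var k
  substP-var-≢ s r k k≢s = P.trans {substP s r (var k)} {mono s r (unit k)} {var k} (substP-mon s r (unit k)) (go (unit k) (lookup-unit-≢ (k≢s ∘ ≡.sym)))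
    where
    go : ∀ u → lookup u s ≡ 0 → mono s r u ≈P mon u
    go u e = PR.begin
      mono s r u              PR.≡⟨ ≡.cong₂ (λ n w → pow r n *P mon w) e (≡.trans (≡.cong (u [ s ]≔_) (≡.sym e)) (VecP.[]≔-lookup u s)) ⟩
      constP 1# *P mon u      PR.≈⟨ P.*-identityˡ (mon u) ⟩
      mon u                   PR.∎

  -- Term by term: a monomial is its own image under `y_s ↦ y_s`, so the two images differ by a
  -- multiple of `y_s^n − r^n`, which `y_s − r` divides.
  substP-diff : ∀ s r p → (var s +P negP r) ∣ (p +P negP (substP s r p))
  substP-diff s r []            = ∣-0 (var s +P negP r)
  substP-diff s r ((a , u) ∷ p) = ∣-respʳ {g = var s +P negP r} {(A P.- A′) P.+ (p P.- substP s r p)} {((a , u) ∷ p) +P negP (A′ +P substP s r p)}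
    (PR.begin
      (A P.- A′) P.+ (p P.- substP s r p)
        PR.≈⟨ S.solve 4 (λ A A′ p q → (A S.:- A′) S.:+ (p S.:- q) S.:= (A S.:+ p) S.:- (A′ S.:+ q)) (λ {_} m → refl) A A′ p (substP s r p) ⟩
      (A P.+ p) P.- (A′ P.+ substP s r p)
        PR.≈⟨ P.+-congʳ {negP (A′ +P substP s r p)} {A +P p} {(a , u) ∷ p} (P.+-congʳ {p} {A} {(a , u) ∷ []} term) ⟩
      ((a , u) ∷ p) +P negP (A′ +P substP s r p) PR.∎)
    (∣-+ {var s +P negP r} {A P.- A′} {p P.- substP s r p}
      (∣-respʳ {var s +P negP r} {constP a *P (mono s (var s) u P.- mono s r u)} {A P.- A′}
        (S.solve 3 (λ c x y → c S.:* (x S.:- y) S.:= c S.:* x S.:- c S.:* y) (λ {_} m → refl) (constP a) (mono s (var s) u) (mono s r u))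
        (∣-*ˡ {var s +P negP r} {mono s (var s) u P.- mono s r u} (constP a)
          (∣-respʳ {var s +P negP r} {(pow (var s) n P.- pow r n) *P m} {mono s (var s) u P.- mono s r u}
            (S.solve 3 (λ x y m → (x S.:- y) S.:* m S.:= x S.:* m S.:- y S.:* m) (λ {_} m → refl) (pow (var s) n) (pow r n) m)
            (∣-*ʳ {var s +P negP r} {pow (var s) n P.- pow r n} (∣-pow (var s) r n) m))))
      (substP-diff s r p))
    where
    n = lookup u s
    m = mon (u [ s ]≔ 0)
    A  = constP a *P mono s (var s) u
    A′ = constP a *P mono s r u
    term : A ≈P ((a , u) ∷ [])
    term = P.trans {A} {constP a *P mon u} {(a , u) ∷ []} (P.*-congˡ {constP a} {mono s (var s) u} {mon u} (mono-var s u))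
      (ext {constP a *P mon u} {(a , u) ∷ []} λ g →
        trans (pair-scale a (mon u) g) (trans (*-congˡ (pair-mon u g)) (sym (+-identityʳ _))))

  polyLike : PolyLike K N
  polyLike = record
    { R = polyRing N ; ∑ = sumF
    ; ∑-zero = λ f m → refl ; ∑-suc = λ f m → refl
    ; ι = constP ; ι-cong = const-cong ; ι-0 = const-0 ; ι-1 = λ m → refl ; ι-+ = const-+ ; ι-* = const-*
    ; y = var ; Homog = HomogP
    ; homog-cong = λ e h m m≢ → trans (sym (e m)) (h m m≢)
    ; homog-0 = λ d m m≢ → refl
    ; homog-+ = λ {d} {f} {g} hf hg m m≢ → trans (coeff-+ f g m) (trans (+-cong (hf m m≢) (hg m m≢)) (+-identityˡ 0#))
    ; homog-* = λ {d} {e} {f} {g} → homogP-* {d} {e} f g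
    ; homog-ι = homogP-const ; homog-y = homogP-var
    ; regular = linPoly-regular
    ; subst = substP ; subst-cong = λ s r {p} {q} → substP-cong s r {p} {q} ; subst-+ = substP-+ ; subst-* = substP-* ; subst-ι = substP-const
    ; subst-y-≡ = substP-var-≡ ; subst-y-≢ = substP-var-≢ ; subst-diff = substP-diff
    }

-- Bases of logarithmic derivations

module Unions {c ℓ} (K : Field c ℓ) where
  open Arrangements K using (Form; Arr; _≈F_)

  infixl 5 _∪₁_
  data _∪₁_ {N} (A : Arr N) (α : Form N) : Arr N where
    old : ∀ {β} → A β → (A ∪₁ α) β
    new : ∀ {β} → β ≈F α → (A ∪₁ α) β

module LinearAlgebra {c ℓ} {K : Field c ℓ} {N : ℕ} (PL : PolyLike K N) where
  open PolyLike PL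
  private module K = Field K
  open Arrangements K using (Form; Arr; _≈F_)
  open Unions K
  open ℤSolver R
  open Algebra.Properties.Ring ring using (-0#≈0#; -‿distribˡ-*)
  open Relation.Binary.Reasoning.Setoid setoid

  ∑-cong : ∀ {m} {f g : Fin m → Carrier} → (∀ i → f i ≈ g i) → ∑ f ≈ ∑ g
  ∑-cong {zero}  e = trans (∑-zero _) (sym (∑-zero _))
  ∑-cong {suc m} e = trans (∑-suc _) (trans (+-cong (e zero) (∑-cong (e ∘ suc))) (sym (∑-suc _)))

  ∑-0 : ∀ {m} {f : Fin m → Carrier} → (∀ i → f i ≈ 0#) → ∑ f ≈ 0#
  ∑-0 {zero}  e = ∑-zero _
  ∑-0 {suc m} e = trans (∑-suc _) (trans (+-cong (e zero) (∑-0 (e ∘ suc))) (+-identityˡ 0#))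

  ∑-+ : ∀ {m} (f g : Fin m → Carrier) → ∑ (λ i → f i + g i) ≈ ∑ f + ∑ g
  ∑-+ {zero}  f g = trans (∑-zero _) (sym (trans (+-cong (∑-zero f) (∑-zero g)) (+-identityˡ 0#)))
  ∑-+ {suc m} f g = begin
    ∑ (λ i → f i + g i)                                 ≈⟨ ∑-suc _ ⟩
    f zero + g zero + ∑ (λ i → f (suc i) + g (suc i))   ≈⟨ +-congˡ (∑-+ (f ∘ suc) (g ∘ suc)) ⟩
    f zero + g zero + (∑ (f ∘ suc) + ∑ (g ∘ suc))       ≈⟨ solve 4 (λ a b c d → (a :+ b) :+ (c :+ d) := (a :+ c) :+ (b :+ d)) refl _ _ _ _ ⟩
    f zero + ∑ (f ∘ suc) + (g zero + ∑ (g ∘ suc))       ≈⟨ +-cong (∑-suc f) (∑-suc g) ⟨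
    ∑ f + ∑ g                                           ∎

  ∑-* : ∀ {m} c (f : Fin m → Carrier) → ∑ (λ i → c * f i) ≈ c * ∑ f
  ∑-* {zero}  c f = trans (∑-zero _) (sym (trans (*-congˡ (∑-zero f)) (zeroʳ c)))
  ∑-* {suc m} c f = trans (∑-suc _) (trans (+-congˡ (∑-* c (f ∘ suc))) (trans (sym (distribˡ c _ _)) (*-congˡ (sym (∑-suc f)))))

  ∑-single : ∀ {m} (f : Fin m → Carrier) k → (∀ i → i ≢ k → f i ≈ 0#) → ∑ f ≈ f k
  ∑-single f zero    e = trans (∑-suc f) (trans (+-congˡ (∑-0 (λ i → e (suc i) λ ()))) (+-identityʳ _))
  ∑-single f (suc k) e = trans (∑-suc f) (trans (+-cong (e zero λ ()) (∑-single (f ∘ suc) k (λ i i≢k → e (suc i) (i≢k ∘ FinP.suc-injective)))) (+-identityˡ _))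

  Der : Set c
  Der = Fin N → Carrier

  infix 4 _≈D_
  _≈D_ : Der → Der → Set ℓ
  θ ≈D φ = ∀ k → θ k ≈ φ k

  -- The Euler derivation is the vector `y` of variables: `lin α` unfolds to `applyD y α`. So it
  -- preserves every form, and the rules for `applyD` apply to `lin` as well.
  applyD : Der → Form N → Carrier
  applyD θ α = ∑ (λ k → ι (α k) * θ k)

  ι-neg : ∀ a → ι (K.- a) ≈ - ι a
  ι-neg a = begin
    ι (K.- a)                    ≈⟨ solve 2 (λ x y → x := (y :+ x) :- y) refl (ι (K.- a)) (ι a) ⟩
    ι a + ι (K.- a) - ι a        ≈⟨ +-congʳ (trans (sym (ι-+ a (K.- a))) (trans (ι-cong (K.-‿inverseʳ a)) ι-0)) ⟩
    0# - ι a                     ≈⟨ +-identityˡ _ ⟩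
    - ι a                        ∎

  applyD-cong : ∀ {θ φ α β} → θ ≈D φ → α ≈F β → applyD θ α ≈ applyD φ β
  applyD-cong e f = ∑-cong (λ k → *-cong (ι-cong (f k)) (e k))

  applyD-sub : ∀ θ α β → applyD θ (λ k → α k K.- β k) ≈ applyD θ α - applyD θ β
  applyD-sub θ α β = begin
    applyD θ (λ k → α k K.- β k)
      ≈⟨ ∑-cong (λ k → trans (*-congʳ (trans (ι-+ _ _) (+-congˡ (ι-neg _))))
           (solve 3 (λ a b t → (a :- b) :* t := a :* t :+ (:- :1) :* (b :* t)) refl (ι (α k)) (ι (β k)) (θ k))) ⟩
    ∑ (λ k → ι (α k) * θ k + - 1# * (ι (β k) * θ k))   ≈⟨ ∑-+ _ _ ⟩
    applyD θ α + ∑ (λ k → - 1# * (ι (β k) * θ k))      ≈⟨ +-congˡ (∑-* (- 1#) _) ⟩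
    applyD θ α + - 1# * applyD θ β
      ≈⟨ solve 2 (λ a b → a :+ (:- :1) :* b := a :- b) refl _ _ ⟩
    applyD θ α - applyD θ β                            ∎

  applyD-scale : ∀ θ t α → applyD θ (λ k → t K.* α k) ≈ ι t * applyD θ α
  applyD-scale θ t α = trans (∑-cong (λ k → trans (*-congʳ (ι-* t (α k))) (*-assoc _ _ _))) (∑-* (ι t) _)

  applyD-+ : ∀ θ φ α → applyD (λ k → θ k + φ k) α ≈ applyD θ α + applyD φ α
  applyD-+ θ φ α = trans (∑-cong (λ k → distribˡ _ _ _)) (∑-+ _ _)

  applyD-* : ∀ f θ α → applyD (λ k → f * θ k) α ≈ f * applyD θ α
  applyD-* f θ α = trans (∑-cong (λ k → solve 3 (λ a f t → a :* (f :* t) := f :* (a :* t)) refl (ι (α k)) f (θ k))) (∑-* f _)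

  applyD-0 : ∀ {θ} → (∀ k → θ k ≈ 0#) → ∀ α → applyD θ α ≈ 0#
  applyD-0 e α = ∑-0 (λ k → trans (*-congˡ (e k)) (zeroʳ _))

  homog-∑ : ∀ {d m} (f : Fin m → Carrier) → (∀ i → Homog d (f i)) → Homog d (∑ f)
  homog-∑ {d} {zero}  f h = homog-cong (sym (∑-zero f)) (homog-0 d)
  homog-∑ {d} {suc m} f h = homog-cong (sym (∑-suc f)) (homog-+ (h zero) (homog-∑ (f ∘ suc) (h ∘ suc)))

  homog-lin : ∀ α → Homog 1 (lin α)
  homog-lin α = homog-∑ _ (λ k → homog-* (homog-ι _) (homog-y k))

  homog-1 : Homog 0 1#
  homog-1 = homog-cong ι-1 (homog-ι K.1#)

  homog-neg : ∀ {d x} → Homog d x → Homog d (- x)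
  homog-neg {x = x} h = homog-cong
    (trans (*-congʳ (trans (ι-neg K.1#) (-‿cong ι-1))) (solve 1 (λ x → :- :1 :* x := :- x) refl x))
    (homog-* (homog-ι (K.- K.1#)) h)

  -- Substituting y_s ↦ y_s − α (with α_s = 1) kills α and sends β to β − β_s α.
  lin-prime : ∀ α s → α s K.≈ K.1# → ∀ β k → ¬ (β k K.- β s K.* α k) K.≈ K.0# →
              ∀ f → lin α ∣ lin β * f → lin α ∣ f
  lin-prime α s αs≈1 β k γk≉0 f (h , e) = ∣-resp
    (solve 2 (λ y a → y :- (y :- a) := a) refl (y s) (lin α))
    (trans (+-congˡ (trans (-‿cong σf≈0) -0#≈0#)) (+-identityʳ f))
    (subst-diff s r f)
    where
    r = y s - lin α
    σ = subst s r
    σ-0 : σ 0# ≈ 0#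
    σ-0 = trans (subst-cong s r (sym ι-0)) (trans (subst-ι s r K.0#) ι-0)
    σ-∑ : ∀ {m} (f : Fin m → Carrier) → σ (∑ f) ≈ ∑ (σ ∘ f)
    σ-∑ {zero}  f = trans (subst-cong s r (∑-zero f)) (trans σ-0 (sym (∑-zero _)))
    σ-∑ {suc m} f = trans (subst-cong s r (∑-suc f)) (trans (subst-+ s r _ _)
      (trans (+-congˡ (σ-∑ (f ∘ suc))) (sym (∑-suc _))))
    [s] : Fin N → Carrier
    [s] k with k Fin.≟ s
    ... | yes _ = 1#
    ... | no  _ = 0#
    [s]-s : [s] s ≈ 1#
    [s]-s with s Fin.≟ s
    ... | yes _   = refl
    ... | no  s≢s = contradiction ≡.refl s≢s
    [s]-≢ : ∀ k → k ≢ s → [s] k ≈ 0#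
    [s]-≢ k k≢s with k Fin.≟ s
    ... | yes k≡s = contradiction k≡s k≢s
    ... | no  _   = refl
    σ-y : ∀ k → σ (y k) ≈ y k + - lin α * [s] k
    σ-y k with k Fin.≟ s
    ... | yes ≡.refl = trans (subst-y-≡ s r) (+-congˡ (sym (*-identityʳ _)))
    ... | no  k≢s    = trans (subst-y-≢ s r k k≢s) (sym (trans (+-congˡ (zeroʳ _)) (+-identityʳ _)))
    σ-lin : ∀ β → σ (lin β) ≈ lin (λ k → β k K.- β s K.* α k)
    σ-lin β = begin
      σ (lin β)
        ≈⟨ σ-∑ _ ⟩
      ∑ (λ k → σ (ι (β k) * y k))
        ≈⟨ ∑-cong (λ k → trans (subst-* s r _ _) (trans (*-cong (subst-ι s r _) (σ-y k))
             (solve 4 (λ b y a i → b :* (y :+ :- a :* i) := b :* y :+ :- a :* (b :* i)) refl (ι (β k)) (y k) (lin α) ([s] k)))) ⟩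
      ∑ (λ k → ι (β k) * y k + - lin α * (ι (β k) * [s] k))
        ≈⟨ trans (∑-+ _ _) (+-congˡ (∑-* (- lin α) _)) ⟩
      lin β + - lin α * ∑ (λ k → ι (β k) * [s] k)
        ≈⟨ +-congˡ (*-congˡ (∑-single _ s (λ k k≢s → trans (*-congˡ ([s]-≢ k k≢s)) (zeroʳ _)))) ⟩
      lin β + - lin α * (ι (β s) * [s] s)
        ≈⟨ +-congˡ (*-congˡ (trans (*-congˡ [s]-s) (*-identityʳ _))) ⟩
      lin β + - lin α * ι (β s)
        ≈⟨ solve 3 (λ b a i → b :+ :- a :* i := b :- i :* a) refl (lin β) (lin α) (ι (β s)) ⟩
      lin β - ι (β s) * lin α
        ≈⟨ +-congˡ (-‿cong (applyD-scale y (β s) α)) ⟨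
      lin β - lin (λ k → β s K.* α k)
        ≈⟨ applyD-sub y β _ ⟨
      lin (λ k → β k K.- β s K.* α k) ∎
    σα≈0 : σ (lin α) ≈ 0#
    σα≈0 = trans (σ-lin α) (∑-0 (λ k → trans (*-congʳ (trans (ι-cong
      (K.trans (K.+-congˡ (K.-‿cong (K.trans (K.*-congʳ αs≈1) (K.*-identityˡ _)))) (K.-‿inverseʳ _))) ι-0)) (zeroˡ _)))
    σf≈0 : σ f ≈ 0#
    σf≈0 = regular (λ k → β k K.- β s K.* α k) k γk≉0 (σ f) (begin
      lin (λ k → β k K.- β s K.* α k) * σ f ≈⟨ *-congʳ (σ-lin β) ⟨
      σ (lin β) * σ f                       ≈⟨ subst-* s r _ _ ⟨
      σ (lin β * f)                         ≈⟨ subst-cong s r e ⟩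
      σ (lin α * h)                         ≈⟨ subst-* s r _ _ ⟩
      σ (lin α) * σ h                       ≈⟨ trans (*-congʳ σα≈0) (zeroˡ _) ⟩
      0#                                    ∎)

  -- Says that `b` is a non-zero-divisor modulo `α`, which is all that "prime to `α`" has to mean.
  -- In this form it passes to products and along congruences modulo `α` without any theory of
  -- factorisation.
  Cancels : Form N → Carrier → Set (c ⊔ ℓ)
  Cancels α b = ∀ f → lin α ∣ b * f → lin α ∣ f

  cancels-1 : ∀ α → Cancels α 1#
  cancels-1 α f = ∣-respʳ (*-identityˡ f)

  cancels-* : ∀ {α a b} → Cancels α a → Cancels α b → Cancels α (a * b)
  cancels-* ca cb f d = cb f (ca _ (∣-respʳ (*-assoc _ _ _) d))

  cancels-mod : ∀ {α a b} → lin α ∣ a - b → Cancels α a → Cancels α b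
  cancels-mod {α} {a} {b} a≡b ca f d = ca f (∣-respʳ
    (solve 3 (λ a b f → (a :- b) :* f :+ b :* f := a :* f) refl a b f) (∣-+ (∣-*ʳ a≡b f) d))

  cancels-neg : ∀ {α a} → Cancels α a → Cancels α (- a)
  cancels-neg ca f d = ca f (∣-respʳ (solve 2 (λ a f → :- (:- a :* f) := a :* f) refl _ f) (∣-neg d))

  infixr 5 _◂_
  _◂_ : ∀ {m} → Carrier → (Fin m → Carrier) → Fin (suc m) → Carrier
  (a ◂ f) zero    = a
  (a ◂ f) (suc i) = f i

  combo : ∀ {m} → (Fin m → Carrier) → Vec Der m → Der
  combo f xs k = ∑ (λ i → f i * lookup xs i k)

  combo-∷ : ∀ {m} f x (xs : Vec Der m) k → combo f (x ∷ xs) k ≈ f zero * x k + combo (f ∘ suc) xs k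
  combo-∷ f x xs k = ∑-suc _

  combo-cong : ∀ {m} {f g : Fin m → Carrier} (xs : Vec Der m) → (∀ i → f i ≈ g i) → combo f xs ≈D combo g xs
  combo-cong xs e k = ∑-cong (λ i → *-congʳ (e i))

  combo-+ : ∀ {m} f g (xs : Vec Der m) k → combo (λ i → f i + g i) xs k ≈ combo f xs k + combo g xs k
  combo-+ f g xs k = trans (∑-cong (λ i → distribʳ _ _ _)) (∑-+ _ _)

  combo-* : ∀ {m} t f (xs : Vec Der m) k → combo (λ i → t * f i) xs k ≈ t * combo f xs k
  combo-* t f xs k = trans (∑-cong (λ i → *-assoc _ _ _)) (∑-* t _)

  infix 4 _,ₛ_
  record Span {m} (xs : Vec Der m) (θ : Der) : Set (c ⊔ ℓ) where
    constructor _,ₛ_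
    field
      coordinates : Fin m → Carrier
      expansion   : θ ≈D combo coordinates xs

  span-cong : ∀ {m} {xs : Vec Der m} {θ φ} → θ ≈D φ → Span xs θ → Span xs φ
  span-cong e (f ,ₛ p) = f ,ₛ λ k → trans (sym (e k)) (p k)

  span-0 : ∀ {m} (xs : Vec Der m) {θ} → (∀ k → θ k ≈ 0#) → Span xs θ
  span-0 xs e = (λ _ → 0#) ,ₛ λ k → trans (e k) (sym (∑-0 (λ i → zeroˡ _)))

  span-+ : ∀ {m} {xs : Vec Der m} {θ φ} → Span xs θ → Span xs φ → Span xs (λ k → θ k + φ k)
  span-+ {xs = xs} (f ,ₛ p) (g ,ₛ q) = _ ,ₛ λ k → trans (+-cong (p k) (q k)) (sym (combo-+ f g xs k))

  span-* : ∀ {m} {xs : Vec Der m} {θ} t → Span xs θ → Span xs (λ k → t * θ k)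
  span-* {xs = xs} t (f ,ₛ p) = _ ,ₛ λ k → trans (*-congˡ (p k)) (sym (combo-* t f xs k))

  span-there : ∀ {m} {xs : Vec Der m} {x θ} → Span xs θ → Span (x ∷ xs) θ
  span-there {xs = xs} {x} (f ,ₛ p) = 0# ◂ f ,ₛ λ k → trans (p k)
    (sym (trans (combo-∷ (0# ◂ f) x xs k) (trans (+-congʳ (zeroˡ _)) (+-identityˡ _))))

  span-here : ∀ {m} {xs : Vec Der m} {x} → Span (x ∷ xs) x
  span-here {xs = xs} {x} = 1# ◂ (λ _ → 0#) ,ₛ λ k → sym (trans (combo-∷ (1# ◂ λ _ → 0#) x xs k)
    (trans (+-cong (*-identityˡ _) (∑-0 (λ i → zeroˡ _))) (+-identityʳ _)))

  span-lookup : ∀ {m} (xs : Vec Der m) i → Span xs (lookup xs i)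
  span-lookup (x ∷ xs) zero    = span-here
  span-lookup (x ∷ xs) (suc i) = span-there (span-lookup xs i)

  InD : Arr N → Der → Set (c ⊔ ℓ)
  InD A θ = ∀ α → A α → lin α ∣ applyD θ α

  record Basis {m} (A : Arr N) (xs : Vec Der m) : Set (lsuc (c ⊔ ℓ)) where
    field
      members     : ∀ i → InD A (lookup xs i)
      spans       : ∀ θ → InD A θ → Span xs θ
      independent : ∀ f → (∀ k → combo f xs k ≈ 0#) → ∀ i → f i ≈ 0#
  open Basis public

  ∣-combo : ∀ {m} α f (xs : Vec Der m) → (∀ i → lin α ∣ applyD (lookup xs i) α) → lin α ∣ applyD (combo f xs) α
  ∣-combo α f []       d = ∣-respʳ (sym (applyD-0 (λ k → ∑-zero _) α)) (∣-0 _)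
  ∣-combo α f (x ∷ xs) d = ∣-respʳ
    (sym (trans (applyD-cong (combo-∷ f x xs) (λ k → K.refl)) (trans (applyD-+ _ _ α) (+-congʳ (applyD-* _ x α)))))
    (∣-+ (∣-*ˡ (f zero) (d zero)) (∣-combo α (f ∘ suc) xs (d ∘ suc)))

  -- Neither map is assumed linear: to-from and to-0 suffice to transfer independence.
  infix 4 _⇄_
  record _⇄_ {m n} (xs : Vec Der m) (ys : Vec Der n) : Set (lsuc (c ⊔ ℓ)) where
    field
      to        : (Fin m → Carrier) → Fin n → Carrier
      from      : (Fin n → Carrier) → Fin m → Carrier
      to-cong   : ∀ {f g} → (∀ i → f i ≈ g i) → ∀ i → to f i ≈ to g i
      to-0      : ∀ i → to (λ _ → 0#) i ≈ 0#
      to-from   : ∀ g i → to (from g) i ≈ g i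
      to-combo  : ∀ f → combo (to f) ys ≈D combo f xs
      from-combo : ∀ g → combo (from g) xs ≈D combo g ys

  ⇄-refl : ∀ {m} {xs : Vec Der m} → xs ⇄ xs
  ⇄-refl = record
    { to = λ f → f ; from = λ f → f ; to-cong = λ e → e ; to-0 = λ _ → refl
    ; to-from = λ _ _ → refl ; to-combo = λ _ _ → refl ; from-combo = λ _ _ → refl }

  ⇄-trans : ∀ {m n o} {xs : Vec Der m} {ys : Vec Der n} {zs : Vec Der o} → xs ⇄ ys → ys ⇄ zs → xs ⇄ zs
  ⇄-trans d e = record
    { to = E.to ∘ D.to ; from = D.from ∘ E.from
    ; to-cong = λ p → E.to-cong (D.to-cong p)
    ; to-0 = λ i → trans (E.to-cong D.to-0 i) (E.to-0 i)
    ; to-from = λ g i → trans (E.to-cong (D.to-from (E.from g)) i) (E.to-from g i)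
    ; to-combo = λ f k → trans (E.to-combo (D.to f) k) (D.to-combo f k)
    ; from-combo = λ g k → trans (D.from-combo (E.from g) k) (E.from-combo g k) }
    where module D = _⇄_ d
          module E = _⇄_ e

  ⇄-cong : ∀ {m n} x {xs : Vec Der m} {ys : Vec Der n} → xs ⇄ ys → x ∷ xs ⇄ x ∷ ys
  ⇄-cong x {xs} {ys} e = record
    { to = λ f → f zero ◂ to (f ∘ suc) ; from = λ f → f zero ◂ from (f ∘ suc)
    ; to-cong = λ p → λ { zero → p zero ; (suc i) → to-cong (p ∘ suc) i }
    ; to-0 = λ { zero → refl ; (suc i) → to-0 i }
    ; to-from = λ g → λ { zero → refl ; (suc i) → to-from (g ∘ suc) i }
    ; to-combo = λ f k → trans (combo-∷ _ x ys k) (trans (+-congˡ (to-combo (f ∘ suc) k)) (sym (combo-∷ f x xs k)))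
    ; from-combo = λ f k → trans (combo-∷ _ x xs k) (trans (+-congˡ (from-combo (f ∘ suc) k)) (sym (combo-∷ f x ys k))) }
    where open _⇄_ e

  ⇄-swap : ∀ {m} x y (xs : Vec Der m) → x ∷ y ∷ xs ⇄ y ∷ x ∷ xs
  ⇄-swap x y xs = record
    { to = sw ; from = sw ; to-cong = sw-cong ; to-0 = sw-0
    ; to-from = sw-sw ; to-combo = sw-combo y x ; from-combo = sw-combo x y }
    where
    sw : ∀ {m} → (Fin (suc (suc m)) → Carrier) → Fin (suc (suc m)) → Carrier
    sw f zero          = f (suc zero)
    sw f (suc zero)    = f zero
    sw f (suc (suc i)) = f (suc (suc i))
    sw-cong : ∀ {m} {f g : Fin (suc (suc m)) → Carrier} → (∀ i → f i ≈ g i) → ∀ i → sw f i ≈ sw g i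
    sw-cong e zero          = e (suc zero)
    sw-cong e (suc zero)    = e zero
    sw-cong e (suc (suc i)) = e (suc (suc i))
    sw-0 : ∀ {m} (i : Fin (suc (suc m))) → sw (λ _ → 0#) i ≈ 0#
    sw-0 zero          = refl
    sw-0 (suc zero)    = refl
    sw-0 (suc (suc i)) = refl
    sw-sw : ∀ {m} (f : Fin (suc (suc m)) → Carrier) i → sw (sw f) i ≈ f i
    sw-sw f zero          = refl
    sw-sw f (suc zero)    = refl
    sw-sw f (suc (suc i)) = refl
    sw-combo : ∀ x y f → combo (sw f) (x ∷ y ∷ xs) ≈D combo f (y ∷ x ∷ xs)
    sw-combo x y f k = trans (trans (combo-∷ (sw f) x (y ∷ xs) k) (+-congˡ (combo-∷ (sw f ∘ suc) y xs k)))
      (trans (solve 3 (λ a b r → a :+ (b :+ r) := b :+ (a :+ r)) refl _ _ _)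
        (sym (trans (combo-∷ f y (x ∷ xs) k) (+-congˡ (combo-∷ (f ∘ suc) x xs k)))))

  -- An elementary change of basis: `x′` is the unit `u` times `x` plus a combination of `xs`. Every
  -- exchange of basis elements below is an instance.
  ⇄-head : ∀ {m} {x x′ : Der} {xs : Vec Der m} u v → u * v ≈ 1# →
           Span xs (λ k → x′ k - u * x k) → x ∷ xs ⇄ x′ ∷ xs
  ⇄-head {x = x} {x′} {xs} u v uv≈1 (g ,ₛ p) = record
    { to = λ f → (f zero * v) ◂ (λ i → f (suc i) - f zero * v * g i)
    ; from = λ h → (h zero * u) ◂ (λ i → h (suc i) + h zero * g i)
    ; to-cong = λ e → λ { zero → *-congʳ (e zero) ; (suc i) → +-cong (e (suc i)) (-‿cong (*-congʳ (*-congʳ (e zero)))) }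
    ; to-0 = λ { zero → zeroˡ v ; (suc i) → solve 2 (λ v g → con (+ 0) :- con (+ 0) :* v :* g := con (+ 0)) refl v (g i) }
    ; to-from = λ h → λ
      { zero → trans (*-assoc _ _ _) (trans (*-congˡ uv≈1) (*-identityʳ _))
      ; (suc i) → begin
          h (suc i) + h zero * g i - h zero * u * v * g i
            ≈⟨ solve 5 (λ a b g u v → a :+ b :* g :- b :* u :* v :* g := a :+ b :* g :- b :* (u :* v) :* g) refl (h (suc i)) (h zero) (g i) u v ⟩
          h (suc i) + h zero * g i - h zero * (u * v) * g i
            ≈⟨ +-congˡ (-‿cong (*-congʳ (trans (*-congˡ uv≈1) (*-identityʳ _)))) ⟩
          h (suc i) + h zero * g i - h zero * g i
            ≈⟨ solve 2 (λ a b → a :+ b :- b := a) refl _ _ ⟩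
          h (suc i) ∎ }
    ; to-combo = λ f k → begin
        combo ((f zero * v) ◂ (λ i → f (suc i) - f zero * v * g i)) (x′ ∷ xs) k
          ≈⟨ combo-∷ _ x′ xs k ⟩
        f zero * v * x′ k + combo (λ i → f (suc i) - f zero * v * g i) xs k
          ≈⟨ +-congˡ (trans (combo-cong xs (λ i → +-congˡ (-‿distribˡ-* (f zero * v) (g i))) k)
               (trans (combo-+ _ _ xs k) (+-congˡ (combo-* (- (f zero * v)) g xs k)))) ⟩
        f zero * v * x′ k + (combo (f ∘ suc) xs k + - (f zero * v) * combo g xs k)
          ≈⟨ +-cong (*-congˡ (x′≈ k)) refl ⟩
        f zero * v * (u * x k + combo g xs k) + (combo (f ∘ suc) xs k + - (f zero * v) * combo g xs k)
          ≈⟨ solve 6 (λ a v u x g r → a :* v :* (u :* x :+ g) :+ (r :+ :- (a :* v) :* g) := a :* (u :* v) :* x :+ r) refl (f zero) v u (x k) (combo g xs k) _ ⟩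
        f zero * (u * v) * x k + combo (f ∘ suc) xs k
          ≈⟨ +-congʳ (*-congʳ (trans (*-congˡ uv≈1) (*-identityʳ _))) ⟩
        f zero * x k + combo (f ∘ suc) xs k
          ≈⟨ combo-∷ f x xs k ⟨
        combo f (x ∷ xs) k ∎
    ; from-combo = λ h k → begin
        combo ((h zero * u) ◂ (λ i → h (suc i) + h zero * g i)) (x ∷ xs) k
          ≈⟨ combo-∷ _ x xs k ⟩
        h zero * u * x k + combo (λ i → h (suc i) + h zero * g i) xs k
          ≈⟨ +-congˡ (trans (combo-+ _ _ xs k) (+-congˡ (combo-* (h zero) g xs k))) ⟩
        h zero * u * x k + (combo (h ∘ suc) xs k + h zero * combo g xs k)
          ≈⟨ solve 5 (λ a u x g r → a :* u :* x :+ (r :+ a :* g) := a :* (u :* x :+ g) :+ r) refl (h zero) u (x k) (combo g xs k) _ ⟩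
        h zero * (u * x k + combo g xs k) + combo (h ∘ suc) xs k
          ≈⟨ +-congʳ (*-congˡ (x′≈ k)) ⟨
        h zero * x′ k + combo (h ∘ suc) xs k
          ≈⟨ combo-∷ h x′ xs k ⟨
        combo h (x′ ∷ xs) k ∎ }
    where
    x′≈ : ∀ k → x′ k ≈ u * x k + combo g xs k
    x′≈ k = trans (solve 2 (λ a b → a := b :+ (a :- b)) refl (x′ k) (u * x k)) (+-congˡ (p k))

  basis-⇄ : ∀ {m n A} {xs : Vec Der m} {ys : Vec Der n} → xs ⇄ ys → Basis A xs → Basis A ys
  basis-⇄ {A = A} {xs} {ys} e b = record
    { members = λ i α Aα →
        let g ,ₛ p = span-lookup ys i in
        ∣-respʳ (applyD-cong (λ k → trans (from-combo g k) (sym (p k))) (λ k → K.refl))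
          (∣-combo α (from g) xs (λ j → members b j α Aα))
    ; spans = λ θ θ∈D → let f ,ₛ p = spans b θ θ∈D in to f ,ₛ λ k → trans (p k) (sym (to-combo f k))
    ; independent = λ g g·ys≈0 i → trans (sym (to-from g i))
        (trans (to-cong (independent b (from g) (λ k → trans (from-combo g k) (g·ys≈0 k))) i) (to-0 i)) }
    where open _⇄_ e

  unitD : Fin N → Der
  unitD i k = if does (k Fin.≟ i) then 1# else 0#

  unitD-≡ : ∀ i → unitD i i ≈ 1#
  unitD-≡ i rewrite dec-true (i Fin.≟ i) ≡.refl = refl

  unitD-≢ : ∀ {i k} → k ≢ i → unitD i k ≈ 0#
  unitD-≢ {i} {k} ne rewrite dec-false (k Fin.≟ i) ne = refl

  basis-empty : ∀ {A} → (∀ β → ¬ A β) → Basis A (Vec.tabulate unitD)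
  basis-empty ∅ = record
    { members     = λ i β Aβ → contradiction Aβ (∅ β)
    ; spans       = λ θ _ → θ ,ₛ λ k → sym (combo-unit θ k)
    ; independent = λ f e k → trans (sym (combo-unit f k)) (e k) }
    where
    combo-unit : ∀ f k → combo f (Vec.tabulate unitD) k ≈ f k
    combo-unit f k = trans
      (∑-cong (λ i → *-congˡ (reflexive (≡.cong (λ θ → θ k) (VecP.lookup∘tabulate unitD i)))))
      (trans (∑-single _ k (λ i i≢k → trans (*-congˡ (unitD-≢ (i≢k ∘ ≡.sym))) (zeroʳ _)))
             (trans (*-congˡ (unitD-≡ k)) (*-identityʳ _)))

  -- Expand an element of the smaller module in the old basis and apply it to `α`. As `xs` preserve
  -- `α`, the coefficient of `x` times `x(α)` is divisible by `α`, hence so is that coefficient.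
  -- Independence survives because `α` is not a zero divisor.
  basis-∪₁ : ∀ {m A α s x} {xs : Vec Der m} → ¬ α s K.≈ K.0# → Basis A (x ∷ xs) →
             (∀ i → lin α ∣ applyD (lookup xs i) α) → Cancels α (applyD x α) →
             Basis (A ∪₁ α) ((λ k → lin α * x k) ∷ xs)
  basis-∪₁ {A = A} {α} {s} {x} {xs} αs≉0 b d canc = record
    { members = mem ; spans = span ; independent = indep }
    where
    mem : ∀ i → InD (A ∪₁ α) (lookup ((λ k → lin α * x k) ∷ xs) i)
    mem zero    β (old Aβ)  = ∣-respʳ (sym (applyD-* (lin α) x β)) (∣-*ˡ (lin α) (members b zero β Aβ))
    mem zero    β (new β≈α) = ∣-resp (applyD-cong (λ k → refl) (λ k → K.sym (β≈α k))) (sym (applyD-* (lin α) x β)) (∣-*ʳ (∣-refl _) _)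
    mem (suc i) β (old Aβ)  = members b (suc i) β Aβ
    mem (suc i) β (new β≈α) = ∣-resp (applyD-cong (λ k → refl) (λ k → K.sym (β≈α k)))
                                (applyD-cong (λ k → refl) (λ k → K.sym (β≈α k))) (d i)
    span : ∀ θ → InD (A ∪₁ α) θ → Span ((λ k → lin α * x k) ∷ xs) θ
    span θ θ∈D with spans b θ (λ β Aβ → θ∈D β (old Aβ))
    ... | f ,ₛ p = h ◂ (f ∘ suc) ,ₛ λ k → begin
      θ k                                          ≈⟨ p k ⟩
      combo f (x ∷ xs) k                           ≈⟨ combo-∷ f x xs k ⟩
      f zero * x k + combo (f ∘ suc) xs k          ≈⟨ +-congʳ (trans (*-congʳ f₀≈) (solve 3 (λ a h x → a :* h :* x := h :* (a :* x)) refl _ _ _)) ⟩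
      h * (lin α * x k) + combo (f ∘ suc) xs k     ≈⟨ combo-∷ (h ◂ (f ∘ suc)) (λ k → lin α * x k) xs k ⟨
      combo (h ◂ (f ∘ suc)) ((λ k → lin α * x k) ∷ xs) k  ∎
      where
      divides-f₀ : lin α ∣ f zero
      divides-f₀ = canc (f zero) (∣-respʳ
        (begin
          applyD θ α - applyD (combo (f ∘ suc) xs) α
            ≈⟨ +-congʳ (trans (applyD-cong (λ k → trans (p k) (combo-∷ f x xs k)) (λ k → K.refl)) (trans (applyD-+ _ _ α) (+-congʳ (applyD-* (f zero) x α)))) ⟩
          f zero * applyD x α + applyD (combo (f ∘ suc) xs) α - applyD (combo (f ∘ suc) xs) α
            ≈⟨ solve 3 (λ a b c → a :* b :+ c :- c := b :* a) refl _ _ _ ⟩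
          applyD x α * f zero ∎)
        (∣-- (θ∈D α (new (λ k → K.refl))) (∣-combo α (f ∘ suc) xs d)))
      h = proj₁ divides-f₀
      f₀≈ = proj₂ divides-f₀
    indep : ∀ f → (∀ k → combo f ((λ k → lin α * x k) ∷ xs) k ≈ 0#) → ∀ i → f i ≈ 0#
    indep f e = λ { zero → regular α s αs≉0 (f zero) (trans (*-comm _ _) (zeros zero)) ; (suc i) → zeros (suc i) }
      where
      zeros : ∀ i → ((f zero * lin α) ◂ (f ∘ suc)) i ≈ 0#
      zeros = independent b _ (λ k → trans (combo-∷ _ x xs k) (trans (+-congʳ (*-assoc _ _ _))
        (trans (sym (combo-∷ f (λ k → lin α * x k) xs k)) (e k))))

-- Discrete integration

-- Discrete calculus with step z, in the basis of falling powers: with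
-- E ys k v = fall k v · ∏ (v − y), T ys k is an antidifference of z E ys k.
module Newton {a b} (R : CommutativeRing a b) (z : CommutativeRing.Carrier R) where
  open CommutativeRing R hiding (zero)
  open Divisibility R
  open ℤSolver R
  open Relation.Binary.Reasoning.Setoid setoid

  nat : ℕ → Carrier
  nat zero    = 0#
  nat (suc n) = 1# + nat n

  nat-+ : ∀ m n → nat (m ℕ.+ n) ≈ nat m + nat n
  nat-+ zero    n = sym (+-identityˡ _)
  nat-+ (suc m) n = trans (+-congˡ (nat-+ m n)) (sym (+-assoc _ _ _))

  fall : ℕ → Carrier → Carrier
  fall zero    v = 1#
  fall (suc k) v = fall k v * (v - nat k * z)

  E : List Carrier → ℕ → Carrier → Carrier
  E []       k v = fall k v
  E (y ∷ ys) k v = E ys (suc k) v + (nat k * z - y) * E ys k v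

  prod : List Carrier → Carrier → Carrier
  prod []       v = 1#
  prod (y ∷ ys) v = (v - y) * prod ys v

  fall-cong : ∀ k {v w} → v ≈ w → fall k v ≈ fall k w
  fall-cong zero    e = refl
  fall-cong (suc k) e = *-cong (fall-cong k e) (+-congʳ e)

  E-prod : ∀ ys k v → E ys k v ≈ fall k v * prod ys v
  E-prod []       k v = sym (*-identityʳ _)
  E-prod (y ∷ ys) k v = begin
    E ys (suc k) v + (nat k * z - y) * E ys k v
      ≈⟨ +-cong (E-prod ys (suc k) v) (*-congˡ (E-prod ys k v)) ⟩
    fall k v * (v - nat k * z) * prod ys v + (nat k * z - y) * (fall k v * prod ys v)
      ≈⟨ solve 5 (λ f v k p y → f :* (v :- k) :* p :+ (k :- y) :* (f :* p) := f :* ((v :- y) :* p)) refl (fall k v) v (nat k * z) (prod ys v) y ⟩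
    fall k v * ((v - y) * prod ys v) ∎

  prod-root : ∀ {ys v} → Any (v ≈_) ys → prod ys v ≈ 0#
  prod-root (here v≈y) = trans (*-congʳ (trans (+-congʳ v≈y) (-‿inverseʳ _))) (zeroˡ _)
  prod-root (there i)  = trans (*-congˡ (prod-root i)) (zeroʳ _)

  E-root : ∀ {ys v} k → Any (v ≈_) ys → E ys k v ≈ 0#
  E-root {ys} {v} k i = trans (E-prod ys k v) (trans (*-congˡ (prod-root i)) (zeroʳ _))

  fall-at-0 : ∀ k → fall (suc k) 0# ≈ 0#
  fall-at-0 zero    = solve 1 (λ z → :1 :* (con (+ 0) :- con (+ 0) :* z) := con (+ 0)) refl z
  fall-at-0 (suc k) = trans (*-congʳ (fall-at-0 k)) (zeroˡ _)

  fall-shift : ∀ k v → fall (suc k) (v + z) ≈ (v + z) * fall k v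
  fall-shift zero    v = solve 2 (λ v z → :1 :* (v :+ z :- con (+ 0) :* z) := (v :+ z) :* :1) refl v z
  fall-shift (suc k) v = trans (*-congʳ (fall-shift k v))
    (solve 4 (λ v z n f → (v :+ z) :* f :* (v :+ z :- (:1 :+ n) :* z) := (v :+ z) :* (f :* (v :- n :* z))) refl v z (nat k) (fall k v))

  fall-diff : ∀ {g} k v w → g ∣ v - w → g ∣ fall k v - fall k w
  fall-diff zero    v w d = ∣-respʳ (sym (-‿inverseʳ 1#)) (∣-0 _)
  fall-diff (suc k) v w d = ∣-mul-diff (fall-diff k v w d)
    (∣-respʳ (solve 3 (λ v w n → v :- w := (v :- n) :- (w :- n)) refl v w (nat k * z)) d)

  module Antidifference (inv : ℕ → Carrier) (nat-inv : ∀ k → nat (suc k) * inv k ≈ 1#) where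

    -- The recursion of `E` with each falling power replaced by its antidifference, the next falling
    -- power over k + 1; this division uses characteristic zero. The constant of integration is
    -- fixed by `T` vanishing at 0.
    T : List Carrier → ℕ → Carrier → Carrier
    T []       k v = inv k * fall (suc k) v
    T (y ∷ ys) k v = T ys (suc k) v + (nat k * z - y) * T ys k v

    T-cong : ∀ ys k {v w} → v ≈ w → T ys k v ≈ T ys k w
    T-cong []       k e = *-congˡ (fall-cong (suc k) e)
    T-cong (y ∷ ys) k e = +-cong (T-cong ys (suc k) e) (*-congˡ (T-cong ys k e))

    T-Δ : ∀ ys k v → T ys k (v + z) ≈ T ys k v + z * E ys k v
    T-Δ [] k v = begin
      inv k * fall (suc k) (v + z)
        ≈⟨ *-congˡ (fall-shift k v) ⟩
      inv k * ((v + z) * fall k v)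
        ≈⟨ solve 5 (λ i v z f n → i :* ((v :+ z) :* f) := i :* (f :* (v :- n :* z)) :+ z :* (((:1 :+ n) :* i) :* f)) refl (inv k) v z (fall k v) (nat k) ⟩
      inv k * fall (suc k) v + z * (nat (suc k) * inv k * fall k v)
        ≈⟨ +-congˡ (*-congˡ (trans (*-congʳ (nat-inv k)) (*-identityˡ _))) ⟩
      inv k * fall (suc k) v + z * fall k v ∎
    T-Δ (y ∷ ys) k v = begin
      T ys (suc k) (v + z) + (nat k * z - y) * T ys k (v + z)
        ≈⟨ +-cong (T-Δ ys (suc k) v) (*-congˡ (T-Δ ys k v)) ⟩
      T ys (suc k) v + z * E ys (suc k) v + (nat k * z - y) * (T ys k v + z * E ys k v)
        ≈⟨ solve 6 (λ a e t b f z → (a :+ z :* e) :+ t :* (b :+ z :* f) := (a :+ t :* b) :+ z :* (e :+ t :* f)) refl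
             (T ys (suc k) v) (E ys (suc k) v) (nat k * z - y) (T ys k v) (E ys k v) z ⟩
      T ys (suc k) v + (nat k * z - y) * T ys k v + z * (E ys (suc k) v + (nat k * z - y) * E ys k v) ∎

    T-diff : ∀ {g} ys k v w → g ∣ v - w → g ∣ T ys k v - T ys k w
    T-diff []       k v w d = ∣-respʳ (solve 3 (λ i a b → i :* (a :- b) := i :* a :- i :* b) refl _ _ _)
      (∣-*ˡ (inv k) (fall-diff (suc k) v w d))
    T-diff (y ∷ ys) k v w d = ∣-respʳ
      (solve 5 (λ a b c e t → (a :- b) :+ t :* (c :- e) := (a :+ t :* c) :- (b :+ t :* e)) refl _ _ _ _ _)
      (∣-+ (T-diff ys (suc k) v w d) (∣-*ˡ (nat k * z - y) (T-diff ys k v w d)))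

    T-pointwise : ∀ {xs ys} → Pointwise _≈_ xs ys → ∀ k v → T xs k v ≈ T ys k v
    T-pointwise []      k v = refl
    T-pointwise (e ∷ p) k v = +-cong (T-pointwise p (suc k) v) (*-cong (+-congˡ (-‿cong e)) (T-pointwise p k v))

    -- The integrand is symmetric in its roots, but the recursion peels them off in order; the
    -- content is that two neighbouring steps commute.
    T-↭ : ∀ {xs ys} → xs ↭ ys → ∀ k v → T xs k v ≈ T ys k v
    T-↭ _↭_.refl          k v = refl
    T-↭ (_↭_.prep x p)    k v = +-cong (T-↭ p (suc k) v) (*-congˡ (T-↭ p k v))
    T-↭ (_↭_.trans p q)   k v = trans (T-↭ p k v) (T-↭ q k v)
    T-↭ (_↭_.swap {xs} {ys} x y p) k v = trans
      (+-cong (+-cong (T-↭ p (suc (suc k)) v) (*-congˡ (T-↭ p (suc k) v))) (*-congˡ (+-cong (T-↭ p (suc k) v) (*-congˡ (T-↭ p k v)))))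
      (solve 7 (λ a b c n z x y →
          (a :+ ((:1 :+ n) :* z :- y) :* b) :+ (n :* z :- x) :* (b :+ (n :* z :- y) :* c)
        := (a :+ ((:1 :+ n) :* z :- x) :* b) :+ (n :* z :- y) :* (b :+ (n :* z :- x) :* c)) refl
        (T ys (suc (suc k)) v) (T ys (suc k) v) (T ys k v) (nat k) z x y)

    private
      lowered : List Carrier → ℕ → Carrier → Carrier
      lowered ys zero    v = 0#
      lowered ys (suc k) v = nat (suc k) * z * T ys k v

      -- As fall k (t + z) = fall k t + k z fall (k − 1) t, the left side is an antidifference
      -- of z E ys k (t + z), while T ys k is one of z E ys k t.
      T-shift-k : ∀ ys k v → T (map (_- z) ys) k v + lowered (map (_- z) ys) k v ≈
                             T ys k v + z * (E ys k v - E ys k 0#)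
      T-shift-k [] zero    v = solve 2 (λ a z → a :+ con (+ 0) := a :+ z :* (:1 :- :1)) refl _ z
      T-shift-k [] (suc k) v = begin
        T [] (suc k) v + nat (suc k) * z * (inv k * fall (suc k) v)
          ≈⟨ +-congˡ (solve 4 (λ n z i f → n :* z :* (i :* f) := z :* ((n :* i) :* f)) refl (nat (suc k)) z (inv k) (fall (suc k) v)) ⟩
        T [] (suc k) v + z * (nat (suc k) * inv k * fall (suc k) v)
          ≈⟨ +-congˡ (*-congˡ (trans (*-congʳ (nat-inv k)) (*-identityˡ _))) ⟩
        T [] (suc k) v + z * fall (suc k) v
          ≈⟨ +-congˡ (*-congˡ (solve 1 (λ f → f := f :- con (+ 0)) refl (fall (suc k) v))) ⟩
        T [] (suc k) v + z * (fall (suc k) v - 0#)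
          ≈⟨ +-congˡ (*-congˡ (+-congˡ (-‿cong (fall-at-0 k)))) ⟨
        T [] (suc k) v + z * (fall (suc k) v - fall (suc k) 0#) ∎
      T-shift-k (y ∷ ys) k v = trans (unfold k) (trans
        (+-cong (T-shift-k ys (suc k) v) (*-congˡ (T-shift-k ys k v)))
        (solve 8 (λ a b z e f t g h →
             (a :+ z :* (e :- g)) :+ t :* (b :+ z :* (f :- h))
           := (a :+ t :* b) :+ z :* ((e :+ t :* f) :- (g :+ t :* h))) refl
           (T ys (suc k) v) (T ys k v) z (E ys (suc k) v) (E ys k v) (nat k * z - y) (E ys (suc k) 0#) (E ys k 0#)))
        where
        ys⁻ = map (_- z) ys
        unfold : ∀ k → T ((y - z) ∷ ys⁻) k v + lowered ((y - z) ∷ ys⁻) k v ≈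
                       T ys⁻ (suc k) v + lowered ys⁻ (suc k) v + (nat k * z - y) * (T ys⁻ k v + lowered ys⁻ k v)
        unfold zero    = solve 4 (λ a b y z → (a :+ (con (+ 0) :* z :- (y :- z)) :* b) :+ con (+ 0)
            := (a :+ (:1 :+ con (+ 0)) :* z :* b) :+ (con (+ 0) :* z :- y) :* (b :+ con (+ 0))) refl
            (T ys⁻ 1 v) (T ys⁻ 0 v) y z
        unfold (suc k) = solve 6 (λ a b c y z n →
              (a :+ ((:1 :+ n) :* z :- (y :- z)) :* b) :+ (:1 :+ n) :* z :* (b :+ (n :* z :- (y :- z)) :* c)
            := (a :+ (:1 :+ (:1 :+ n)) :* z :* b) :+ ((:1 :+ n) :* z :- y) :* (b :+ (:1 :+ n) :* z :* c)) refl
            (T ys⁻ (suc (suc k)) v) (T ys⁻ (suc k) v) (T ys⁻ k v) y z (nat k)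

    -- Translating the roots by -z translates the integrand, so the left side is `T ys 0 (v + z)` up
    -- to a constant. The last term is that constant, since `T` vanishes at 0.
    T-shift : ∀ ys v → T (map (_- z) ys) 0 v ≈ T ys 0 v + z * (E ys 0 v - E ys 0 0#)
    T-shift ys v = trans (sym (+-identityʳ _)) (T-shift-k ys 0 v)

-- Descending order puts the element of highest index at the head, which is where `⇄-head` exchanges
-- it after the last wall.
down : ∀ {a} {A : Set a} → (ℕ → A) → (m : ℕ) → ∀ {r} → Vec A r → Vec A (m ℕ.+ r)
down f zero    rest = rest
down f (suc m) rest = f m ∷ down f m rest

-- Derivations from antidifferences, and the relation for the top element

module Derivations {c ℓ} {K : Field c ℓ} (char : CharZero K) {l : ℕ} (PL : PolyLike K (suc l)) where
  open PolyLike PL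
  open LinearAlgebra PL
  private module K = Field K
  open FieldOps K
  open ℤSolver R
  open Relation.Binary.Reasoning.Setoid setoid

  z : Carrier
  z = y zero

  open Newton R z public

  nat≈ι : ∀ n → nat n ≈ ι (natK n)
  nat≈ι zero    = sym ι-0
  nat≈ι (suc n) = trans (+-cong (sym ι-1) (nat≈ι n)) (sym (ι-+ _ _))

  inv : ℕ → Carrier
  inv k = ι (K.inv (natK (suc k)) (char k))

  nat-inv : ∀ k → nat (suc k) * inv k ≈ 1#
  nat-inv k = trans (*-congʳ (nat≈ι (suc k))) (trans (sym (ι-* _ _)) (trans (ι-cong (K.inverse _ (char k))) ι-1))

  open Antidifference inv nat-inv public

  -- Needed because the relation for the top element first appears multiplied by the step `z`.
  z-regular : ∀ f → z * f ≈ 0# → f ≈ 0#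
  z-regular f e = regular e₀ zero (λ 1≈0 → K.0≉1 (K.sym 1≈0)) f (trans (*-congʳ lin-e₀) e)
    where
    e₀ : Fin (suc l) → K.Carrier
    e₀ zero    = K.1#
    e₀ (suc _) = K.0#
    lin-e₀ : lin e₀ ≈ z
    lin-e₀ = trans (∑-single _ zero λ { zero ne → contradiction ≡.refl ne ; (suc i) _ → trans (*-congʳ ι-0) (zeroˡ _) })
      (trans (*-congʳ ι-1) (*-identityˡ _))

  module AtPoints (V : Fin l → Carrier) where

    der : (Carrier → Carrier) → Der
    der F zero    = 0#
    der F (suc i) = F (V i)

    ones : Der
    ones = der (λ _ → 1#)

    module LeadingTerms (X : ℕ → Der) {r} (rest : Vec Der r) where

      -- Leading-term calculus: `θ` is congruent to `c` times `X m` modulo the elements of lower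
      -- index and `rest`. Only leading coefficients matter later, so the lower terms stay hidden in
      -- `Span`.
      Lead : ℕ → Carrier → Der → Set _
      Lead m c θ = Span (down X m rest) (λ k → θ k - c * X m k)

      span-rest : ∀ m {θ} → Span rest θ → Span (down X m rest) θ
      span-rest zero    s = s
      span-rest (suc m) s = span-there (span-rest m s)

      lead-cong : ∀ {m c d θ φ} → c ≈ d → θ ≈D φ → Lead m c θ → Lead m d φ
      lead-cong e p = span-cong (λ k → +-cong (p k) (-‿cong (*-congʳ e)))

      lead-+ : ∀ {m c d θ φ} → Lead m c θ → Lead m d φ → Lead m (c + d) (λ k → θ k + φ k)
      lead-+ s t = span-cong (λ k → solve 5 (λ a b c d x → (a :- c :* x) :+ (b :- d :* x) := a :+ b :- (c :+ d) :* x) refl _ _ _ _ _) (span-+ s t)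

      lead-* : ∀ {m c θ} t → Lead m c θ → Lead m (t * c) (λ k → t * θ k)
      lead-* t s = span-cong (λ k → solve 4 (λ a c t x → t :* (a :- c :* x) := t :* a :- t :* c :* x) refl _ _ _ _) (span-* t s)

      lead-span : ∀ {m θ} → Span (down X m rest) θ → Lead m 0# θ
      lead-span = span-cong (λ k → solve 2 (λ a x → a := a :- con (+ 0) :* x) refl _ _)

      span-lead : ∀ {m c θ} → Lead m c θ → Span (down X (suc m) rest) θ
      span-lead {m} {c} s = span-cong (λ k → solve 2 (λ a x → (a :- x) :+ x := a) refl _ _)
        (span-+ (span-there s) (span-* c span-here))

      lead-self : ∀ m → Lead m 1# (X m)
      lead-self m = span-0 _ (λ k → solve 1 (λ x → x :- :1 :* x := con (+ 0)) refl _)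

      lead-0 : ∀ m {θ} → (∀ k → θ k ≈ 0#) → Lead m 0# θ
      lead-0 m e = lead-span (span-0 _ e)

    module _ (Y : List Carrier) {r} (rest : Vec Der r) where
      open LeadingTerms (λ k → der (T Y k)) rest

      -- Each further root multiplies the integrand by a monic linear factor, which raises the
      -- leading falling power by one and keeps its coefficient.
      lead-T : ∀ rs k {m} → k ℕ.+ length rs ≡ m → Lead m 1# (der (T (rs ++ Y) k))
      lead-T []       k {m} e rewrite ≡.trans (≡.sym (ℕP.+-identityʳ k)) e = lead-self m
      lead-T (b ∷ rs) k {m} e = lead-cong (+-identityʳ 1#)
        (λ { zero → solve 2 (λ n b → con (+ 0) :+ (n :- b) :* con (+ 0) := con (+ 0)) refl (nat k * z) b ; (suc i) → refl })
        (lead-+ (lead-T rs (suc k) e′) (lead-span (span-* (nat k * z - b) (tail e′))))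
        where
        e′ = ≡.trans (≡.sym (ℕP.+-suc k (length rs))) e
        tail : ∀ {m} → suc (k ℕ.+ length rs) ≡ m → Span (down (λ k → der (T Y k)) m rest) (der (T (rs ++ Y) k))
        tail ≡.refl = span-lead (lead-T rs k ≡.refl)

    -- Q(t) = ∏ (t − P) over all points P of the intervals vanishes at every V i, and its
    -- difference is the integrand ∏ (t − y) over ys times z q(t), with q of leading coefficient
    -- Σ w and with q(yₛ) = wₛ ∏ α. Expanding q around yₛ thus expresses the new top element X m
    -- through ∏ α · T ys 0, lower terms and constants; characteristic zero makes Σ w invertible.
    module TopRelation
      (ys : List Carrier) (yₛ : Carrier) {J : Set} (a b α : J → Carrier) (w : J → ℕ)
      (a-b : ∀ j → a j - b j ≈ nat (w j) * z) (y-b : ∀ j → yₛ - b j ≈ α j)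
      {r} (rest : Vec Der r) (ones∈rest : Span rest ones)
      where

      Y : List Carrier
      Y = yₛ ∷ ys

      X : ℕ → Der
      X k = der (T Y k)

      open LeadingTerms X rest

      ∏α : List J → Carrier
      ∏α []       = 1#
      ∏α (j ∷ js) = α j * ∏α js

      -- The roots `b j` are exchanged for `a j` one at a time. Each exchange costs a multiple of
      -- `a j − b j = w_j z`, and `D₁` is the total cost divided by `z`; so its leading coefficient
      -- is the sum of the `w j`.
      D₁ : List J → ℕ → Carrier → Carrier
      D₁ []       k v = 0#
      D₁ (j ∷ js) k v = D₁ js (suc k) v + (nat k * z - a j) * D₁ js k v + nat (w j) * T (map b js ++ Y) k v

      D₁-spec : ∀ js k v → T (map b js ++ Y) k v ≈ T (map a js ++ Y) k v + z * D₁ js k v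
      D₁-spec []       k v = solve 2 (λ t z → t := t :+ z :* con (+ 0)) refl _ z
      D₁-spec (j ∷ js) k v = begin
        T B (suc k) v + (κ - b j) * T B k v
          ≈⟨ solve 5 (λ t s k a b → t :+ (k :- b) :* s := t :+ (k :- a) :* s :+ (a :- b) :* s) refl (T B (suc k) v) (T B k v) κ (a j) (b j) ⟩
        T B (suc k) v + (κ - a j) * T B k v + (a j - b j) * T B k v
          ≈⟨ +-cong (+-cong (D₁-spec js (suc k) v) (*-congˡ (D₁-spec js k v))) (*-congʳ (a-b j)) ⟩
        T A (suc k) v + z * D₁ js (suc k) v + (κ - a j) * (T A k v + z * D₁ js k v) + nat (w j) * z * T B k v
          ≈⟨ solve 8 (λ t d k s e w u z → t :+ z :* d :+ k :* (s :+ z :* e) :+ w :* z :* u := t :+ k :* s :+ z :* (d :+ k :* e :+ w :* u)) refl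
               (T A (suc k) v) (D₁ js (suc k) v) (κ - a j) (T A k v) (D₁ js k v) (nat (w j)) (T B k v) z ⟩
        T A (suc k) v + (κ - a j) * T A k v + z * (D₁ js (suc k) v + (κ - a j) * D₁ js k v + nat (w j) * T B k v) ∎
        where
        κ = nat k * z
        B = map b js ++ Y
        A = map a js ++ Y

      length-map′ : ∀ (f : J → Carrier) js {k m} → k ℕ.+ length js ≡ m → k ℕ.+ length (map f js) ≡ m
      length-map′ f []       e = e
      length-map′ f (j ∷ js) {k} e = ≡.trans (ℕP.+-suc k _) (length-map′ f js (≡.trans (≡.sym (ℕP.+-suc k _)) e))

      weight : List J → ℕ
      weight []       = 0
      weight (j ∷ js) = w j ℕ.+ weight js

      D₁-lead : ∀ js k m → k ℕ.+ length js ≡ suc m → Lead m (nat (weight js)) (der (D₁ js k))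
      D₁-lead []       k m e = lead-0 m (λ { zero → refl ; (suc i) → refl })
      D₁-lead (j ∷ js) k m e = lead-cong
        (trans (solve 2 (λ a b → a :+ con (+ 0) :+ b :* :1 := b :+ a) refl _ _) (sym (nat-+ (w j) (weight js))))
        (λ { zero → solve 2 (λ κ w → con (+ 0) :+ κ :* con (+ 0) :+ w :* con (+ 0) := con (+ 0)) refl _ _ ; (suc i) → refl })
        (lead-+ (lead-+ (D₁-lead js (suc k) m e′) (lead-span (span-* (nat k * z - a j) (low js m (ℕP.suc-injective e′)))))
                (lead-* (nat (w j)) (lead-T Y rest (map b js) k (length-map′ b js (ℕP.suc-injective e′)))))
        where
        e′ = ≡.trans (≡.sym (ℕP.+-suc k (length js))) e
        low : ∀ js m → k ℕ.+ length js ≡ m → Span (down X m rest) (der (D₁ js k))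
        low []       m       e = span-0 _ (λ { zero → refl ; (suc i) → refl })
        low (j ∷ js) (suc m) e = span-lead (D₁-lead (j ∷ js) k m e)
        low (j ∷ js) zero    e with () ← ≡.trans (≡.sym (ℕP.+-suc k (length js))) e

      -- The remainder when the product of the `t − b j` is expanded around `yₛ`: exchanging `b j`
      -- for `yₛ` leaves `yₛ − b j = α j` times the product with that factor removed.
      D₂ : List J → Carrier → Carrier
      D₂ []       v = 0#
      D₂ (j ∷ js) v = T (map b js ++ Y) 0 v + α j * D₂ js v

      T-replace : ∀ p q ys v → T (p ∷ ys) 0 v ≈ T (q ∷ ys) 0 v + (q - p) * T ys 0 v
      T-replace p q ys v = solve 5 (λ t s z p q →
        t :+ (con (+ 0) :* z :- p) :* s := t :+ (con (+ 0) :* z :- q) :* s :+ (q :- p) :* s) refl (T ys 1 v) (T ys 0 v) z p q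

      D₂-spec : ∀ js v → T (map b js ++ ys) 0 v ≈ ∏α js * T ys 0 v + D₂ js v
      D₂-spec []       v = solve 1 (λ t → t := :1 :* t :+ con (+ 0)) refl _
      D₂-spec (j ∷ js) v = begin
        T (b j ∷ map b js ++ ys) 0 v
          ≈⟨ T-replace (b j) yₛ (map b js ++ ys) v ⟩
        T (yₛ ∷ map b js ++ ys) 0 v + (yₛ - b j) * T (map b js ++ ys) 0 v
          ≈⟨ +-cong (T-↭ (↭-sym (↭P.shift yₛ (map b js) ys)) 0 v) (*-cong (y-b j) (D₂-spec js v)) ⟩
        T (map b js ++ Y) 0 v + α j * (∏α js * T ys 0 v + D₂ js v)
          ≈⟨ solve 5 (λ t a p s d → t :+ a :* (p :* s :+ d) := a :* p :* s :+ (t :+ a :* d)) refl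
               (T (map b js ++ Y) 0 v) (α j) (∏α js) (T ys 0 v) (D₂ js v) ⟩
        α j * ∏α js * T ys 0 v + (T (map b js ++ Y) 0 v + α j * D₂ js v) ∎

      D₂-lead : ∀ js m → length js ≡ suc m → Lead m 1# (der (D₂ js))
      D₂-lead (j ∷ js) m e = lead-cong (+-identityʳ 1#)
        (λ { zero → solve 1 (λ a → con (+ 0) :+ a :* con (+ 0) := con (+ 0)) refl _ ; (suc i) → refl })
        (lead-+ (lead-T Y rest (map b js) 0 (length-map′ b js (ℕP.suc-injective e)))
                (lead-span (span-* (α j) (low js m (ℕP.suc-injective e)))))
        where
        low : ∀ js m → length js ≡ m → Span (down X m rest) (der (D₂ js))
        low []       m       e = span-0 _ (λ { zero → refl ; (suc i) → refl })
        low (j ∷ js) (suc m) e = span-lead (D₂-lead (j ∷ js) m e)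

      module _
        (js : List J) {m} (length-js : length js ≡ suc m)
        (bₛ : Carrier) (nₛ : ℕ) (yₛ-bₛ : yₛ - bₛ ≈ nat (suc nₛ) * z)
        (shifted : ∀ v → T (bₛ ∷ map b js ++ ys) 0 v ≈ T (map (_- z) (yₛ ∷ map a js ++ ys)) 0 v)
        (root : ∀ i → E (yₛ ∷ map a js ++ ys) 0 (V i) ≈ 0#)
        where
        private
          wₛ = nat (suc nₛ)
          e₀ = E (yₛ ∷ map a js ++ ys) 0 0#
          n  = nₛ ℕ.+ weight js
          N′ = nat (suc n)

          relation : ∀ i → D₁ js 0 (V i) + wₛ * D₂ js (V i) ≈ - (wₛ * (∏α js * T ys 0 (V i)) + e₀)
          relation i = begin
            d₁ + wₛ * d₂
              ≈⟨ solve 4 (λ d p e q → d :+ q := (d :+ (p :+ q) :+ e) :- (p :+ e)) refl d₁ (wₛ * (∏α js * t)) e₀ (wₛ * d₂) ⟩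
            d₁ + (wₛ * (∏α js * t) + wₛ * d₂) + e₀ - (wₛ * (∏α js * t) + e₀)
              ≈⟨ +-congʳ (trans (+-congʳ (+-congˡ (sym (distribˡ _ _ _)))) (z-regular _ total)) ⟩
            0# - (wₛ * (∏α js * t) + e₀)
              ≈⟨ +-identityˡ _ ⟩
            - (wₛ * (∏α js * t) + e₀) ∎
            where
            v  = V i
            d₁ = D₁ js 0 v
            d₂ = D₂ js v
            t  = T ys 0 v
            B  = T (map b js ++ ys) 0 v
            A  = T (map a js ++ Y) 0 v
            -- The antidifference with roots `bₛ`, `b`, `ys` is computed twice: by exchanging roots
            -- one at a time, and by translating all points, where `E` drops out because `V i` is
            -- itself a point.
            total : z * (d₁ + wₛ * (∏α js * t + d₂) + e₀) ≈ 0#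
            total = begin
              z * (d₁ + wₛ * (∏α js * t + d₂) + e₀)
                ≈⟨ solve 6 (λ z d w p e A → z :* (d :+ w :* p :+ e) := A :+ z :* d :+ w :* z :* p :- (A :+ z :* (con (+ 0) :- e))) refl
                     z d₁ wₛ (∏α js * t + d₂) e₀ A ⟩
              A + z * d₁ + wₛ * z * (∏α js * t + d₂) - (A + z * (0# - e₀))
                ≈⟨ +-cong (+-cong (D₁-spec js 0 v) (*-cong yₛ-bₛ (D₂-spec js v)))
                     (-‿cong (+-cong (T-↭ (↭-sym (↭P.shift yₛ (map a js) ys)) 0 v) (*-congˡ (+-congʳ (root i))))) ⟨
              T (map b js ++ Y) 0 v + (yₛ - bₛ) * B - (T (yₛ ∷ map a js ++ ys) 0 v + z * (E (yₛ ∷ map a js ++ ys) 0 v - e₀))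
                ≈⟨ +-cong (+-congʳ (T-↭ (↭P.shift yₛ (map b js) ys) 0 v)) (-‿cong (sym (T-shift (yₛ ∷ map a js ++ ys) v))) ⟩
              T (yₛ ∷ map b js ++ ys) 0 v + (yₛ - bₛ) * B - T (map (_- z) (yₛ ∷ map a js ++ ys)) 0 v
                ≈⟨ +-cong (sym (T-replace bₛ yₛ (map b js ++ ys) v)) (-‿cong (sym (shifted v))) ⟩
              T (bₛ ∷ map b js ++ ys) 0 v - T (bₛ ∷ map b js ++ ys) 0 v
                ≈⟨ -‿inverseʳ _ ⟩
              0# ∎

        -- As `inv n` is the inverse of `N′`, this is -wₛ / N′, with `N′` the sum of all weights
        -- including that of s.
        top-unit top-unit⁻¹ : Carrier
        top-unit   = - (inv n * wₛ)
        top-unit⁻¹ = - (N′ * inv nₛ)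

        top-unit-inverse : top-unit * top-unit⁻¹ ≈ 1#
        top-unit-inverse = trans
          (solve 4 (λ i w N j → :- (i :* w) :* :- (N :* j) := (N :* i) :* (w :* j)) refl (inv n) wₛ N′ (inv nₛ))
          (trans (*-cong (nat-inv n) (nat-inv nₛ)) (*-identityˡ 1#))

        top-relation : Span (down X m rest) (λ k → X m k - top-unit * (∏α js * der (T ys 0) k))
        top-relation = span-cong eq
          (span-* (- inv n) (span-+ (lead-cong coefficient (λ k → refl)
              (lead-+ (D₁-lead js 0 m length-js) (lead-* wₛ (D₂-lead js m length-js))))
            (span-rest m (span-* e₀ ones∈rest))))
          where
          coefficient : nat (weight js) + wₛ * 1# ≈ N′
          coefficient = trans (solve 2 (λ a w → a :+ w :* :1 := w :+ a) refl _ _) (sym (nat-+ (suc nₛ) (weight js)))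
          eq : ∀ k → - inv n * (der (D₁ js 0) k + wₛ * der (D₂ js) k - N′ * X m k + e₀ * ones k) ≈
                     X m k - top-unit * (∏α js * der (T ys 0) k)
          eq zero = solve 6 (λ i w N e o p →
            :- i :* (con (+ 0) :+ w :* con (+ 0) :- N :* con (+ 0) :+ e :* con (+ 0)) := con (+ 0) :- :- (i :* w) :* (p :* con (+ 0))) refl
            (inv n) wₛ N′ e₀ 0# (∏α js)
          eq (suc i) = begin
            - inv n * (D₁ js 0 (V i) + wₛ * D₂ js (V i) - N′ * x + e₀ * 1#)
              ≈⟨ *-congˡ (+-congʳ (+-congʳ (relation i))) ⟩
            - inv n * (- (wₛ * p + e₀) - N′ * x + e₀ * 1#)
              ≈⟨ solve 6 (λ i w p e N x → :- i :* (:- (w :* p :+ e) :- N :* x :+ e :* :1) := (N :* i) :* x :- :- (i :* w) :* p) refl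
                   (inv n) wₛ p e₀ N′ x ⟩
            N′ * inv n * x - top-unit * p
              ≈⟨ +-congʳ (trans (*-congʳ (nat-inv n)) (*-identityˡ x)) ⟩
            x - top-unit * p ∎
            where
            x = X m (suc i)
            p = ∏α js * T ys 0 (V i)

-- Inductive freeness depends only on the hyperplanes

module Invariance {c ℓ} (K : Field c ℓ) where
  open Field K hiding (zero)
  open Arrangements K
  open ℤSolver commutativeRing
  open Relation.Binary.Reasoning.Setoid setoid

  -- Inclusion of the sets of hyperplanes: forms are compared up to nonzero scalars.
  infix 4 _≼_ _≃_
  record _≼_ {N} (A B : Arr N) : Set (lsuc (c ⊔ ℓ)) where
    constructor ≼-by
    field
      rescale : ∀ β → A β → ∃ λ t → ∃ λ γ → ¬ t ≈ 0# × B γ × (∀ k → β k ≈ t * γ k)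
  open _≼_ public

  ≼-by-≈ : ∀ {N} {A B : Arr N} → (∀ β → A β → ∃ λ γ → B γ × β ≈F γ) → A ≼ B
  ≼-by-≈ f = ≼-by λ β Aβ → let γ , Bγ , e = f β Aβ in
    1# , γ , 0≉1 ∘ sym , Bγ , λ k → trans (e k) (sym (*-identityˡ _))

  record _≃_ {N} (A B : Arr N) : Set (lsuc (c ⊔ ℓ)) where
    constructor _,≃_
    field
      forth : A ≼ B
      back  : B ≼ A

  ≃-sym : ∀ {N} {A B : Arr N} → A ≃ B → B ≃ A
  ≃-sym (f ,≃ g) = g ,≃ f

  restrictF-cong : ∀ {N} k (α : Form (suc N)) nz {β γ} → β ≈F γ → restrictF k α nz β ≈F restrictF k α nz γ
  restrictF-cong k α nz e j = +-cong (e _) (-‿cong (*-congʳ (e k)))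

  restrictF-scale : ∀ {N} k (α : Form (suc N)) nz t β j →
                    restrictF k α nz (λ i → t * β i) j ≈ t * restrictF k α nz β j
  restrictF-scale k α nz t β j =
    solve 4 (λ t b c a → t :* b :- t :* c :* a := t :* (b :- c :* a)) refl t (β (punchIn k j)) (β k) (α (punchIn k j) * inv (α k) nz)

  module _ {N} {A B : Arr N} {α γ : Form N} {t} (t≉0 : ¬ t ≈ 0#) (α≈tγ : ∀ k → α k ≈ t * γ k) (A≼B : A ≼ B) where

    Del-≼ : Del A α ≼ Del B γ
    Del-≼ = ≼-by λ β → λ { (Aβ , np) →
      let u , η , u≉0 , Bη , e = rescale A≼B β Aβ in
      u , η , u≉0 , (Bη , λ { (r , f) → np (u * r * inv t t≉0 , λ k → begin
          β k                                ≈⟨ trans (e k) (*-congˡ (f k)) ⟩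
          u * (r * γ k)                      ≈⟨ *-identityˡ _ ⟨
          1# * (u * (r * γ k))               ≈⟨ *-congʳ (inverse t t≉0) ⟨
          t * inv t t≉0 * (u * (r * γ k))    ≈⟨ solve 5 (λ t i u r g → t :* i :* (u :* (r :* g)) := u :* r :* i :* (t :* g)) refl t _ u r (γ k) ⟩
          u * r * inv t t≉0 * (t * γ k)      ≈⟨ *-congˡ (α≈tγ k) ⟨
          u * r * inv t t≉0 * α k            ∎) }) , e }

  invert-scale : ∀ {t} (t≉0 : ¬ t ≈ 0#) {a g} → a ≈ t * g → g ≈ inv t t≉0 * a
  invert-scale {t} t≉0 {a} {g} e = begin
    g                       ≈⟨ *-identityˡ g ⟨
    1# * g                  ≈⟨ *-congʳ (inverse t t≉0) ⟨
    t * inv t t≉0 * g       ≈⟨ solve 3 (λ t i g → t :* i :* g := i :* (t :* g)) refl _ _ _ ⟩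
    inv t t≉0 * (t * g)     ≈⟨ *-congˡ e ⟨
    inv t t≉0 * a           ∎

  inv-nonzero : ∀ {t} (t≉0 : ¬ t ≈ 0#) → ¬ inv t t≉0 ≈ 0#
  inv-nonzero {t} t≉0 e = 0≉1 (trans (sym (trans (*-congˡ e) (zeroʳ t))) (inverse t t≉0))

  inv-unique : ∀ {x y} (nz : ¬ x ≈ 0#) → x * y ≈ 1# → inv x nz ≈ y
  inv-unique {x} {y} nz e = trans (sym (*-identityʳ _)) (sym (invert-scale nz (sym e)))

  -- Restriction sees `α` only through the quotients of its coefficients by `α k`, from which the
  -- factor `t` cancels.
  restrictF-congα : ∀ {N} k {α γ : Form (suc N)} nz nz′ {t} → ¬ t ≈ 0# → (∀ i → α i ≈ t * γ i) →
                    ∀ β → restrictF k α nz β ≈F restrictF k γ nz′ β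
  restrictF-congα k {α} {γ} nz nz′ {t} t≉0 e β j = +-congˡ (-‿cong (*-congˡ (begin
    α (punchIn k j) * inv (α k) nz
      ≈⟨ *-cong (e _) (inv-unique nz (begin
           α k * (inv t t≉0 * inv (γ k) nz′)          ≈⟨ *-congʳ (e k) ⟩
           t * γ k * (inv t t≉0 * inv (γ k) nz′)      ≈⟨ solve 4 (λ t g i h → t :* g :* (i :* h) := (t :* i) :* (g :* h)) refl _ _ _ _ ⟩
           t * inv t t≉0 * (γ k * inv (γ k) nz′)      ≈⟨ *-cong (inverse t t≉0) (inverse (γ k) nz′) ⟩
           1# * 1#                                    ≈⟨ *-identityˡ 1# ⟩
           1#                                         ∎)) ⟩
    t * γ (punchIn k j) * (inv t t≉0 * inv (γ k) nz′)
      ≈⟨ solve 4 (λ t g i h → t :* g :* (i :* h) := (t :* i) :* (g :* h)) refl _ _ _ _ ⟩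
    t * inv t t≉0 * (γ (punchIn k j) * inv (γ k) nz′)
      ≈⟨ trans (*-congʳ (inverse t t≉0)) (*-identityˡ _) ⟩
    γ (punchIn k j) * inv (γ k) nz′ ∎)))

  Res-≼ : ∀ {N} {A B : Arr (suc N)} {k α γ} nz nz′ {t} → ¬ t ≈ 0# → (∀ i → α i ≈ t * γ i) → A ≼ B →
          Res A k α nz ≼ Res B k γ nz′
  Res-≼ {k = k} {α} {γ} nz nz′ {t} t≉0 e A≼B = ≼-by λ η → λ { (β , Dβ , η≈) →
    let u , β′ , u≉0 , D′ , f = rescale (Del-≼ t≉0 e A≼B) β Dβ in
    u , restrictF k γ nz′ β′ , u≉0 , (β′ , D′ , λ j → refl) , λ j → begin
      η j                                   ≈⟨ η≈ j ⟩
      restrictF k α nz β j                  ≈⟨ restrictF-congα k nz nz′ t≉0 e β j ⟩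
      restrictF k γ nz′ β j                 ≈⟨ restrictF-cong k γ nz′ f j ⟩
      restrictF k γ nz′ (λ i → u * β′ i) j  ≈⟨ restrictF-scale k γ nz′ u β′ j ⟩
      u * restrictF k γ nz′ β′ j            ∎ }

  module _ {N} (PL : PolyLike K N) where
    open PolyLike PL using (ι)
    private module S = PolyLike PL
    open LinearAlgebra PL using (Basis; applyD-scale; applyD-cong; members; spans; independent) renaming (InD to InD′)

    InD-≼ : ∀ {A B} → B ≼ A → ∀ θ → InD′ A θ → InD′ B θ
    InD-≼ B≼A θ d β Bβ with rescale B≼A β Bβ
    ... | t , γ , _ , Aγ , e with d γ Aγ
    ...   | h , f = h , S.trans (applyD-cong′ θ) (S.trans (S.*-congˡ f) (S.trans (S.sym (S.*-assoc _ _ _)) (S.*-congʳ (S.sym (applyD-cong′ S.y)))))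
      where
      applyD-cong′ : ∀ θ → LinearAlgebra.applyD PL θ β S.≈ ι t S.* LinearAlgebra.applyD PL θ γ
      applyD-cong′ θ = S.trans (applyD-cong (λ _ → S.refl) e) (applyD-scale θ t γ)

    basis-≃ : ∀ {A B m} {xs : Vec _ m} → A ≃ B → Basis A xs → Basis B xs
    basis-≃ (A≼B ,≃ B≼A) b = record
      { members     = λ i → InD-≼ B≼A _ (members b i)
      ; spans       = λ θ d → spans b θ (InD-≼ A≼B θ d)
      ; independent = independent b }

  FreeWith-≃ : ∀ {N m} {A B : Arr N} (e : Vec ℕ m) → A ≃ B → FreeWith A e → FreeWith B e
  FreeWith-≃ {N} e (A≼B ,≃ B≼A) (xs , hom , mem , span , ind) =
    xs , hom , (λ i → InD-≼ (Instance.polyLike K N) B≼A (xs i) (mem i))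
       , (λ θ d → span θ (InD-≼ (Instance.polyLike K N) A≼B θ d)) , ind

  IndFree-≃ : ∀ {N} {A B : Arr N} → A ≃ B → IndFree N A → IndFree N B
  IndFree-≃ (A≼B ,≃ B≼A) (empty ∅) = empty λ β Bβ → let _ , γ , _ , Aγ , _ = rescale B≼A β Bβ in ∅ γ Aγ
  IndFree-≃ {suc N} {A} {B} (A≼B ,≃ B≼A) (step α Aα k nz dA rA e₁ e₂ f₁ f₂ sb) =
    step γ Bγ k nz′ (IndFree-≃ del≃ dA) (IndFree-≃ res≃ rA) e₁ e₂ (FreeWith-≃ e₁ del≃ f₁) (FreeWith-≃ e₂ res≃ f₂) sb
    where
    scaled = rescale A≼B α Aα
    t   = proj₁ scaled
    γ   = proj₁ (proj₂ scaled)
    t≉0 = proj₁ (proj₂ (proj₂ scaled))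
    Bγ  = proj₁ (proj₂ (proj₂ (proj₂ scaled)))
    α≈tγ = proj₂ (proj₂ (proj₂ (proj₂ scaled)))
    nz′ : ¬ γ k ≈ 0#
    nz′ z = nz (trans (α≈tγ k) (trans (*-congˡ z) (zeroʳ t)))
    γ≈t⁻¹α : ∀ i → γ i ≈ inv t t≉0 * α i
    γ≈t⁻¹α i = invert-scale t≉0 (α≈tγ i)
    del≃ : Del A α ≃ Del B γ
    del≃ = Del-≼ t≉0 α≈tγ A≼B ,≃ Del-≼ (inv-nonzero t≉0) γ≈t⁻¹α B≼A
    res≃ : Res A k α nz ≃ Res B k γ nz′
    res≃ = Res-≼ nz nz′ t≉0 α≈tγ A≼B ,≃ Res-≼ nz′ nz (inv-nonzero t≉0) γ≈t⁻¹α B≼A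

-- Arrangements of colliding points

module Configurations {c ℓ} (K : Field c ℓ) (char : CharZero K) where
  open Field K hiding (zero)
  open Arrangements K
  open Invariance K
  open Unions K
  open ℤSolver commutativeRing
  open Algebra.Properties.Ring ring using (-0#≈0#)
  open Algebra.Properties.Group +-group using () renaming (x∙y⁻¹≈ε⇒x≈y to x-y≈0⇒x≈y; x≈y⇒x∙y⁻¹≈ε to x≈y⇒x-y≈0; ∙-cancelˡ to +-cancelˡ)

  natK-+ : ∀ m n → natK (m ℕ.+ n) ≈ natK m + natK n
  natK-+ zero    n = sym (+-identityˡ _)
  natK-+ (suc m) n = trans (+-congˡ (natK-+ m n)) (sym (+-assoc _ _ _))

  natK-injective : ∀ m n → natK m ≈ natK n → m ≡ n
  natK-injective zero    zero    e = ≡.refl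
  natK-injective zero    (suc n) e = contradiction (sym e) (char n)
  natK-injective (suc m) zero    e = contradiction e (char m)
  natK-injective (suc m) (suc n) e = ≡.cong suc (natK-injective m n (+-cancelˡ 1# _ _ e))

  1≉0 : ¬ 1# ≈ 0#
  1≉0 = 0≉1 ∘ sym

  δ-≡ : ∀ {l} {t i : Fin l} → t ≡ i → δ t i ≈ 1#
  δ-≡ {t = t} {i} e rewrite dec-true (t Fin.≟ i) e = refl

  δ-≢ : ∀ {l} {t i : Fin l} → t ≢ i → δ t i ≈ 0#
  δ-≢ {t = t} {i} ne rewrite dec-false (t Fin.≟ i) ne = refl

  δ-punchIn : ∀ {l} (s : Fin (suc l)) t i → δ (punchIn s t) (punchIn s i) ≈ δ t i
  δ-punchIn s t i with t Fin.≟ i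
  ... | yes ≡.refl = δ-≡ {t = punchIn s t} ≡.refl
  ... | no t≢i     = δ-≢ (t≢i ∘ FinP.punchIn-injective s t i)

  infixl 6 _⊖_
  _⊖_ : ∀ {N} → Form N → Form N → Form N
  (α ⊖ β) k = α k - β k

  -- the affine point x_i + p_i + a, homogenised
  pt : ∀ {l} → (Fin l → Carrier) → Fin l → ℕ → Form (suc l)
  pt p i a zero    = p i + natK a
  pt p i a (suc t) = δ t i

  -- The hyperplanes on which two of the points x_i + p_i + a (0 ≤ a < w_i) with
  -- different i collide, and z = 0; w_i = 0 means that vertex i takes no part.
  -- The cone of A(n, ∅) is the case p = 0, w = n + 1.
  data Conf {l} (p : Fin l → Carrier) (w : Fin l → ℕ) : Arr (suc l) where
    isZ : ∀ {β} → β ≈F zForm → Conf p w β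
    isP : ∀ {β} i j a b → i ≢ j → a < w i → b < w j → β ≈F (pt p i a ⊖ pt p j b) → Conf p w β

  conf-cong : ∀ {l} {p p′ : Fin l → Carrier} {w w′} → (∀ i → p i ≈ p′ i) → (∀ i → w i ≡ w′ i) → Conf p w ≼ Conf p′ w′
  conf-cong {p = p} {p′} ep ew = ≼-by-≈ λ
    { β (isZ e) → β , isZ e , λ _ → refl
    ; β (isP i j a b i≢j a< b< e) → β , isP i j a b i≢j (≡.subst (a <_) (ew i) a<) (≡.subst (b <_) (ew j) b<)
        (λ k → trans (e k) (+-cong (pt-cong i a k) (-‿cong (pt-cong j b k)))) , λ _ → refl }
    where
    pt-cong : ∀ i a → pt p i a ≈F pt p′ i a
    pt-cong i a zero    = +-congʳ (ep i)
    pt-cong i a (suc t) = refl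

  conf-≃ : ∀ {l} {p p′ : Fin l → Carrier} {w w′} → (∀ i → p i ≈ p′ i) → (∀ i → w i ≡ w′ i) → Conf p w ≃ Conf p′ w′
  conf-≃ ep ew = conf-cong ep ew ,≃ conf-cong (sym ∘ ep) (≡.sym ∘ ew)

  -- Adding to x_s + p_s + [0, w_s) its right neighbour, one collision at a time.
  module Wall {l} (p : Fin (suc l) → Carrier) (w : Fin (suc l) → ℕ) (s : Fin (suc l)) where

    data View (i : Fin (suc l)) : Set where
      is-s  : i ≡ s → View i
      other : ∀ i′ → i ≡ punchIn s i′ → View i

    view : ∀ i → View i
    view i with s Fin.≟ i
    ... | yes s≡i = is-s (≡.sym s≡i)
    ... | no s≢i  = other (punchOut s≢i) (≡.sym (FinP.punchIn-punchOut s≢i))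

    wall : Fin l → Form (suc (suc l))
    wall j = pt p s (w s) ⊖ pt p (punchIn s j) 0

    wall-s : ∀ j → wall j (suc s) ≈ 1#
    wall-s j = trans (+-cong (δ-≡ {t = s} ≡.refl) (-‿cong (δ-≢ (FinP.punchInᵢ≢i s j ∘ ≡.sym)))) (trans (+-congˡ -0#≈0#) (+-identityʳ 1#))

    wall-s≉0 : ∀ j → ¬ wall j (suc s) ≈ 0#
    wall-s≉0 j e = 1≉0 (trans (sym (wall-s j)) e)

    Walls : List (Fin l) → Arr (suc (suc l))
    Walls []       = Conf p w
    Walls (j ∷ js) = Walls js ∪₁ wall j

    module Collapse (j : Fin l) where
      α = wall j

      -- On the wall x_s + p_s + w_s = x_j + p_j, hence x_s + p_s + a = x_j + (p_j - w_s) + a. The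
      -- points of s thus occupy the first w_s places of an interval starting at x_j + p_j - w_s,
      -- and those of j follow at once.
      p′ : Fin l → Carrier
      p′ i = if does (i Fin.≟ j) then p (punchIn s j) - natK (w s) else p (punchIn s i)

      shift : Fin l → ℕ → ℕ
      shift i a = if does (i Fin.≟ j) then w s ℕ.+ a else a

      w′ : Fin l → ℕ
      w′ i = shift i (w (punchIn s i))

      shift-j : ∀ a → shift j a ≡ w s ℕ.+ a
      shift-j a rewrite dec-true (j Fin.≟ j) ≡.refl = ≡.refl

      shift-≢ : ∀ {i} → i ≢ j → ∀ a → shift i a ≡ a
      shift-≢ {i} i≢j a rewrite dec-false (i Fin.≟ j) i≢j = ≡.refl

      p′-j : p′ j ≡ p (punchIn s j) - natK (w s)
      p′-j rewrite dec-true (j Fin.≟ j) ≡.refl = ≡.refl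

      shift-< : ∀ i {a} → a < w (punchIn s i) → shift i a < w′ i
      shift-< i a< with i Fin.≟ j
      ... | yes _ = ℕP.+-monoʳ-< (w s) a<
      ... | no  _ = a<

      restrict : Form (suc (suc l)) → Form (suc l)
      restrict β = restrictF (suc s) α (wall-s≉0 j) β

      restrict≈ : ∀ β t → restrict β t ≈ β (punchIn (suc s) t) - β (suc s) * α (punchIn (suc s) t)
      restrict≈ β t = +-congˡ (-‿cong (*-congˡ (trans (*-congˡ (inv-unique _ (trans (*-identityʳ _) (wall-s j)))) (*-identityʳ _))))

      restrict-⊖ : ∀ β γ → restrict (β ⊖ γ) ≈F (restrict β ⊖ restrict γ)
      restrict-⊖ β γ t = solve 5 (λ b g b₀ g₀ x → (b :- g) :- (b₀ :- g₀) :* x := (b :- b₀ :* x) :- (g :- g₀ :* x)) refl _ _ _ _ _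

      restrict-cong : ∀ {β γ} → β ≈F γ → restrict β ≈F restrict γ
      restrict-cong = restrictF-cong (suc s) α (wall-s≉0 j)

      restrict-other : ∀ i a → restrict (pt p (punchIn s i) a) ≈F pt p′ i (shift i a)
      restrict-other i a t = trans (restrict≈ (pt p (punchIn s i) a) t) (trans (+-congˡ (trans (-‿cong (trans (*-congʳ (δ-≢ (FinP.punchInᵢ≢i s i ∘ ≡.sym))) (zeroˡ _))) -0#≈0#))
        (trans (+-identityʳ _) (go t)))
        where
        go : ∀ t → pt p (punchIn s i) a (punchIn (suc s) t) ≈ pt p′ i (shift i a) t
        go (suc t) = δ-punchIn s t i
        go zero with i Fin.≟ j
        ... | yes ≡.refl = trans (solve 3 (λ p w a → p :+ a := p :- w :+ (w :+ a)) refl (p (punchIn s i)) (natK (w s)) (natK a)) (+-congˡ (sym (natK-+ (w s) a)))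
        ... | no  _      = refl

      restrict-s : ∀ a → restrict (pt p s a) ≈F pt p′ j a
      restrict-s a t = trans (restrict≈ (pt p s a) t) (trans (+-congˡ (-‿cong (trans (*-congʳ (δ-≡ {t = s} ≡.refl)) (*-identityˡ _)))) (go t))
        where
        go : ∀ t → pt p s a (punchIn (suc s) t) - α (punchIn (suc s) t) ≈ pt p′ j a t
        go zero    = trans (solve 4 (λ p a w q → p :+ a :- (p :+ w :- (q :+ con (+ 0))) := q :- w :+ a) refl (p s) (natK a) (natK (w s)) (p (punchIn s j)))
                       (+-congʳ (sym (reflexive p′-j)))
        go (suc t) = trans (+-cong (δ-≢ (FinP.punchInᵢ≢i s t)) (-‿cong (+-cong (δ-≢ (FinP.punchInᵢ≢i s t)) (-‿cong (δ-punchIn s t j)))))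
                       (solve 1 (λ d → con (+ 0) :- (con (+ 0) :- d) := d) refl (δ t j))

      proportional⇒restrict≈0 : ∀ {β} → Proportional β α → ∀ t → restrict β t ≈ 0#
      proportional⇒restrict≈0 {β} (r , e) t = trans (restrict≈ β t) (trans
        (+-cong (e _) (-‿cong (*-congʳ (trans (e (suc s)) (trans (*-congˡ (wall-s j)) (*-identityʳ r)))))) (-‿inverseʳ _))

      restrict≈0⇒proportional : ∀ {β} → (∀ t → restrict β t ≈ 0#) → Proportional β α
      restrict≈0⇒proportional {β} e = β (suc s) , go
        where
        at : ∀ t → β (punchIn (suc s) t) ≈ β (suc s) * α (punchIn (suc s) t)
        at t = x-y≈0⇒x≈y _ _ (trans (sym (restrict≈ β t)) (e t))
        go : ∀ k → β k ≈ β (suc s) * α k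
        go zero    = at zero
        go (suc i) with view i
        ... | is-s ≡.refl      = sym (trans (*-congˡ (wall-s j)) (*-identityʳ _))
        ... | other t ≡.refl   = at (suc t)

      -- the vertex that i is identified with on the wall
      data Over : Fin (suc l) → Fin l → Set where
        over-s     : Over s j
        over-other : ∀ i → Over (punchIn s i) i

      over-unique : ∀ {i i′ k′} → Over i i′ → Over i k′ → i′ ≡ k′
      over-unique o o′ = go o o′ ≡.refl
        where
        go : ∀ {i k i′ k′} → Over i i′ → Over k k′ → i ≡ k → i′ ≡ k′
        go over-s         over-s          e = ≡.refl
        go over-s         (over-other i)  e = contradiction (≡.sym e) (FinP.punchInᵢ≢i s i)
        go (over-other i) over-s          e = contradiction e (FinP.punchInᵢ≢i s i)
        go (over-other i) (over-other i′) e = FinP.punchIn-injective s i i′ e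

      record Image (i : Fin (suc l)) (a : ℕ) : Set (c ⊔ ℓ) where
        constructor image
        field
          {vertex} : Fin l
          {index}  : ℕ
          over     : Over i vertex
          bound    : index < w′ vertex
          maps     : restrict (pt p i a) ≈F pt p′ vertex index

      -- The bound includes `a = w s`, the new point, which occurs in the walls already added. Its
      -- image is the first point of j, so j must have one.
      image-s : 0 < w (punchIn s j) → ∀ {a} → a ≤ w s → Image s a
      image-s w>0 {a} a≤ = image over-s
        (≡.subst (a <_) (≡.sym (shift-j _)) (ℕP.≤-<-trans a≤ (ℕP.m<m+n (w s) w>0))) (restrict-s a)

      image-other : ∀ i {a} → a < w (punchIn s i) → Image (punchIn s i) a
      image-other i {a} a< = image (over-other i) (shift-< i a<) (restrict-other i a)

      image-conf : 0 < w (punchIn s j) → ∀ i {a} → a < w i → Image i a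
      image-conf w>0 i a< with view i
      ... | is-s ≡.refl    = image-s w>0 (ℕP.<⇒≤ a<)
      ... | other i′ ≡.refl = image-other i′ a<

      difference-at : ∀ {i′ k′ : Fin l} {a b} → i′ ≢ k′ → ¬ ((pt p′ i′ a ⊖ pt p′ k′ b) (suc i′) ≈ 0#)
      difference-at {i′} {k′} i≢k e = 1≉0 (trans (sym (trans (+-cong (δ-≡ {t = i′} ≡.refl) (trans (-‿cong (δ-≢ i≢k)) -0#≈0#)) (+-identityʳ 1#))) e)

      same-vertex : ∀ {i′ : Fin l} a b → (pt p′ i′ a ⊖ pt p′ i′ b) ≈F (λ k → (natK a - natK b) * zForm k)
      same-vertex {i′} a b zero    = solve 3 (λ p a b → p :+ a :- (p :+ b) := (a :- b) :* :1) refl (p′ i′) (natK a) (natK b)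
      same-vertex {i′} a b (suc t) = solve 3 (λ d a b → d :- d := (a :- b) :* con (+ 0)) refl (δ t i′) (natK a) (natK b)

      restrict-z : restrict zForm ≈F zForm
      restrict-z t = trans (restrict≈ zForm t) (trans (+-cong (go t) (trans (-‿cong (zeroˡ _)) -0#≈0#)) (+-identityʳ _))
        where
        go : ∀ t → zForm (punchIn (suc s) t) ≈ zForm t
        go zero    = refl
        go (suc t) = refl

      restrict-difference : ∀ {β i k a b} → β ≈F (pt p i a ⊖ pt p k b) → (x : Image i a) (x′ : Image k b) →
                            restrict β ≈F (pt p′ (Image.vertex x) (Image.index x) ⊖ pt p′ (Image.vertex x′) (Image.index x′))
      restrict-difference {i = i} {k} {a} {b} e x x′ t = trans (restrict-cong e t) (trans (restrict-⊖ (pt p i a) (pt p k b) t) (+-cong (Image.maps x t) (-‿cong (Image.maps x′ t))))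

      -- If both points land on the same vertex, their collision becomes a multiple of z = 0. The
      -- factor is nonzero, since otherwise the restriction would vanish and `β` would be
      -- proportional to the wall, which the restriction leaves out.
      restrict-in : ∀ {β i k a b} → β ≈F (pt p i a ⊖ pt p k b) → Image i a → Image k b → ¬ Proportional β α →
                    ∃ λ t → ∃ λ γ → ¬ t ≈ 0# × Conf p′ w′ γ × (∀ k → restrict β k ≈ t * γ k)
      restrict-in e x x′ np with Image.vertex x Fin.≟ Image.vertex x′
      ... | no ne = 1# , _ , 1≉0 , isP _ _ _ _ ne (Image.bound x) (Image.bound x′) (λ _ → refl) ,
                    λ k → trans (restrict-difference e x x′ k) (sym (*-identityˡ _))
      restrict-in e x@(image {i′} {a} _ _ _) x′@(image {_} {b} _ _ _) np | yes ≡.refl =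
        natK a - natK b , zForm , nz , isZ (λ _ → refl) , λ k → trans (restrict-difference e x x′ k) (same-vertex a b k)
        where
        nz : ¬ natK a - natK b ≈ 0#
        nz z = np (restrict≈0⇒proportional (λ t → trans (restrict-difference e x x′ t) (trans (same-vertex a b t) (trans (*-congʳ z) (zeroˡ _)))))

      record Preimage (i′ : Fin l) (a′ : ℕ) : Set (c ⊔ ℓ) where
        constructor preimage
        field
          {vertex} : Fin (suc l)
          {index}  : ℕ
          over     : Over vertex i′
          bound    : index < w vertex
          maps     : restrict (pt p vertex index) ≈F pt p′ i′ a′

      -- On the glued interval, places below `w s` come from s and the remaining ones from j.
      lift-point : ∀ i′ {a′} → a′ < w′ i′ → Preimage i′ a′
      lift-point i′ {a′} a′< = go (i′ Fin.≟ j) (a′ ℕ.<? w s)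
        where
        go : Dec (i′ ≡ j) → Dec (a′ < w s) → Preimage i′ a′
        go (no i′≢j)    _          = preimage (over-other i′) (≡.subst (a′ <_) (shift-≢ i′≢j _) a′<)
          (λ t → trans (restrict-other i′ a′ t) (reflexive (≡.cong (λ a → pt p′ i′ a t) (shift-≢ i′≢j a′))))
        go (yes ≡.refl) (yes a′<ws) = preimage over-s a′<ws (restrict-s a′)
        go (yes ≡.refl) (no  a′≮ws) = preimage {index = a′ ℕ.∸ w s} (over-other i′)
          (ℕP.+-cancelˡ-< (w s) _ _ (≡.subst₂ _<_ (≡.sym a′≡) (shift-j _) a′<))
          (λ t → trans (restrict-other i′ (a′ ℕ.∸ w s) t) (reflexive (≡.cong (λ a → pt p′ i′ a t) (≡.trans (shift-j _) a′≡))))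
          where
          a′≡ : w s ℕ.+ (a′ ℕ.∸ w s) ≡ a′
          a′≡ = ℕP.m+[n∸m]≡n (ℕP.≮⇒≥ a′≮ws)

      walls-conf : ∀ js {β} → Conf p w β → Walls js β
      walls-conf []       d = d
      walls-conf (_ ∷ js) d = old (walls-conf js d)

      -- The walls of `js` contribute nothing new: on the wall of j the new point coincides with the
      -- first point of j, so they restrict to collisions already present. The restriction is
      -- therefore the same at whatever stage the wall is added.
      Res-wall : ∀ js → 0 < w (punchIn s j) → All (λ i → 0 < w (punchIn s i)) js →
                 Res (Walls (j ∷ js)) (suc s) α (wall-s≉0 j) ≃ Conf p′ w′
      Res-wall js w>0 ws>0 = ≼-by (λ η → λ { (β , (Aβ , np) , e) →
            let t , γ , t≉0 , Cγ , f = forward (j ∷ js) (w>0 ∷ ws>0) Aβ np in t , γ , t≉0 , Cγ , λ k → trans (e k) (f k) })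
        ,≃ ≼-by-≈ backward
        where
        forward : ∀ is → All (λ i → 0 < w (punchIn s i)) is → ∀ {β} → Walls is β → ¬ Proportional β α →
                  ∃ λ t → ∃ λ γ → ¬ t ≈ 0# × Conf p′ w′ γ × (∀ k → restrict β k ≈ t * γ k)
        forward []       _        (isZ e) np = 1# , zForm , 1≉0 , isZ (λ _ → refl) ,
          λ k → trans (restrict-cong e k) (trans (restrict-z k) (sym (*-identityˡ _)))
        forward []       _        (isP i k a b _ a< b< e) np = restrict-in e (image-conf w>0 i a<) (image-conf w>0 k b<) np
        forward (i ∷ is) (_ ∷ ps) (old d) np = forward is ps d np
        forward (i ∷ is) (q ∷ _)  (new e) np = restrict-in e (image-s w>0 ℕP.≤-refl) (image-other i q) np
        backward : ∀ β → Conf p′ w′ β → ∃ λ γ → Res (Walls (j ∷ js)) (suc s) α (wall-s≉0 j) γ × β ≈F γ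
        backward β (isZ e) = _ , (zForm , (walls-conf (j ∷ js) (isZ (λ _ → refl)) ,
            λ pr → 1≉0 (trans (sym (restrict-z zero)) (proportional⇒restrict≈0 pr zero))) , λ _ → refl) ,
          λ k → trans (e k) (sym (restrict-z k))
        backward β (isP i′ k′ a′ b′ ne a′< b′< e) = go (lift-point i′ a′<) (lift-point k′ b′<)
          where
          go : Preimage i′ a′ → Preimage k′ b′ → ∃ λ γ → Res (Walls (j ∷ js)) (suc s) α (wall-s≉0 j) γ × β ≈F γ
          go (preimage {i} {a} o a< m) (preimage {k} {b} o′ b< m′) =
            restrict γ , (γ , (walls-conf (j ∷ js) (isP i k a b (λ { ≡.refl → ne (over-unique o o′) }) a< b< (λ _ → refl)) ,
                 λ pr → difference-at {a = a′} {b′} ne (trans (sym (restricted (suc i′))) (proportional⇒restrict≈0 pr (suc i′)))) , λ _ → refl) ,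
            λ t → trans (e t) (sym (restricted t))
            where
            γ = pt p i a ⊖ pt p k b
            restricted : restrict γ ≈F (pt p′ i′ a′ ⊖ pt p′ k′ b′)
            restricted t = trans (restrict-⊖ (pt p i a) (pt p k b) t) (+-cong (m t) (-‿cong (m′ t)))

      -- A form proportional to the wall restricts to zero, and a collision restricts to zero only
      -- when its two points have the same image. Within one vertex, different indices give
      -- different scalars by characteristic zero.
      not-proportional-images : ∀ {β i k a b} → β ≈F (pt p i a ⊖ pt p k b) → (x : Image i a) (x′ : Image k b) →
        (Image.vertex x ≡ Image.vertex x′ → Image.index x ≡ Image.index x′ → ⊥) → ¬ Proportional β α
      not-proportional-images e x x′ ne pr with Image.vertex x Fin.≟ Image.vertex x′
      ... | no v≢ = difference-at {a = Image.index x} {Image.index x′} v≢ (trans (sym (restrict-difference e x x′ (suc (Image.vertex x)))) (proportional⇒restrict≈0 pr (suc (Image.vertex x))))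
      not-proportional-images e x@(image {i′} {a} _ _ _) x′@(image {_} {b} _ _ _) ne pr | yes ≡.refl =
        ne ≡.refl (natK-injective a b (x-y≈0⇒x≈y _ _ (trans (sym (*-identityʳ _))
          (trans (sym (same-vertex a b zero)) (trans (sym (restrict-difference e x x′ zero)) (proportional⇒restrict≈0 pr zero))))))

      -- This ensures that deleting the wall from the enlarged arrangement gives back exactly the
      -- previous one. For a collision of s with j the images differ because points of s lie
      -- strictly before place `w s`.
      walls-not-proportional : ∀ js → j ∉ js → 0 < w (punchIn s j) → All (λ i → 0 < w (punchIn s i)) js →
                               ∀ β → Walls js β → ¬ Proportional β α
      walls-not-proportional [] _ w>0 _ β (isZ e) pr =
        1≉0 (trans (sym (restrict-z zero)) (trans (sym (restrict-cong e zero)) (proportional⇒restrict≈0 pr zero)))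
      walls-not-proportional (i ∷ is) j∉ w>0 (_ ∷ ps) β (old d) = walls-not-proportional is (j∉ ∘ there) w>0 ps β d
      walls-not-proportional (i ∷ is) j∉ w>0 (q ∷ _) β (new e) =
        not-proportional-images e (image-s w>0 ℕP.≤-refl) (image-other i q) (λ v _ → j∉ (here v))
      walls-not-proportional [] _ w>0 _ β (isP i k a b i≢k a< b< e) with view i | view k
      ... | is-s ≡.refl    | is-s ≡.refl    = λ _ → i≢k ≡.refl
      ... | is-s ≡.refl    | other k′ ≡.refl = not-proportional-images e (image-s w>0 (ℕP.<⇒≤ a<)) (image-other k′ b<)
            (λ { ≡.refl x → ℕP.<⇒≱ a< (ℕP.≤-trans (ℕP.m≤m+n (w s) b) (ℕP.≤-reflexive (≡.trans (≡.sym (shift-j b)) (≡.sym x)))) })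
      ... | other i′ ≡.refl | is-s ≡.refl   = not-proportional-images e (image-other i′ a<) (image-s w>0 (ℕP.<⇒≤ b<))
            (λ { ≡.refl x → ℕP.<⇒≱ b< (ℕP.≤-trans (ℕP.m≤m+n (w s) a) (ℕP.≤-reflexive (≡.trans (≡.sym (shift-j a)) x))) })
      ... | other i′ ≡.refl | other k′ ≡.refl = not-proportional-images e (image-other i′ a<) (image-other k′ b<)
            (λ v _ → i≢k (≡.cong (punchIn s) v))

      Del-wall : ∀ js → j ∉ js → 0 < w (punchIn s j) → All (λ i → 0 < w (punchIn s i)) js →
                 Del (Walls (j ∷ js)) α ≃ Walls js
      Del-wall js j∉ w>0 ws>0 =
        ≼-by-≈ (λ β → λ { (old d , _) → β , d , λ _ → refl
                        ; (new e , np) → contradiction (1# , λ k → trans (e k) (sym (*-identityˡ _))) np })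
        ,≃ ≼-by-≈ (λ β d → β , (old d , walls-not-proportional js j∉ w>0 ws>0 β d) , λ _ → refl)

module FreeBases {c ℓ} (K : Field c ℓ) where
  open Arrangements K using (FreeWith)

  HomogDer : ∀ {N} (PL : PolyLike K N) → ℕ → LinearAlgebra.Der PL → Set ℓ
  HomogDer PL d θ = ∀ k → PolyLike.Homog PL d (θ k)

  -- Bases are built over an arbitrary family of `PolyLike` structures and reach `FreeWith` only
  -- through this hypothesis, which is discharged for lists of terms.
  BasisToFree : (∀ N → PolyLike K N) → Set _
  BasisToFree PL = ∀ {N m A} {xs : Vec (LinearAlgebra.Der (PL N)) m} (es : Vec ℕ m) →
    VPW.Pointwise (HomogDer (PL N)) es xs → LinearAlgebra.Basis (PL N) A xs → FreeWith A es

  freeWith : BasisToFree (Instance.polyLike K)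
  freeWith {N} {xs = xs} es h b = lookup xs , VPW.lookup h , members b
    , (λ θ d → Span.coordinates (spans b θ d) , Span.expansion (spans b θ d)) , independent b
    where open LinearAlgebra (Instance.polyLike K N) using (module Span; members; spans; independent)

-- Adding the walls one at a time

module Extension {c ℓ} (K : Field c ℓ) (char : CharZero K) {l} (p : Fin (suc l) → Field.Carrier K) (w : Fin (suc l) → ℕ) (s : Fin (suc l)) where
  private module K = Field K
  open Arrangements K hiding (InD; Der; applyD; _≈D_; combo)
  open Invariance K
  open Unions K
  open FreeBases K
  open Configurations K char
  open Wall p w s public

  module _ (w⁺ : Fin (suc l) → ℕ) (w⁺-s : w⁺ s ≡ suc (w s)) (w⁺-other : ∀ j → w⁺ (punchIn s j) ≡ w (punchIn s j))
    (narrow : 0 < w s ⊎ (∀ j → w (punchIn s j) ≤ 1))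
    (js : List (Fin l)) (js-active : All (λ j → 0 < w (punchIn s j)) js) (js-complete : ∀ j → 0 < w (punchIn s j) → j ∈ js)
    where

    w≤w⁺ : ∀ i → w i ≤ w⁺ i
    w≤w⁺ i with view i
    ... | is-s ≡.refl    = ≡.subst (w i ≤_) (≡.sym w⁺-s) (ℕP.n≤1+n _)
    ... | other j ≡.refl = ℕP.≤-reflexive (≡.sym (w⁺-other j))

    private
      Rescaled : Form (suc (suc l)) → Set _
      Rescaled β = ∃ λ t → ∃ λ γ → ¬ t K.≈ K.0# × Walls js γ × (∀ k → β k K.≈ t K.* γ k)

      rescaled : ∀ {β γ} → Walls js γ → β ≈F γ → Rescaled β
      rescaled d e = K.1# , _ , 1≉0 , d , λ k → K.trans (e k) (K.sym (K.*-identityˡ _))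

      in-conf : ∀ is {β} → Conf p w β → Walls is β
      in-conf []       d = d
      in-conf (_ ∷ is) d = old (in-conf is d)

      in-walls : ∀ {is j} → j ∈ is → Walls is (wall j)
      in-walls (here ≡.refl) = new (λ _ → K.refl)
      in-walls (there j∈)    = old (in-walls j∈)

      pt-suc : ∀ i a k b → (pt p i (suc a) ⊖ pt p k (suc b)) ≈F (pt p i a ⊖ pt p k b)
      pt-suc i a k b zero    = KS.solve 5 (λ p q a b u → (p KS.:+ (u KS.:+ a)) KS.:- (q KS.:+ (u KS.:+ b)) KS.:= p KS.:+ a KS.:- (q KS.:+ b)) K.refl (p i) (p k) (natK a) (natK b) K.1#
        where module KS = ℤSolver K.commutativeRing
      pt-suc i a k b (suc t) = K.refl

      -- A collision of the new point with place b + 1 of j is the old collision one place to the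
      -- left on both intervals. The left neighbour on s exists if `0 < w s`; the other alternative
      -- of `narrow` leaves no place b + 1 to meet.
      collision : ∀ j a b → a < suc (w s) → b < w (punchIn s j) → ∀ {β} → β ≈F (pt p s a ⊖ pt p (punchIn s j) b) → Rescaled β
      collision j a b (s≤s a≤) b< e with ℕP.m≤n⇒m<n∨m≡n a≤
      ... | inj₁ a< = rescaled (in-conf js (isP s (punchIn s j) a b (FinP.punchInᵢ≢i s j ∘ ≡.sym) a< b< (λ _ → K.refl))) e
      collision j a zero (s≤s a≤) b< e | inj₂ eq = rescaled (in-walls (js-complete j b<))
        (λ k → K.trans (e k) (K.reflexive (≡.cong (λ a → (pt p s a ⊖ pt p (punchIn s j) 0) k) eq)))
      collision j zero (suc b) (s≤s a≤) b< e | inj₂ eq =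
        ⊥-elim ([ (λ 0<w → ℕP.<⇒≢ 0<w eq) , (λ w≤1 → ℕP.<⇒≱ b< (ℕP.≤-trans (w≤1 j) (s≤s z≤n))) ]′ narrow)
      collision j (suc a) (suc b) (s≤s a≤) b< e | inj₂ eq =
        rescaled (in-conf js (isP s (punchIn s j) a b (FinP.punchInᵢ≢i s j ∘ ≡.sym) a≤ (ℕP.<⇒≤ b<) (λ _ → K.refl)))
          (λ k → K.trans (e k) (pt-suc s a (punchIn s j) b k))

      flip-sign : ∀ {β γ} → (∀ k → β k K.≈ K.- γ k) → Rescaled γ → Rescaled β
      flip-sign e (t , η , t≉0 , d , f) = K.- t , η , (λ z → t≉0 (K.trans (K.sym (-‿involutive t)) (K.trans (K.-‿cong z) -0#≈0#))) , d ,
        λ k → K.trans (e k) (K.trans (K.-‿cong (f k)) (-‿distribˡ-* t (η k)))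
        where open Algebra.Properties.Ring K.ring using (-‿involutive; -0#≈0#; -‿distribˡ-*)

    walls-complete : Walls js ≃ Conf p w⁺
    walls-complete = ≼-by-≈ (λ β d → β , shrink js js-active d , λ _ → K.refl) ,≃ ≼-by grow
      where
      shrink : ∀ is → All (λ j → 0 < w (punchIn s j)) is → ∀ {β} → Walls is β → Conf p w⁺ β
      shrink []       _        (isZ e) = isZ e
      shrink []       _        (isP i k a b i≢k a< b< e) = isP i k a b i≢k (ℕP.<-≤-trans a< (w≤w⁺ i)) (ℕP.<-≤-trans b< (w≤w⁺ k)) e
      shrink (j ∷ is) (_ ∷ qs) (old d) = shrink is qs d
      shrink (j ∷ is) (q ∷ _)  (new e) = isP s (punchIn s j) (w s) 0 (FinP.punchInᵢ≢i s j ∘ ≡.sym)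
        (≡.subst (w s <_) (≡.sym w⁺-s) ℕP.≤-refl) (ℕP.<-≤-trans q (w≤w⁺ _)) e
      grow : ∀ β → Conf p w⁺ β → Rescaled β
      grow β (isZ e) = rescaled (in-conf js (isZ e)) (λ _ → K.refl)
      grow β (isP i k a b i≢k a< b< e) with view i | view k
      ... | is-s ≡.refl | is-s ≡.refl = contradiction ≡.refl i≢k
      ... | is-s ≡.refl | other j ≡.refl = collision j a b (≡.subst (a <_) w⁺-s a<) (≡.subst (b <_) (w⁺-other j) b<) e
      ... | other j ≡.refl | is-s ≡.refl = flip-sign {γ = pt p s b ⊖ pt p (punchIn s j) a}
            (λ t → K.trans (e t) (KS.solve 2 (λ x y → x KS.:- y KS.:= KS.:- (y KS.:- x)) K.refl (pt p (punchIn s j) a t) (pt p s b t)))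
            (collision j b a (≡.subst (b <_) w⁺-s b<) (≡.subst (a <_) (w⁺-other j) a<) (λ _ → K.refl))
        where module KS = ℤSolver K.commutativeRing
      ... | other i′ ≡.refl | other k′ ≡.refl = rescaled (in-conf js
            (isP (punchIn s i′) (punchIn s k′) a b i≢k (≡.subst (a <_) (w⁺-other i′) a<) (≡.subst (b <_) (w⁺-other k′) b<) e)) (λ _ → K.refl)

  module WallBasis (PL : PolyLike K (suc (suc l))) where
    open PolyLike PL
    open LinearAlgebra PL

    -- Eliminating x_s by means of wall j turns wall i into a form in which x_j has coefficient 1,
    -- hence into a nonzero one.
    wall-cancels-wall : ∀ i j → i ≢ j → Cancels (wall j) (lin (wall i))
    wall-cancels-wall i j i≢j = lin-prime (wall j) (suc s) (wall-s j) (wall i) (suc (punchIn s j))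
      (λ e → 1≉0 (K.trans (K.sym eq) e))
      where
      module KS = ℤSolver K.commutativeRing
      eq : wall i (suc (punchIn s j)) K.- wall i (suc s) K.* wall j (suc (punchIn s j)) K.≈ K.1#
      eq = K.trans (K.+-cong (K.+-cong (δ-≢ (FinP.punchInᵢ≢i s j)) (K.-‿cong (δ-≢ (i≢j ∘ ≡.sym ∘ FinP.punchIn-injective s j i))))
             (K.-‿cong (K.*-cong (wall-s i) (K.+-cong (δ-≢ (FinP.punchInᵢ≢i s j)) (K.-‿cong (δ-≡ {t = punchIn s j} ≡.refl))))))
             (KS.solve 0 ((KS.con (+ 0) KS.:- KS.con (+ 0)) KS.:- KS.:1 KS.:* (KS.con (+ 0) KS.:- KS.:1) KS.:= KS.:1) K.refl)

    Θ : Der → List (Fin l) → Der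
    Θ θ []       = θ
    Θ θ (j ∷ js) = λ k → lin (wall j) * Θ θ js k

    ∏wall : List (Fin l) → Carrier
    ∏wall []       = 1#
    ∏wall (j ∷ js) = lin (wall j) * ∏wall js

    Θ≈∏wall : ∀ θ js k → Θ θ js k ≈ ∏wall js * θ k
    Θ≈∏wall θ []       k = sym (*-identityˡ _)
    Θ≈∏wall θ (j ∷ js) k = trans (*-congˡ (Θ≈∏wall θ js k)) (sym (*-assoc _ _ _))

    Θ-homog : ∀ {θ d} → (∀ k → Homog d (θ k)) → ∀ js k → Homog (length js ℕ.+ d) (Θ θ js k)
    Θ-homog h []       k = h k
    Θ-homog h (j ∷ js) k = homog-* (homog-lin (wall j)) (Θ-homog h js k)

    module _ {m} {θ : Der} {θs : Vec Der m} (basis : Basis (Conf p w) (θ ∷ θs))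
      (θs-wall : ∀ j → 0 < w (punchIn s j) → ∀ i → lin (wall j) ∣ applyD (lookup θs i) (wall j))
      (θ-wall : ∀ j → 0 < w (punchIn s j) → Cancels (wall j) (applyD θ (wall j)))
      where

      cancels-Θ : ∀ j → 0 < w (punchIn s j) → ∀ js → j ∉ js → Cancels (wall j) (applyD (Θ θ js) (wall j))
      cancels-Θ j w>0 []       _  = θ-wall j w>0
      cancels-Θ j w>0 (i ∷ is) j∉ f d =
        cancels-* (wall-cancels-wall i j (λ { ≡.refl → j∉ (here ≡.refl) })) (cancels-Θ j w>0 is (j∉ ∘ there)) f
          (∣-respʳ (*-congʳ (applyD-* (lin (wall i)) (Θ θ is) (wall j))) d)

      basis-walls : ∀ js → Unique js → All (λ j → 0 < w (punchIn s j)) js → Basis (Walls js) (Θ θ js ∷ θs)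
      basis-walls []       _        _        = basis
      basis-walls (j ∷ js) (j≢ ∷ u) (q ∷ qs) =
        basis-∪₁ {s = suc s} (wall-s≉0 j) (basis-walls js u qs) (θs-wall j q) (cancels-Θ j q js (AllP.All¬⇒¬Any j≢))

  module WallFree (PL : ∀ N → PolyLike K N) (basisToFree : BasisToFree PL) where
    open LinearAlgebra (PL (suc (suc l)))
    open WallBasis (PL (suc (suc l)))
    open PolyLike (PL (suc (suc l))) using (lin; _∣_)

    module _
      {m} {θ : Der} {θs : Vec Der m} (basis : Basis (Conf p w) (θ ∷ θs))
      (θs-wall : ∀ j → 0 < w (punchIn s j) → ∀ i → lin (wall j) ∣ applyD (lookup θs i) (wall j))
      (θ-wall : ∀ j → 0 < w (punchIn s j) → Cancels (wall j) (applyD θ (wall j)))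
      {d} {ds : Vec ℕ m} (θ-homog : HomogDer (PL (suc (suc l))) d θ) (θs-homog : VPW.Pointwise (HomogDer (PL (suc (suc l)))) ds θs)
      (indFree : IndFree (suc (suc l)) (Conf p w))
      (collapsed : ∀ j → 0 < w (punchIn s j) → IndFree (suc l) (Conf (Collapse.p′ j) (Collapse.w′ j)) ×
         ∃ λ m → ∃ λ (e : Vec ℕ m) → FreeWith (Conf (Collapse.p′ j) (Collapse.w′ j)) e × toList e ≡ toList ds)
      where

      -- All the restrictions have the exponents `ds` of the untouched elements. The only further
      -- exponent of the deletion is the degree of `Θ θ js`, which grows by one with each wall.
      indFree-walls : ∀ js → Unique js → All (λ j → 0 < w (punchIn s j)) js → IndFree (suc (suc l)) (Walls js)
      indFree-walls []       _        _        = indFree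
      indFree-walls (j ∷ js) (j≢ ∷ u) (q ∷ qs) = add (collapsed j q)
        where
        open Collapse j
        j∉ = AllP.All¬⇒¬Any j≢
        del≃ = ≃-sym (Del-wall js j∉ q qs)
        res≃ = ≃-sym (Res-wall js q qs)
        add : (IndFree (suc l) (Conf p′ w′) × ∃ λ m → ∃ λ (e : Vec ℕ m) → FreeWith (Conf p′ w′) e × toList e ≡ toList ds) →
              IndFree (suc (suc l)) (Walls (j ∷ js))
        add (ind , _ , e , free , e≡ds) = step (wall j) (new (λ _ → K.refl)) (suc s) (wall-s≉0 j)
          (IndFree-≃ del≃ (indFree-walls js u qs)) (IndFree-≃ res≃ ind)
          (length js ℕ.+ d ∷ ds) e
          (FreeWith-≃ (length js ℕ.+ d ∷ ds) del≃ (basisToFree (length js ℕ.+ d ∷ ds) (Θ-homog {θ} θ-homog js ∷ θs-homog) (basis-walls basis θs-wall θ-wall js u qs)))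
          (FreeWith-≃ e res≃ free)
          (length js ℕ.+ d ∷ [] , ≡.subst (λ xs → length js ℕ.+ d ∷ toList ds ↭ xs ++ (length js ℕ.+ d ∷ [])) (≡.sym e≡ds)
            (↭P.∷↭∷ʳ (length js ℕ.+ d) (toList ds)))

-- The braid arrangement

up : ∀ {a} {A : Set a} → (ℕ → A) → ℕ → (m : ℕ) → ∀ {r} → Vec A r → Vec A (m ℕ.+ r)
up f k zero    rest = rest
up f k (suc m) rest = f k ∷ up f (suc k) m rest

zeros : ∀ m {r} → Vec ℕ r → Vec ℕ (m ℕ.+ r)
zeros zero    rest = rest
zeros (suc m) rest = 0 ∷ zeros m rest

module _ {a b ℓ} {A : Set a} {B : Set b} {R : A → B → Set ℓ} where

  down⁺ : ∀ {f g} → (∀ k → R (f k) (g k)) → ∀ m {r} {xs : Vec A r} {ys : Vec B r} → VPW.Pointwise R xs ys →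
          VPW.Pointwise R (down f m xs) (down g m ys)
  down⁺ h zero    p = p
  down⁺ h (suc m) p = h m ∷ down⁺ h m p

up-zeros⁺ : ∀ {b ℓ} {B : Set b} {R : ℕ → B → Set ℓ} {g} → (∀ k → R 0 (g k)) → ∀ k m {r} {xs : Vec ℕ r} {ys : Vec B r} →
            VPW.Pointwise R xs ys → VPW.Pointwise R (zeros m xs) (up g k m ys)
up-zeros⁺ h k zero    p = p
up-zeros⁺ h k (suc m) p = h k ∷ up-zeros⁺ h (suc k) m p

-- The widths while the braid arrangement is built up: vertices of index below `a` carry one point,
-- the others none.
act : ∀ {l} → ℕ → Fin l → ℕ
act a i = if does (toℕ i ℕ.<? a) then 1 else 0

act-< : ∀ {l a} {i : Fin l} → toℕ i < a → act a i ≡ 1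
act-< {a = a} {i} i<a rewrite dec-true (toℕ i ℕ.<? a) i<a = ≡.refl

act-≮ : ∀ {l a} {i : Fin l} → ¬ toℕ i < a → act a i ≡ 0
act-≮ {a = a} {i} i≮a rewrite dec-false (toℕ i ℕ.<? a) i≮a = ≡.refl

<-act : ∀ {l a b} {i : Fin l} → b < act a i → toℕ i < a × b ≡ 0
<-act {a = a} {b} {i} p = go (toℕ i ℕ.<? a) p
  where
  go : (d : Dec (toℕ i < a)) → b < (if does d then 1 else 0) → toℕ i < a × b ≡ 0
  go (yes q) (s≤s z≤n) = q , ≡.refl

toℕ-punchIn-< : ∀ {l} (s : Fin (suc l)) i → (toℕ (punchIn s i) < toℕ s → toℕ i < toℕ s) × (toℕ i < toℕ s → toℕ (punchIn s i) < toℕ s)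
toℕ-punchIn-< zero    i       = (λ ()) , (λ ())
toℕ-punchIn-< (suc s) zero    = (λ _ → s≤s z≤n) , (λ _ → s≤s z≤n)
toℕ-punchIn-< (suc s) (suc i) = (λ { (s≤s p) → s≤s (proj₁ (toℕ-punchIn-< s i) p) }) , (λ { (s≤s p) → s≤s (proj₂ (toℕ-punchIn-< s i) p) })

act-punchIn : ∀ {l} (s : Fin (suc l)) i → act (toℕ s) (punchIn s i) ≡ act (toℕ s) i
act-punchIn s i = go (toℕ i ℕ.<? toℕ s)
  where
  go : Dec (toℕ i < toℕ s) → act (toℕ s) (punchIn s i) ≡ act (toℕ s) i
  go (yes p) = ≡.trans (act-< {i = punchIn s i} (proj₂ (toℕ-punchIn-< s i) p)) (≡.sym (act-< {i = i} p))
  go (no np) = ≡.trans (act-≮ {i = punchIn s i} (np ∘ proj₁ (toℕ-punchIn-< s i))) (≡.sym (act-≮ {i = i} np))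

module Points {c ℓ} {K : Field c ℓ} (char : CharZero K) {l : ℕ} (PL : PolyLike K (suc l)) (p : Fin l → Field.Carrier K) where
  private module K = Field K
  open PolyLike PL
  open LinearAlgebra PL
  open Arrangements K using (zForm; natK)
  open Configurations K char
  open Derivations char PL public
  open ℤSolver R
  open Relation.Binary.Reasoning.Setoid setoid

  V : Fin l → Carrier
  V i = lin (pt p i 0)

  P : Fin l → ℕ → Carrier
  P i a = V i + nat a * z

  open AtPoints V public

  applyD-pt : ∀ θ i a → applyD θ (pt p i a) ≈ θ (suc i) + ι (p i K.+ natK a) * θ zero
  applyD-pt θ i a = trans (∑-suc _) (trans (+-comm _ _) (+-congʳ (trans
    (∑-single _ i (λ t t≢i → trans (*-congʳ (trans (ι-cong (δ-≢ t≢i)) ι-0)) (zeroˡ _)))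
    (trans (*-congʳ (trans (ι-cong (δ-≡ {t = i} ≡.refl)) ι-1)) (*-identityˡ _)))))

  applyD-⊖ : ∀ {θ} → θ zero ≈ 0# → ∀ i a k b → applyD θ (pt p i a ⊖ pt p k b) ≈ θ (suc i) - θ (suc k)
  applyD-⊖ {θ} θz i a k b = trans (applyD-sub θ (pt p i a) (pt p k b)) (+-cong (at i a) (-‿cong (at k b)))
    where
    at : ∀ i a → applyD θ (pt p i a) ≈ θ (suc i)
    at i a = trans (applyD-pt θ i a) (trans (+-congˡ (trans (*-congˡ θz) (zeroʳ _))) (+-identityʳ _))

  lin-pt : ∀ i a → lin (pt p i a) ≈ P i a
  lin-pt i a = begin
    lin (pt p i a)                                      ≈⟨ applyD-pt y i a ⟩
    y (suc i) + ι (p i K.+ natK a) * z                  ≈⟨ +-congˡ (*-congʳ (trans (ι-+ _ _) (+-congˡ (sym (nat≈ι a))))) ⟩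
    y (suc i) + (ι (p i) + nat a) * z                   ≈⟨ solve 4 (λ y q a z → y :+ (q :+ a) :* z := y :+ (q :+ con (+ 0)) :* z :+ a :* z) refl (y (suc i)) (ι (p i)) (nat a) z ⟩
    y (suc i) + (ι (p i) + 0#) * z + nat a * z          ≈⟨ +-congʳ (+-congˡ (*-congʳ (trans (ι-+ _ _) (+-congˡ ι-0)))) ⟨
    y (suc i) + ι (p i K.+ K.0#) * z + nat a * z        ≈⟨ +-congʳ (applyD-pt y i 0) ⟨
    V i + nat a * z                                     ∎

  P-0 : ∀ i → P i 0 ≈ V i
  P-0 i = solve 2 (λ v z → v :+ con (+ 0) :* z := v) refl (V i) z

  P-suc : ∀ i a → P i (suc a) ≈ P i a + z
  P-suc i a = solve 3 (λ v n z → v :+ (:1 :+ n) :* z := v :+ n :* z :+ z) refl (V i) (nat a) z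

  lin-⊖ : ∀ i a k b → lin (pt p i a ⊖ pt p k b) ≈ P i a - P k b
  lin-⊖ i a k b = trans (applyD-sub y (pt p i a) (pt p k b)) (+-cong (lin-pt i a) (-‿cong (lin-pt k b)))

  applyD-z : ∀ θ → applyD θ zForm ≈ θ zero
  applyD-z θ = trans (∑-single _ zero (λ { zero ne → contradiction ≡.refl ne ; (suc i) _ → trans (*-congʳ ι-0) (zeroˡ _) }))
    (trans (*-congʳ ι-1) (*-identityˡ _))

  inD : ∀ {w θ} → θ zero ≈ 0# → (∀ i a k b → i ≢ k → a < w i → b < w k → P i a - P k b ∣ θ (suc i) - θ (suc k)) →
        InD (Conf p w) θ
  inD {θ = θ} θz h α (isZ e) = ∣-respʳ (sym (trans (applyD-cong (λ _ → refl) e) (trans (applyD-z θ) θz))) (∣-0 _)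
  inD {θ = θ} θz h α (isP i k a b i≢k a< b< e) = ∣-resp
    (sym (trans (applyD-cong (λ _ → refl) e) (lin-⊖ i a k b)))
    (sym (trans (applyD-cong (λ _ → refl) e) (applyD-⊖ {θ} θz i a k b)))
    (h i a k b i≢k a< b<)

  lookup-down : ∀ {q} (Q : Der → Set q) {f} → (∀ k → Q (f k)) → ∀ m {r} {xs : Vec Der r} → (∀ i → Q (lookup xs i)) →
                ∀ i → Q (lookup (down f m xs) i)
  lookup-down Q h zero    g i       = g i
  lookup-down Q h (suc m) g zero    = h m
  lookup-down Q h (suc m) g (suc i) = lookup-down Q h m g i

  ⇄-down-out : ∀ (f : ℕ → Der) m x {r} {xs : Vec Der r} → down f m (x ∷ xs) ⇄ x ∷ down f m xs
  ⇄-down-out f zero    x = ⇄-refl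
  ⇄-down-out f (suc m) x {xs = xs} = ⇄-trans (⇄-cong (f m) (⇄-down-out f m x)) (⇄-swap (f m) x (down f m xs))

  ⇄-up-in : ∀ (f : ℕ → Der) k m x {r} {xs : Vec Der r} → x ∷ up f k m xs ⇄ up f k m (x ∷ xs)
  ⇄-up-in f k zero    x = ⇄-refl
  ⇄-up-in f k (suc m) x {xs = xs} = ⇄-trans (⇄-swap x (f k) (up f (suc k) m xs)) (⇄-cong (f k) (⇄-up-in f (suc k) m x))

  ∂ⁿ : ℕ → Der
  ∂ⁿ k zero    = 0#
  ∂ⁿ k (suc i) = if does (toℕ i ℕ.≟ k) then 1# else 0#

  ∂ⁿ-≡ : ∀ {k i} → toℕ i ≡ k → ∂ⁿ k (suc i) ≈ 1#
  ∂ⁿ-≡ {k} {i} e rewrite dec-true (toℕ i ℕ.≟ k) e = refl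

  ∂ⁿ-≢ : ∀ {k i} → toℕ i ≢ k → ∂ⁿ k (suc i) ≈ 0#
  ∂ⁿ-≢ {k} {i} ne rewrite dec-false (toℕ i ℕ.≟ k) ne = refl

  span-up : ∀ a b {r} {rest : Vec Der r} → a ℕ.+ b ≡ l → ∀ {θ} → θ zero ≈ 0# → (∀ i → toℕ i < a → θ (suc i) ≈ 0#) →
            Span (up ∂ⁿ a b rest) θ
  span-up a zero    a+b≡l θz h = span-0 _ λ { zero → θz ; (suc i) → h i (≡.subst (toℕ i <_) (≡.trans (≡.sym a+b≡l) (ℕP.+-identityʳ a)) (FinP.toℕ<n i)) }
  span-up a (suc b) a+b≡l {θ} θz h = span-cong
    (λ k → solve 2 (λ x t → x :- t :+ t := x) refl (θ k) (θ (suc s) * ∂ⁿ a k))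
    (span-+ (span-there (span-up (suc a) b (≡.trans (≡.sym (ℕP.+-suc a b)) a+b≡l) φz φ≈0)) (span-* (θ (suc s)) span-here))
    where
    a<l = ≡.subst (a <_) a+b≡l (ℕP.m<m+n a (s≤s z≤n))
    s = fromℕ< a<l
    φ : Der
    φ k = θ k - θ (suc s) * ∂ⁿ a k
    φz : φ zero ≈ 0#
    φz = trans (+-congʳ θz) (solve 1 (λ t → con (+ 0) :- t :* con (+ 0) := con (+ 0)) refl _)
    φ≈0 : ∀ i → toℕ i < suc a → φ (suc i) ≈ 0#
    φ≈0 i (s≤s i≤a) = [ (λ i<a → trans (+-cong (h i i<a) (-‿cong (trans (*-congˡ (∂ⁿ-≢ {a} {i} (ℕP.<⇒≢ i<a))) (zeroʳ _)))) (-‿inverseʳ 0#))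
      , (λ i≡a → trans (+-cong (reflexive (≡.cong (θ ∘ suc) (FinP.toℕ-injective (≡.trans i≡a (≡.sym (FinP.toℕ-fromℕ< a<l))))))
            (-‿cong (trans (*-congˡ (∂ⁿ-≡ {a} {i} i≡a)) (*-identityʳ _)))) (-‿inverseʳ _))
      ]′ (ℕP.m≤n⇒m<n∨m≡n i≤a)

  fallD : ℕ → Der
  fallD k = der (fall k)

  -- Falling powers for the `a` active vertices, as in the Vandermonde basis of the braid
  -- arrangement; partial derivatives for the `b` idle ones, on which no form but z depends; and the
  -- Euler derivation.
  braidBasis : ∀ a b → Vec Der (a ℕ.+ (b ℕ.+ 1))
  braidBasis a b = down fallD a (up ∂ⁿ a b (y ∷ []))

  module _ {r} (rest : Vec Der r) where
    open LeadingTerms fallD rest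

    lead-E : ∀ rs k {m} → k ℕ.+ length rs ≡ m → Lead m 1# (der (E rs k))
    lead-E []       k {m} e rewrite ≡.trans (≡.sym (ℕP.+-identityʳ k)) e = lead-self m
    lead-E (b ∷ rs) k {m} e = lead-cong (+-identityʳ 1#)
      (λ { zero → solve 2 (λ n b → con (+ 0) :+ (n :- b) :* con (+ 0) := con (+ 0)) refl (nat k * z) b ; (suc i) → refl })
      (lead-+ (lead-E rs (suc k) e′) (lead-span (span-* (nat k * z - b) (tail e′))))
      where
      e′ = ≡.trans (≡.sym (ℕP.+-suc k (length rs))) e
      tail : ∀ {m} → suc (k ℕ.+ length rs) ≡ m → Span (down fallD m rest) (der (E rs k))
      tail ≡.refl = span-lead (lead-E rs k ≡.refl)

module BraidStep {c ℓ} {K : Field c ℓ} (char : CharZero K) {l : ℕ} (PL : PolyLike K (suc (suc l)))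
  (p : Fin (suc l) → Field.Carrier K) (s : Fin (suc l)) {a b : ℕ} (toℕ-s : toℕ s ≡ a) (a+b≡l : a ℕ.+ b ≡ l) where
  open PolyLike PL
  open LinearAlgebra PL
  open Invariance K
  open Configurations K char
  open Extension K char p (act a) s
  open WallBasis PL
  open Points char PL p
  open ℤSolver R

  s-idle : act a s ≡ 0
  s-idle = act-≮ {a = a} { s} (λ lt → ℕP.<⇒≢ lt toℕ-s)

  lin-wall : ∀ j → lin (wall j) ≈ V s - V (punchIn s j)
  lin-wall j = trans (lin-⊖ s (act a s) (punchIn s j) 0)
    (+-cong (trans (reflexive (≡.cong (P s) s-idle)) (P-0 s)) (-‿cong (P-0 _)))

  active⇒< : ∀ {j} → 0 < act a (punchIn s j) → toℕ (punchIn s j) < a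
  active⇒< {j} q = proj₁ (<-act {i = punchIn s j} q)

  θs : Vec Der (a ℕ.+ (b ℕ.+ 1))
  θs = down fallD a (up ∂ⁿ (suc a) b (y ∷ []))

  applyD-wall : ∀ {θ} → θ zero ≈ 0# → ∀ j → applyD θ (wall j) ≈ θ (suc s) - θ (suc (punchIn s j))
  applyD-wall {θ} θz j = applyD-⊖ {θ} θz s (act a s) (punchIn s j) 0

  -- On the wall the values of a falling power at `V s` and `V (punchIn s j)` agree, and a partial
  -- derivative of index above `a` kills both coordinates involved.
  θs-wall : ∀ j → 0 < act a (punchIn s j) → ∀ i → lin (wall j) ∣ applyD (lookup θs i) (wall j)
  θs-wall j q = lookup-down Good fall-good a (lookup-up (suc a) ℕP.≤-refl b)
    where
    Good : Der → Set _
    Good θ = lin (wall j) ∣ applyD θ (wall j)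
    fall-good : ∀ k → Good (fallD k)
    fall-good k = ∣-resp (sym (lin-wall j)) (sym (applyD-wall {fallD k} refl j)) (fall-diff k _ _ (∣-refl _))
    lookup-up : ∀ k → a < k → ∀ m i → Good (lookup (up ∂ⁿ k m (y ∷ [])) i)
    lookup-up k a<k zero    zero    = ∣-refl _
    lookup-up k a<k (suc m) zero    = ∣-respʳ (sym (trans (applyD-wall {∂ⁿ k} refl j)
      (trans (+-cong (∂ⁿ-≢ {k} {s} (λ e → ℕP.<⇒≢ a<k (≡.trans (≡.sym toℕ-s) e)))
                     (-‿cong (∂ⁿ-≢ {k} {punchIn s j} (ℕP.<⇒≢ (ℕP.<-trans (active⇒< q) a<k))))) (-‿inverseʳ 0#)))) (∣-0 _)
    lookup-up k a<k (suc m) (suc i) = lookup-up (suc k) (ℕP.m≤n⇒m≤1+n a<k) m i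

  ∂-wall : ∀ j → 0 < act a (punchIn s j) → Cancels (wall j) (applyD (∂ⁿ a) (wall j))
  ∂-wall j q f d = ∣-respʳ (trans (*-congʳ value) (*-identityˡ f)) d
    where
    value : applyD (∂ⁿ a) (wall j) ≈ 1#
    value = trans (applyD-wall {∂ⁿ a} refl j) (trans (+-cong (∂ⁿ-≡ {a} {s} toℕ-s) (-‿cong (∂ⁿ-≢ {a} {punchIn s j} (ℕP.<⇒≢ (active⇒< q)))))
      (solve 0 (:1 :- con (+ 0) := :1) refl))

  a≤l : a ≤ l
  a≤l = ≡.subst (a ≤_) a+b≡l (ℕP.m≤m+n a b)

  js : List (Fin l)
  js = map (λ i → inject≤ i a≤l) (allFin a)

  js-unique : Unique js
  js-unique = UniqueP.map⁺ (FinP.inject≤-injective a≤l a≤l _ _) (UniqueP.allFin⁺ a)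

  punchIn-< : ∀ {j : Fin l} → toℕ j < a → toℕ (punchIn s j) < a
  punchIn-< {j} j<a = ≡.subst (toℕ (punchIn s j) <_) toℕ-s (proj₂ (toℕ-punchIn-< s j) (≡.subst (toℕ j <_) (≡.sym toℕ-s) j<a))

  punchIn-<⁻ : ∀ {j : Fin l} → toℕ (punchIn s j) < a → toℕ j < a
  punchIn-<⁻ {j} lt = ≡.subst (toℕ j <_) toℕ-s (proj₁ (toℕ-punchIn-< s j) (≡.subst (toℕ (punchIn s j) <_) (≡.sym toℕ-s) lt))

  js-active : All (λ j → 0 < act a (punchIn s j)) js
  js-active = AllP.map⁺ (All.universal (λ i → ℕP.≤-reflexive (≡.sym (act-< {a = a} { punchIn s (inject≤ i a≤l)}
    (punchIn-< (≡.subst (_< a) (≡.sym (FinP.toℕ-inject≤ i a≤l)) (FinP.toℕ<n i)))))) (allFin a))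

  js-complete′ : ∀ j → toℕ j < a → j ∈ js
  js-complete′ j j<a = ≡.subst (_∈ js) (FinP.toℕ-injective (≡.trans (FinP.toℕ-inject≤ _ a≤l) (FinP.toℕ-fromℕ< j<a)))
    (∈P.∈-map⁺ (λ i → inject≤ i a≤l) (∈P.∈-allFin (fromℕ< j<a)))

  length-js : length js ≡ a
  length-js = ≡.trans (ListP.length-map _ (allFin a)) (ListP.length-tabulate id)

  walls≃ : Walls js ≃ Conf p (act (suc a))
  walls≃ = walls-complete (act (suc a))
    (≡.trans (act-< {a = suc a} {s} (s≤s (ℕP.≤-reflexive toℕ-s))) (≡.cong suc (≡.sym s-idle)))
    same (inj₂ (λ j → narrow (punchIn s j))) js js-active (λ j q → js-complete′ j (punchIn-<⁻ (active⇒< q)))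
    where
    narrow : ∀ i → act a i ≤ 1
    narrow i = go (toℕ i ℕ.<? a)
      where
      go : Dec (toℕ i < a) → act a i ≤ 1
      go (yes q) = ℕP.≤-reflexive (act-< {a = a} { i} q)
      go (no q)  = ℕP.≤-trans (ℕP.≤-reflexive (act-≮ {a = a} { i} q)) z≤n
    same : ∀ j → act (suc a) (punchIn s j) ≡ act a (punchIn s j)
    same j = go (toℕ (punchIn s j) ℕ.<? a)
      where
      go : Dec (toℕ (punchIn s j) < a) → act (suc a) (punchIn s j) ≡ act a (punchIn s j)
      go (yes q) = ≡.trans (act-< {a = suc a} {punchIn s j} (ℕP.m≤n⇒m≤1+n q)) (≡.sym (act-< {a = a} { punchIn s j} q))
      go (no q)  = ≡.trans (act-≮ {a = suc a} {punchIn s j} (λ { (s≤s le) → [ q , (λ e → FinP.punchInᵢ≢i s j (FinP.toℕ-injective (≡.trans e (≡.sym toℕ-s)))) ]′ (ℕP.m≤n⇒m<n∨m≡n le) }))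
                    (≡.sym (act-≮ {a = a} { punchIn s j} q))

  module _ (basis : Basis (Conf p (act a)) (braidBasis a (suc b))) where

    basis₀ : Basis (Conf p (act a)) (∂ⁿ a ∷ θs)
    basis₀ = basis-⇄ (⇄-down-out fallD a (∂ⁿ a)) basis

    -- ∏ (t − V_j) over the active j is monic of degree a, vanishes at the active
    -- points, and takes the value ∏ wall at V_s.
    braid-next : Basis (Conf p (act (suc a))) (braidBasis (suc a) b)
    braid-next = basis-⇄ (⇄-head 1# 1# (*-identityˡ 1#) top) (basis-≃ PL walls≃ (basis-walls basis₀ θs-wall ∂-wall js js-unique js-active))
      where
      roots : List Carrier
      roots = map (V ∘ punchIn s) js
      length-roots : length roots ≡ a
      length-roots = ≡.trans (ListP.length-map _ js) length-js
      Φ : Der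
      Φ = Θ (∂ⁿ a) js
      prod-roots : ∀ is → prod (map (V ∘ punchIn s) is) (V s) ≈ ∏wall is
      prod-roots []       = refl
      prod-roots (i ∷ is) = *-cong (sym (lin-wall i)) (prod-roots is)
      at-active : ∀ i → toℕ i < suc a → E roots 0 (V i) - Φ (suc i) ≈ 0#
      at-active i (s≤s i≤a) with view i
      ... | is-s ≡.refl = trans (+-cong (trans (E-prod roots 0 (V s)) (trans (*-identityˡ _) (prod-roots js)))
              (-‿cong (trans (Θ≈∏wall (∂ⁿ a) js (suc s)) (trans (*-congˡ (∂ⁿ-≡ {a} {s} toℕ-s)) (*-identityʳ _))))) (-‿inverseʳ _)
      ... | other j ≡.refl = trans (+-cong (E-root 0 (AnyP.map⁺ (Any.map (λ e → reflexive (≡.cong (V ∘ punchIn s) e)) (js-complete′ j (punchIn-<⁻ i<a)))))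
              (-‿cong (trans (Θ≈∏wall (∂ⁿ a) js (suc (punchIn s j))) (trans (*-congˡ (∂ⁿ-≢ {a} {punchIn s j} (ℕP.<⇒≢ i<a))) (zeroʳ _))))) (-‿inverseʳ 0#)
        where
        i<a : toℕ (punchIn s j) < a
        i<a = ℕP.≤∧≢⇒< i≤a (λ e → FinP.punchInᵢ≢i s j (FinP.toℕ-injective (≡.trans e (≡.sym toℕ-s))))
      rest : Vec Der (b ℕ.+ 1)
      rest = up ∂ⁿ (suc a) b (y ∷ [])
      top : Span θs (λ k → fallD a k - 1# * Φ k)
      top = span-cong (λ k → solve 3 (λ f e t → (e :- t) :+ :- :1 :* (e :- :1 :* f) := f :- :1 :* t) refl (fallD a k) (der (E roots 0) k) (Φ k))
        (span-+ (LeadingTerms.span-rest fallD rest a (span-up (suc a) b (≡.cong suc a+b≡l)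
                   (trans (+-congˡ (-‿cong (trans (Θ≈∏wall (∂ⁿ a) js zero) (zeroʳ _)))) (-‿inverseʳ 0#)) at-active))
                (span-* (- 1#) (lead-E rest roots 0 length-roots)))

module BraidHomog {c ℓ} {K : Field c ℓ} (char : CharZero K) {l : ℕ} (PL : PolyLike K (suc l)) (p : Fin l → Field.Carrier K) where
  open FreeBases K using (HomogDer)
  open PolyLike PL
  open LinearAlgebra PL
  open Points char PL p

  homog-nat : ∀ n → Homog 0 (nat n)
  homog-nat n = homog-cong (sym (nat≈ι n)) (homog-ι _)

  homog-nat*z : ∀ n → Homog 1 (nat n * z)
  homog-nat*z n = homog-* (homog-nat n) (homog-y zero)

  homog-V : ∀ i → Homog 1 (V i)
  homog-V i = homog-lin _

  homog-fall : ∀ k {v} → Homog 1 v → Homog k (fall k v)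
  homog-fall zero    h = homog-1
  homog-fall (suc k) {v} h = ≡.subst (λ d → Homog d (fall (suc k) v)) (ℕP.+-comm k 1)
    (homog-* (homog-fall k h) (homog-+ h (homog-neg (homog-nat*z k))))

  homog-der : ∀ {d F} → (∀ i → Homog d (F (V i))) → HomogDer PL d (der F)
  homog-der h zero    = homog-0 _
  homog-der h (suc i) = h i

  homog-∂ⁿ : ∀ k → HomogDer PL 0 (∂ⁿ k)
  homog-∂ⁿ k zero    = homog-0 0
  homog-∂ⁿ k (suc i) with does (toℕ i ℕ.≟ k)
  ... | true  = homog-1
  ... | false = homog-0 0

  braidDegrees : ∀ a b → Vec ℕ (a ℕ.+ (b ℕ.+ 1))
  braidDegrees a b = down id a (zeros b (1 ∷ []))

  braid-homog : ∀ a b k → VPW.Pointwise (HomogDer PL) (braidDegrees a b) (down fallD a (up ∂ⁿ k b (y ∷ [])))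
  braid-homog a b k = down⁺ (λ k → homog-der (λ i → homog-fall k (homog-V i))) a (up-zeros⁺ homog-∂ⁿ k b (homog-y ∷ []))

module BraidStart {c ℓ} {K : Field c ℓ} (char : CharZero K) {l : ℕ} (PL : PolyLike K (suc l)) (p : Fin l → Field.Carrier K) where
  private module K = Field K
  open PolyLike PL
  open LinearAlgebra PL
  open Arrangements K using (zForm)
  open Invariance K
  open Unions K
  open Configurations K char
  open Points char PL p

  -- Only z = 0 is present. Adding it to the empty arrangement gives z ∂_z and the other partial
  -- derivatives, and z ∂_z may be exchanged for the Euler derivation.
  braid-start : Basis (Conf p (act 0)) (braidBasis 0 l)
  braid-start = basis-⇄ change (basis-≃ PL same
      (basis-∪₁ {s = zero} 1≉0 (basis-empty {A = λ _ → Lift _ ⊥} (λ _ → Lift.lower)) others first))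
    where
    same : ((λ _ → Lift _ ⊥) ∪₁ zForm) ≃ Conf p (act 0)
    same = ≼-by-≈ (λ { β (new e) → β , isZ e , λ _ → K.refl })
      ,≃ ≼-by-≈ (λ { β (isZ e) → β , new e , λ _ → K.refl
                   ; β (isP i _ _ _ _ a< _ _) → contradiction (proj₁ (<-act {a = 0} {i = i} a<)) λ () })
    others : ∀ i → lin zForm ∣ applyD (lookup (Vec.tabulate (unitD ∘ suc)) i) zForm
    others i = ∣-respʳ (sym (trans (applyD-z (lookup (Vec.tabulate (unitD ∘ suc)) i))
      (trans (reflexive (≡.cong (λ θ → θ zero) (VecP.lookup∘tabulate (unitD ∘ suc) i))) (unitD-≢ {suc i} {zero} λ ())))) (∣-0 _)
    first : Cancels zForm (applyD (unitD zero) zForm)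
    first f = ∣-respʳ (trans (*-congʳ (trans (applyD-z (unitD zero)) (unitD-≡ zero))) (*-identityˡ f))
    tabulate-up : ∀ k m (g : Fin m → Der) → (∀ i → g i ≈D ∂ⁿ (k ℕ.+ toℕ i)) → Vec.tabulate g ⇄ up ∂ⁿ k m []
    tabulate-up k zero    g e = ⇄-refl
    tabulate-up k (suc m) g e = ⇄-trans
      (⇄-head {x′ = ∂ⁿ k} 1# 1# (*-identityˡ 1#) (span-0 _ (λ t → trans (+-cong (reflexive (≡.cong (λ n → ∂ⁿ n t) (≡.sym (ℕP.+-identityʳ k))))
        (-‿cong (trans (*-identityˡ _) (e zero t)))) (-‿inverseʳ _))))
      (⇄-cong (∂ⁿ k) (tabulate-up (suc k) m (g ∘ suc) (λ i t → trans (e (suc i) t) (reflexive (≡.cong (λ n → ∂ⁿ n t) (ℕP.+-suc k (toℕ i)))))))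
    unit-∂ⁿ : ∀ (i : Fin l) → unitD (suc i) ≈D ∂ⁿ (toℕ i)
    unit-∂ⁿ i zero    = unitD-≢ {suc i} {zero} λ ()
    unit-∂ⁿ i (suc t) = go (t Fin.≟ i)
      where
      go : Dec (t ≡ i) → unitD (suc i) (suc t) ≈ ∂ⁿ (toℕ i) (suc t)
      go (yes ≡.refl) = trans (unitD-≡ (suc t)) (sym (∂ⁿ-≡ {i = t} ≡.refl))
      go (no t≢i)     = trans (unitD-≢ {suc i} {suc t} (t≢i ∘ FinP.suc-injective)) (sym (∂ⁿ-≢ {i = t} (t≢i ∘ FinP.toℕ-injective)))
    change : (λ k → lin zForm * unitD zero k) ∷ Vec.tabulate (unitD ∘ suc) ⇄ braidBasis 0 l
    change = ⇄-trans (⇄-cong _ (tabulate-up 0 l (unitD ∘ suc) unit-∂ⁿ))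
      (⇄-trans (⇄-head {x′ = y} 1# 1# (*-identityˡ 1#) (span-up 0 l ≡.refl
          (trans (+-congˡ (-‿cong (trans (*-identityˡ _) (trans (*-cong (applyD-z y) (unitD-≡ zero)) (*-identityʳ _))))) (-‿inverseʳ _))
          (λ i ())))
        (⇄-up-in ∂ⁿ 0 l y))

module Braid {c ℓ} (K : Field c ℓ) (char : CharZero K) (PL : ∀ N → PolyLike K N) (basisToFree : FreeBases.BasisToFree K PL) where
  private module K = Field K
  open Arrangements K using (IndFree; step; empty; FreeWith; zForm; Del; Res; Form)
  open Invariance K
  open Configurations K char

  start-indFree : ∀ l (p : Fin l → K.Carrier) → IndFree (suc l) (Conf p (act 0))
  start-indFree l p = step zForm (isZ (λ _ → K.refl)) zero 1≉0 (empty no-del) (empty no-res)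
    (Vec.replicate (suc l) 0) (Vec.replicate l 0) (free no-del) (free no-res)
    (0 ∷ [] , ↭P.∷↭∷ʳ 0 (toList (Vec.replicate l 0)))
    where
    no-del : ∀ β → ¬ Del (Conf p (act 0)) zForm β
    no-del β (isZ e , np) = np (K.1# , λ k → K.trans (e k) (K.sym (K.*-identityˡ _)))
    no-del β (isP i _ _ _ _ a< _ _ , np) = contradiction (proj₁ (<-act {a = 0} {i = i} a<)) λ ()
    no-res : ∀ β → ¬ Res (Conf p (act 0)) zero zForm 1≉0 β
    no-res β (γ , d , _) = no-del γ d
    free : ∀ {N A} → (∀ β → ¬ A β) → FreeWith {N} A (Vec.replicate N 0)
    free {N} ∅ = basisToFree (Vec.replicate N 0) (units unitD homog-unit) (basis-empty ∅)
      where
      open LinearAlgebra (PL N)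
      open PolyLike (PL N) using (Homog; homog-0)
      homog-unit : ∀ i k → Homog 0 (unitD i k)
      homog-unit i k with does (k Fin.≟ i)
      ... | true  = homog-1
      ... | false = homog-0 0
      units : ∀ {m} (g : Fin m → Der) → (∀ i k → Homog 0 (g i k)) → VPW.Pointwise (λ d θ → ∀ k → Homog d (θ k)) (Vec.replicate m 0) (Vec.tabulate g)
      units {zero}  g h = []
      units {suc m} g h = h zero ∷ units (g ∘ suc) (h ∘ suc)

  BraidClaim : ∀ l (a b : ℕ) → (Fin l → K.Carrier) → Set _
  BraidClaim l a b p = IndFree (suc l) (Conf p (act a)) ×
    LinearAlgebra.Basis (PL (suc l)) (Conf p (act a)) (Points.braidBasis char (PL (suc l)) p a b)

  -- Both recursive calls have one active vertex fewer: the arrangement before the walls keeps s as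
  -- an idle vertex, the restrictions lose it.
  braid : ∀ a b l → a ℕ.+ b ≡ l → ∀ p → BraidClaim l a b p
  braid zero    b l       ≡.refl p = start-indFree l p , BraidStart.braid-start char (PL (suc l)) p
  braid (suc a) b (suc l) eq p = next (braid a (suc b) (suc l) (≡.trans (ℕP.+-suc a b) eq) p)
    where
    a<l : a < suc l
    a<l = ≡.subst (a <_) eq (s≤s (ℕP.m≤m+n a b))
    s = fromℕ< a<l
    toℕ-s = FinP.toℕ-fromℕ< a<l
    open BraidStep char (PL (suc (suc l))) p s {a} {b} toℕ-s (ℕP.suc-injective eq)
    open BraidHomog char (PL (suc (suc l))) p using (homog-∂ⁿ; braid-homog; braidDegrees)
    open Extension K char p (act a) s
    next : BraidClaim (suc l) a (suc b) p → BraidClaim (suc l) (suc a) b p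
    next (ind , basis) =
      IndFree-≃ walls≃ (WallFree.indFree-walls PL basisToFree (basis₀ basis) θs-wall ∂-wall {0} {braidDegrees a b} (homog-∂ⁿ a) (braid-homog a b (suc a)) ind collapsed js js-unique js-active)
      , braid-next basis
      where
      collapsed : ∀ j → 0 < act a (punchIn s j) → IndFree (suc l) (Conf (Collapse.p′ j) (Collapse.w′ j)) ×
        ∃ λ m → ∃ λ (e : Vec ℕ m) → FreeWith (Conf (Collapse.p′ j) (Collapse.w′ j)) e × toList e ≡ toList (braidDegrees a b)
      collapsed j _ = go (braid a b l (ℕP.suc-injective eq) (Collapse.p′ j))
        where
        -- As s carries no points yet, gluing it to j adds none, and removing s leaves the indices
        -- below `a` unchanged.
        w′≡ : ∀ i → act a i ≡ Collapse.w′ j i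
        w′≡ i = ≡.trans (≡.subst (λ a → act a i ≡ act a (punchIn s i)) toℕ-s (≡.sym (act-punchIn s i))) (shift-id (i Fin.≟ j))
          where
          shift-id : ∀ {x} → Dec (i ≡ j) → x ≡ Collapse.shift j i x
          shift-id {x} (yes ≡.refl) = ≡.trans (≡.cong (ℕ._+ x) (≡.sym s-idle)) (≡.sym (Collapse.shift-j j x))
          shift-id {x} (no ne)      = ≡.sym (Collapse.shift-≢ j ne x)
        conf≃ : Conf (Collapse.p′ j) (act a) ≃ Conf (Collapse.p′ j) (Collapse.w′ j)
        conf≃ = conf-≃ (λ _ → K.refl) w′≡
        go : BraidClaim l a b (Collapse.p′ j) → _
        go (ind , basis) = IndFree-≃ conf≃ ind , _ , braidDegrees a b ,
          FreeWith-≃ (braidDegrees a b) conf≃ (basisToFree (braidDegrees a b) (BraidHomog.braid-homog char (PL (suc l)) (Collapse.p′ j) a b a) basis) , ≡.refl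

-- Lengthening an interval

allFin-punchIn : ∀ {l} (s : Fin (suc l)) → allFin (suc l) ↭ s ∷ map (punchIn s) (allFin l)
allFin-punchIn {l} zero    = ↭-reflexive (≡.cong (zero ∷_) (≡.sym (ListP.map-tabulate id suc)))
allFin-punchIn {suc l} (suc s) = begin
  zero ∷ List.tabulate suc                                          ≡⟨ ≡.cong (zero ∷_) (ListP.map-tabulate id suc) ⟨
  zero ∷ map suc (allFin (suc l))                                   ↭⟨ ↭-prep _ (↭P.map⁺ suc (allFin-punchIn s)) ⟩
  zero ∷ suc s ∷ map suc (map (punchIn s) (allFin l))               ↭⟨ ↭-swap zero (suc s) ↭-refl ⟩
  suc s ∷ zero ∷ map suc (map (punchIn s) (allFin l))               ≡⟨ ≡.cong (λ xs → suc s ∷ zero ∷ xs) (ListP.map-∘ (allFin l)) ⟨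
  suc s ∷ zero ∷ map (punchIn (suc s) ∘ suc) (allFin l)             ≡⟨ ≡.cong (λ xs → suc s ∷ zero ∷ xs) (ListP.map-∘ (allFin l)) ⟩
  suc s ∷ zero ∷ map (punchIn (suc s)) (map suc (allFin l))         ≡⟨ ≡.cong (λ xs → suc s ∷ zero ∷ map (punchIn (suc s)) xs) (ListP.map-tabulate id suc) ⟩
  suc s ∷ zero ∷ map (punchIn (suc s)) (List.tabulate suc)          ∎
  where open PermutationReasoning

map-allFin-punchIn : ∀ {l} {A : Set} (f : Fin (suc l) → A) s → map f (allFin (suc l)) ↭ f s ∷ map (f ∘ punchIn s) (allFin l)
map-allFin-punchIn f s = ↭-trans (↭P.map⁺ f (allFin-punchIn s)) (↭-reflexive (≡.cong (f s ∷_) (≡.sym (ListP.map-∘ (allFin _)))))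

next : ∀ {l} → Fin l × ℕ → Fin l × ℕ
next (i , a) = i , suc a

-- Ys lists the pairs (i , a) with a < n i. The permutation says that adjoining
-- either all (i , 0) to its shift or all (i , n i) to itself gives the pairs with a ≤ n i.
record Diagram {l} (n : Fin l → ℕ) (N : ℕ) (Ys : List (Fin l × ℕ)) : Set where
  field
    complete : ∀ i a → a < n i → (i , a) ∈ Ys
    sound    : All (λ ia → proj₂ ia < n (proj₁ ia)) Ys
    size     : length Ys ≡ N
    shifts   : map (_, 0) (allFin l) ++ map next Ys ↭ map (λ i → i , n i) (allFin l) ++ Ys

diagram-empty : ∀ {l} {n : Fin l → ℕ} → (∀ i → n i ≡ 0) → Diagram n 0 []
diagram-empty n≡0 = record
  { complete = λ i a a< → contradiction (≡.subst (a <_) (n≡0 i) a<) λ ()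
  ; sound = [] ; size = ≡.refl
  ; shifts = ↭-reflexive (≡.cong (_++ []) (ListP.map-cong (λ i → ≡.cong (i ,_) (≡.sym (n≡0 i))) (allFin _))) }

-- The former last point of s joins the list, and its right neighbour becomes the last point. In the
-- permutation both sides gain (s , n s + 1): on the left as the shift of the new entry, on the
-- right as the new end, while the old end moves into the list.
diagram-suc : ∀ {l} {n n⁺ : Fin (suc l) → ℕ} {N Ys} s → n⁺ s ≡ suc (n s) → (∀ j → n⁺ (punchIn s j) ≡ n (punchIn s j)) →
              Diagram n N Ys → Diagram n⁺ (suc N) ((s , n s) ∷ Ys)
diagram-suc {l} {n} {n⁺} {N} {Ys} s eq same D = record
  { complete = λ i a a< → complete⁺ i a a< (s Fin.≟ i)
  ; sound = ≡.subst (n s <_) (≡.sym eq) (ℕP.n<1+n _) ∷ All.map (λ {ia} lt → ℕP.<-≤-trans lt (n≤n⁺ (proj₁ ia) (s Fin.≟ proj₁ ia))) sound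
  ; size = ≡.cong suc size
  ; shifts = begin
      map (_, 0) (allFin (suc l)) ++ (s , suc (n s)) ∷ map next Ys
        ↭⟨ ↭P.shift (s , suc (n s)) (map (_, 0) (allFin (suc l))) (map next Ys) ⟩
      (s , suc (n s)) ∷ map (_, 0) (allFin (suc l)) ++ map next Ys
        ↭⟨ ↭-prep _ (shifts) ⟩
      (s , suc (n s)) ∷ map (λ i → i , n i) (allFin (suc l)) ++ Ys
        ↭⟨ ↭-prep _ (↭P.++⁺ʳ Ys (map-allFin-punchIn (λ i → i , n i) s)) ⟩
      (s , suc (n s)) ∷ (s , n s) ∷ tops ++ Ys
        ↭⟨ ↭-prep _ (↭P.shift (s , n s) tops Ys) ⟨
      (s , suc (n s)) ∷ tops ++ (s , n s) ∷ Ys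
        ≡⟨ ≡.cong₂ (λ m ts → (s , m) ∷ ts ++ (s , n s) ∷ Ys) (≡.sym eq) (ListP.map-cong (λ j → ≡.cong (punchIn s j ,_) (≡.sym (same j))) (allFin l)) ⟩
      (s , n⁺ s) ∷ map (λ j → punchIn s j , n⁺ (punchIn s j)) (allFin l) ++ (s , n s) ∷ Ys
        ↭⟨ ↭P.++⁺ʳ ((s , n s) ∷ Ys) (map-allFin-punchIn (λ i → i , n⁺ i) s) ⟨
      map (λ i → i , n⁺ i) (allFin (suc l)) ++ (s , n s) ∷ Ys ∎ }
  where
  open Diagram D
  open PermutationReasoning
  tops = map (λ j → punchIn s j , n (punchIn s j)) (allFin l)
  same′ : ∀ {i} → s ≢ i → n⁺ i ≡ n i
  same′ s≢i = ≡.subst (λ i → n⁺ i ≡ n i) (FinP.punchIn-punchOut s≢i) (same _)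
  n≤n⁺ : ∀ i → Dec (s ≡ i) → n i ≤ n⁺ i
  n≤n⁺ i (yes ≡.refl) = ≡.subst (n s ≤_) (≡.sym eq) (ℕP.n≤1+n _)
  n≤n⁺ i (no s≢i)     = ℕP.≤-reflexive (≡.sym (same′ s≢i))
  complete⁺ : ∀ i a → a < n⁺ i → Dec (s ≡ i) → (i , a) ∈ (s , n s) ∷ Ys
  complete⁺ i a a< (no s≢i) = there (complete i a (≡.subst (a <_) (same′ s≢i) a<))
  complete⁺ i a a< (yes ≡.refl) = [ (λ lt → there (complete i a lt)) , (λ e → here (≡.cong (i ,_) e)) ]′
    (ℕP.m≤n⇒m<n∨m≡n (ℕP.≤-pred (≡.subst (a <_) eq a<)))

module CatalanPoints {c ℓ} {K : Field c ℓ} (char : CharZero K) {l : ℕ} (PL : PolyLike K (suc (suc l)))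
  (p : Fin (suc l) → Field.Carrier K) where
  private module K = Field K
  open PolyLike PL
  open LinearAlgebra PL
  open FreeBases K using (HomogDer)
  open Configurations K char
  open Points char PL p
  open BraidHomog char PL p
  open ℤSolver R

  pos : List (Fin (suc l) × ℕ) → List Carrier
  pos = map (λ ia → P (proj₁ ia) (proj₂ ia))

  TD : List Carrier → ℕ → Der
  TD ys k = der (T ys k)

  -- The last two entries, `ones` and `y`, are the sum of all ∂/∂x_i and the Euler derivation; they
  -- provide the exponents 0 and 1.
  catalanBasis : List (Fin (suc l) × ℕ) → Vec Der (l ℕ.+ 2)
  catalanBasis Ys = down (TD (pos Ys)) l (ones ∷ y ∷ [])

  catalanDegrees : ℕ → ∀ m → Vec ℕ (m ℕ.+ 2)
  catalanDegrees N m = down (λ k → N ℕ.+ suc k) m (0 ∷ 1 ∷ [])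

  pos-root : ∀ {Ys i a} → (i , a) ∈ Ys → Any (P i a ≈_) (pos Ys)
  pos-root {i = i} {a} i∈ = AnyP.map⁺ (Any.map (λ e → reflexive (≡.cong (λ ia → P (proj₁ ia) (proj₂ ia)) e)) i∈)

  T-stable : ∀ {Ys i} n → (∀ a → a < n → (i , a) ∈ Ys) → ∀ k → T (pos Ys) k (P i n) ≈ T (pos Ys) k (V i)
  T-stable {Ys} {i} zero    h k = T-cong (pos Ys) k (P-0 i)
  T-stable {Ys} {i} (suc n) h k = trans (T-cong (pos Ys) k (P-suc i n)) (trans (T-Δ (pos Ys) k (P i n))
    (trans (+-congˡ (trans (*-congˡ (E-root k (pos-root (h n ℕP.≤-refl)))) (zeroʳ z)))
      (trans (+-identityʳ _) (T-stable {Ys} n (λ a a< → h a (ℕP.m<n⇒m<1+n a<)) k))))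

  -- A polynomial takes values at two points whose difference is divisible by the difference of the
  -- points. Being constant on intervals, `T` may be evaluated at the colliding points instead of at
  -- their first points.
  TD-inD : ∀ {n Ys} → (∀ i a → a < n i → (i , a) ∈ Ys) → ∀ k → InD (Conf p (suc ∘ n)) (TD (pos Ys) k)
  TD-inD {n} {Ys} h k = inD refl λ { i a j b _ (s≤s a≤) (s≤s b≤) → ∣-respʳ
    (+-cong (T-stable {Ys} {i} a (λ a′ lt → h i a′ (ℕP.<-≤-trans lt a≤)) k)
            (-‿cong (T-stable {Ys} {j} b (λ b′ lt → h j b′ (ℕP.<-≤-trans lt b≤)) k)))
    (T-diff (pos Ys) k _ _ (∣-refl _)) }

  homog-T : ∀ ys k {v} → All (Homog 1) ys → Homog 1 v → Homog (length ys ℕ.+ suc k) (T ys k v)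
  homog-T []       k hs       h = homog-* (homog-ι _) (homog-fall (suc k) h)
  homog-T (y ∷ ys) k {v} (h′ ∷ hs) h = homog-+
    (≡.subst (λ d → Homog d (T ys (suc k) v)) (ℕP.+-suc (length ys) (suc k)) (homog-T ys (suc k) hs h))
    (homog-* (homog-+ (homog-nat*z k) (homog-neg h′)) (homog-T ys k hs h))

  homog-pos : ∀ Ys → All (Homog 1) (pos Ys)
  homog-pos Ys = AllP.map⁺ (All.universal (λ ia → homog-+ (homog-V (proj₁ ia)) (homog-nat*z (proj₂ ia))) Ys)

  homog-TD : ∀ {Ys N} → length Ys ≡ N → ∀ k → HomogDer PL (N ℕ.+ suc k) (TD (pos Ys) k)
  homog-TD {Ys} e k = ≡.subst (λ d → HomogDer PL (d ℕ.+ suc k) (TD (pos Ys) k)) (≡.trans (ListP.length-map _ Ys) e)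
    (homog-der (λ i → homog-T (pos Ys) k (homog-pos Ys) (homog-V i)))

  catalan-homog : ∀ {Ys N} → length Ys ≡ N → ∀ m → VPW.Pointwise (HomogDer PL) (catalanDegrees N m) (down (TD (pos Ys)) m (ones ∷ y ∷ []))
  catalan-homog {Ys} e m = down⁺ (homog-TD {Ys} e) m (homog-der (λ _ → homog-1) ∷ homog-y ∷ [])

  -- Without roots, `T` is the falling power of index k + 1 up to the unit 1/(k + 1), and the
  -- falling power of index 0 gives `ones`.
  catalan-start : ∀ {n} → (∀ i → n i ≡ 0) → Basis (Conf p (act (suc l))) (braidBasis (suc l) 0) → Basis (Conf p (suc ∘ n)) (catalanBasis [])
  catalan-start n≡0 basis = basis-⇄ (change l) (Invariance.basis-≃ K PL
      (conf-≃ (λ _ → K.refl) (λ i → ≡.trans (act-< {a = suc l} {i} (FinP.toℕ<n i)) (≡.cong suc (≡.sym (n≡0 i))))) basis)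
    where
    change : ∀ m {r} {rest : Vec Der r} → down fallD (suc m) rest ⇄ down (TD []) m (ones ∷ rest)
    change zero    = ⇄-refl
    change (suc m) {rest = rest} = ⇄-trans
      (⇄-head {x′ = TD [] m} (inv m) (nat (suc m)) (trans (*-comm _ _) (nat-inv m)) (span-0 (down fallD (suc m) rest)
        λ { zero → solve 1 (λ i → con (+ 0) :- i :* con (+ 0) := con (+ 0)) refl (inv m) ; (suc i) → -‿inverseʳ _ }))
      (⇄-cong (TD [] m) (change m))

module CatalanStep {c ℓ} {K : Field c ℓ} (char : CharZero K) {m : ℕ} (PL : PolyLike K (suc (suc (suc m))))
  (p : Fin (suc (suc m)) → Field.Carrier K) (n : Fin (suc (suc m)) → ℕ) (s : Fin (suc (suc m)))
  {N Ys} (D : Diagram n N Ys) where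
  private
    module K = Field K
    module KS = ℤSolver (Field.commutativeRing K)
  open PolyLike PL
  open LinearAlgebra PL
  open Arrangements K using (zForm; natK; δ)
  open Invariance K
  open Configurations K char
  open Extension K char p (suc ∘ n) s
  open WallBasis PL
  open Points char PL p
  open CatalanPoints char PL p
  open Diagram D
  open ℤSolver R
  open Algebra.Properties.Ring K.ring using (-0#≈0#; -‿involutive)

  ys : List Carrier
  ys = pos Ys

  yₛ : Carrier
  yₛ = P s (n s)

  X : ℕ → Der
  X = TD (yₛ ∷ ys)

  θs : Vec Der (m ℕ.+ 2)
  θs = down X m (ones ∷ y ∷ [])

  lin-wall : ∀ j → lin (wall j) ≈ P s (suc (n s)) - P (punchIn s j) 0
  lin-wall j = lin-⊖ s (suc (n s)) (punchIn s j) 0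

  -- By the recursion of `T`, `X k` is the old element of index k + 1 plus a multiple of the one of
  -- index k. From the top down each old element is exchanged for its `X`, which leaves over the one
  -- of index 0.
  triangular : ∀ m {r} {rest : Vec Der r} → down (TD ys) (suc m) rest ⇄ TD ys 0 ∷ down X m rest
  triangular zero    = ⇄-refl
  triangular (suc m) {rest = rest} = ⇄-trans
    (⇄-head {x′ = X m} 1# 1# (*-identityˡ 1#) (span-cong
      (λ { zero → solve 1 (λ t → t :* con (+ 0) := con (+ 0) :- :1 :* con (+ 0)) refl _
         ; (suc i) → solve 3 (λ a t b → t :* b := a :+ t :* b :- :1 :* a) refl (T ys (suc m) (V i)) (nat m * z - yₛ) (T ys m (V i)) })
      (span-* (nat m * z - yₛ) span-here)))
    (⇄-trans (⇄-cong (X m) (triangular m)) (⇄-swap (X m) (TD ys 0) (down X m rest)))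

  module _ {n⁺ : Fin (suc (suc m)) → ℕ} (n⁺-s : n⁺ s ≡ suc (n s)) (n⁺-other : ∀ j → n⁺ (punchIn s j) ≡ n (punchIn s j)) where

    D⁺ : Diagram n⁺ (suc N) ((s , n s) ∷ Ys)
    D⁺ = diagram-suc s n⁺-s n⁺-other D

    -- The `X k` already belong to the arrangement of the longer interval, of which every wall is a
    -- member.
    θs-wall : ∀ j → 0 < suc (n (punchIn s j)) → ∀ i → lin (wall j) ∣ applyD (lookup θs i) (wall j)
    θs-wall j _ = lookup-down (λ θ → lin (wall j) ∣ applyD θ (wall j))
      (λ k → TD-inD {n⁺} {(s , n s) ∷ Ys} (Diagram.complete D⁺) k (wall j) wall∈)
      m rest-wall
      where
      wall∈ : Conf p (suc ∘ n⁺) (wall j)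
      wall∈ = isP s (punchIn s j) (suc (n s)) 0 (FinP.punchInᵢ≢i s j ∘ ≡.sym)
        (s≤s (ℕP.≤-reflexive (≡.sym n⁺-s))) (s≤s z≤n) (λ _ → K.refl)
      rest-wall : ∀ i → lin (wall j) ∣ applyD (lookup (ones ∷ y ∷ []) i) (wall j)
      rest-wall zero       = ∣-respʳ (sym (trans (applyD-⊖ {ones} refl s (suc (n s)) (punchIn s j) 0) (-‿inverseʳ 1#))) (∣-0 _)
      rest-wall (suc zero) = ∣-refl _

    walls≃ : Walls (allFin (suc m)) ≃ Conf p (suc ∘ n⁺)
    walls≃ = walls-complete (suc ∘ n⁺) (≡.cong suc n⁺-s) (λ j → ≡.cong suc (n⁺-other j)) (inj₁ (s≤s z≤n))
      (allFin (suc m)) (All.universal (λ _ → s≤s z≤n) _) (λ j _ → ∈P.∈-allFin j)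

  cancels-≈ : ∀ {α a b} → a ≈ b → Cancels α a → Cancels α b
  cancels-≈ e c f d = c f (∣-respʳ (*-congʳ (sym e)) d)

  cancels-z : ∀ j → Cancels (wall j) z
  cancels-z j = cancels-≈ (applyD-z y) (lin-prime (wall j) (suc s) (wall-s j) zForm zero
    (λ e → 1≉0 (K.trans (KS.solve 1 (λ a → KS.:1 KS.:= KS.:1 KS.:- KS.con (+ 0) KS.:* a) K.refl (wall j zero)) e)))

  -- Modulo the wall, `yₛ` is `V (punchIn s j) − z`. The root therefore becomes (n_s - a) z if i is
  -- s, -(a + 1) z if i is the vertex of j, and otherwise still contains x_j; characteristic zero
  -- makes the first two nonzero.
  cancels-root : ∀ j i a → a < n i → Cancels (wall j) (yₛ - P i a)
  cancels-root j i a a< = cancels-≈ (lin-⊖ s (n s) i a) (go (view i))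
    where
    β = pt p s (n s) ⊖ pt p i a
    βₛ-other : ∀ {i′} → i ≡ punchIn s i′ → β (suc s) K.≈ K.1#
    βₛ-other {i′} ≡.refl = K.trans (K.+-cong (δ-≡ {t = s} ≡.refl) (K.-‿cong (δ-≢ (FinP.punchInᵢ≢i s i′ ∘ ≡.sym)))) (K.trans (K.+-congˡ -0#≈0#) (K.+-identityʳ K.1#))
    go : View i → Cancels (wall j) (lin β)
    go (is-s ≡.refl) = lin-prime (wall j) (suc s) (wall-s j) β zero (λ e → ℕP.<⇒≢ a< (natK-injective a (n s)
      (K.sym (x-y≈0⇒x≈y _ _ (K.trans (K.sym eq) e)))))
      where
      open Algebra.Properties.Group K.+-group using () renaming (x∙y⁻¹≈ε⇒x≈y to x-y≈0⇒x≈y)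
      eq : β zero K.- β (suc s) K.* wall j zero K.≈ natK (n s) K.- natK a
      eq = KS.solve 5 (λ q u v d x → (q KS.:+ u KS.:- (q KS.:+ v)) KS.:- (d KS.:- d) KS.:* x KS.:= u KS.:- v) K.refl (p s) (natK (n s)) (natK a) (δ s s) (wall j zero)
    go (other i′ e₁) = choose (i′ Fin.≟ j) e₁
      where
      choose : Dec (i′ ≡ j) → i ≡ punchIn s i′ → Cancels (wall j) (lin β)
      choose (yes ≡.refl) ≡.refl = lin-prime (wall j) (suc s) (wall-s j) β zero
        (λ e → char a (K.trans (K.sym (-‿involutive _)) (K.trans (K.-‿cong (K.trans (K.sym eq) e)) -0#≈0#)))
        where
        eq : β zero K.- β (suc s) K.* wall j zero K.≈ K.- natK (suc a)
        eq = K.trans (K.+-congˡ (K.-‿cong (K.*-congʳ (βₛ-other ≡.refl))))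
          (KS.solve 4 (λ q r u v → (q KS.:+ u KS.:- (r KS.:+ v)) KS.:- KS.:1 KS.:* (q KS.:+ (KS.:1 KS.:+ u) KS.:- (r KS.:+ KS.con (+ 0))) KS.:= KS.:- (KS.:1 KS.:+ v))
            K.refl (p s) (p (punchIn s j)) (natK (n s)) (natK a))
      choose (no i′≢j) ≡.refl = lin-prime (wall j) (suc s) (wall-s j) β (suc (punchIn s j)) (λ e → 1≉0 (K.trans (K.sym eq) e))
        where
        eq : β (suc (punchIn s j)) K.- β (suc s) K.* wall j (suc (punchIn s j)) K.≈ K.1#
        eq = K.trans (K.+-cong (K.+-cong (δ-≢ (FinP.punchInᵢ≢i s j)) (K.-‿cong (δ-≢ (i′≢j ∘ ≡.sym ∘ FinP.punchIn-injective s j i′))))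
               (K.-‿cong (K.*-cong (βₛ-other ≡.refl) (K.+-cong (δ-≢ (FinP.punchInᵢ≢i s j)) (K.-‿cong (δ-≡ {t = punchIn s j} ≡.refl))))))
               (KS.solve 0 ((KS.con (+ 0) KS.:- KS.con (+ 0)) KS.:- KS.:1 KS.:* (KS.con (+ 0) KS.:- KS.:1) KS.:= KS.:1) K.refl)

  -- On the wall V_j = V_s + (n_s + 1) z, so T(V_s) − T(V_j) is a sum of values of
  -- − z ∏ (t − root) at V_s, …, V_s + n_s z, all of which vanish but the last.
  θ-wall : ∀ j → 0 < suc (n (punchIn s j)) → Cancels (wall j) (applyD (TD ys 0) (wall j))
  θ-wall j _ = cancels-≈ (sym (applyD-⊖ {TD ys 0} refl s (suc (n s)) k 0)) (cancels-mod
    (∣-resp (sym (lin-wall j)) eq (∣-sym-diff (T-diff ys 0 (P s (suc (n s))) (P k 0) (∣-refl _))))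
    (cancels-neg (cancels-* (cancels-z j) (cancels-≈ (sym (trans (E-prod ys 0 yₛ) (*-identityˡ _))) (cancels-prod Ys sound)))))
    where
    k = punchIn s j
    cancels-prod : ∀ Zs → All (λ ia → proj₂ ia < n (proj₁ ia)) Zs → Cancels (wall j) (prod (pos Zs) yₛ)
    cancels-prod []             _        = cancels-1 (wall j)
    cancels-prod ((i , a) ∷ Zs) (q ∷ qs) = cancels-* (cancels-root j i a q) (cancels-prod Zs qs)
    eq : T ys 0 (P k 0) - T ys 0 (P s (suc (n s))) ≈ - (z * E ys 0 yₛ) - (T ys 0 (V s) - T ys 0 (V k))
    eq = trans (+-cong (T-cong ys 0 (P-0 k)) (-‿cong (trans (T-cong ys 0 (P-suc s (n s))) (trans (T-Δ ys 0 yₛ)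
           (+-congʳ (T-stable {Ys} {s} (n s) (complete s) 0))))))
      (solve 3 (λ a b e → a :- (b :+ e) := :- e :- (b :- a)) refl (T ys 0 (V k)) (T ys 0 (V s)) (z * E ys 0 yₛ))

  private
    J = Fin (suc m)
    -- The last point of an interval, and the place just before its first point. As the walls
    -- express that the right neighbour of `yₛ` is the first point of j, the difference `yₛ − b j`
    -- is exactly the wall.
    a b : J → Carrier
    a j = P (punchIn s j) (n (punchIn s j))
    b j = V (punchIn s j) - z
    js : List J
    js = allFin (suc m)
    bₛ = V s - z

    a-b : ∀ j → a j - b j ≈ nat (suc (n (punchIn s j))) * z
    a-b j = solve 3 (λ v u z → v :+ u :* z :- (v :- z) := (:1 :+ u) :* z) refl (V (punchIn s j)) (nat (n (punchIn s j))) z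

    y-b : ∀ j → yₛ - b j ≈ lin (wall j)
    y-b j = trans (solve 4 (λ v u z w → v :+ u :* z :- (w :- z) := v :+ (:1 :+ u) :* z :- (w :+ con (+ 0) :* z)) refl (V s) (nat (n s)) z (V (punchIn s j)))
      (sym (lin-wall j))

    module Top = TopRelation ys yₛ a b (lin ∘ wall) (λ j → suc (n (punchIn s j))) a-b y-b (ones ∷ y ∷ []) span-here

    yₛ-bₛ : yₛ - bₛ ≈ nat (suc (n s)) * z
    yₛ-bₛ = solve 3 (λ v u z → v :+ u :* z :- (v :- z) := (:1 :+ u) :* z) refl (V s) (nat (n s)) z

    tops bottoms : List (Fin (suc (suc m)) × ℕ)
    tops    = (s , n s) ∷ map (λ j → punchIn s j , n (punchIn s j)) js
    bottoms = (s , 0) ∷ map (λ j → punchIn s j , 0) js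

    bottoms↭tops : bottoms ++ map next Ys ↭ tops ++ Ys
    bottoms↭tops = ↭-trans (↭P.++⁺ʳ (map next Ys) (↭-sym (map-allFin-punchIn (_, 0) s)))
      (↭-trans shifts (↭P.++⁺ʳ Ys (map-allFin-punchIn (λ i → i , n i) s)))

    pos-tops : pos (tops ++ Ys) ≡ yₛ ∷ map a js ++ ys
    pos-tops = ≡.trans (ListP.map-++ _ tops Ys) (≡.cong (λ as → yₛ ∷ as ++ ys) (≡.sym (ListP.map-∘ js)))

    -- Moving every interval one step to the left frees its last place and occupies the one before
    -- its first; the other places are those of `ys`. This is the `shifts` permutation of the
    -- diagram.
    shifted : ∀ v → T (bₛ ∷ map b js ++ ys) 0 v ≈ T (map (_- z) (yₛ ∷ map a js ++ ys)) 0 v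
    shifted v = trans (T-pointwise bottoms≈ 0 v) (trans (T-↭ (↭P.map⁺ (_- z) (↭P.map⁺ _ bottoms↭tops)) 0 v)
      (reflexive (≡.cong (λ xs → T (map (_- z) xs) 0 v) pos-tops)))
      where
      P-0-z : ∀ i → V i - z ≈ P i 0 - z
      P-0-z i = +-congʳ (sym (P-0 i))
      rows : ∀ Zs → Pointwise _≈_ (pos Zs) (map (_- z) (pos (map next Zs)))
      rows []             = []
      rows ((i , a) ∷ Zs) = trans (solve 2 (λ x z → x := x :+ z :- z) refl (P i a) z) (+-congʳ (sym (P-suc i a))) ∷ rows Zs
      zeros≈ : ∀ is → Pointwise _≈_ (map b is ++ ys) (map (_- z) (pos (map (λ j → punchIn s j , 0) is ++ map next Ys)))
      zeros≈ []       = rows Ys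
      zeros≈ (i ∷ is) = P-0-z (punchIn s i) ∷ zeros≈ is
      bottoms≈ : Pointwise _≈_ (bₛ ∷ map b js ++ ys) (map (_- z) (pos (bottoms ++ map next Ys)))
      bottoms≈ = P-0-z s ∷ zeros≈ js

    root : ∀ i → E (yₛ ∷ map a js ++ ys) 0 (V i) ≈ 0#
    root i = E-root 0 (≡.subst (Any (V i ≈_)) pos-tops (Any.map (trans (sym (P-0 i))) (pos-root {tops ++ Ys} (member (n i) ≡.refl))))
      where
      top-member : View i → (i , n i) ∈ tops
      top-member (is-s ≡.refl)    = here ≡.refl
      top-member (other j ≡.refl) = there (∈P.∈-map⁺ (λ j → punchIn s j , n (punchIn s j)) (∈P.∈-allFin j))
      -- The first point of i is its last one when `n i` is 0; otherwise it occurs in the diagram.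
      member : ∀ x → n i ≡ x → (i , 0) ∈ tops ++ Ys
      member zero    e = ∈P.∈-++⁺ˡ (≡.subst (λ x → (i , x) ∈ tops) e (top-member (view i)))
      member (suc x) e = ∈P.∈-++⁺ʳ tops (complete i 0 (≡.subst (0 <_) (≡.sym e) (s≤s z≤n)))

    length-js : length js ≡ suc m
    length-js = ListP.length-tabulate id

    ∏α≡∏wall : ∀ is → Top.∏α is ≡ ∏wall is
    ∏α≡∏wall []       = ≡.refl
    ∏α≡∏wall (i ∷ is) = ≡.cong (lin (wall i) *_) (∏α≡∏wall is)

  module _ (basis : Basis (Conf p (suc ∘ n)) (catalanBasis Ys)) where

    basis₀ : Basis (Conf p (suc ∘ n)) (TD ys 0 ∷ θs)
    basis₀ = basis-⇄ (triangular m) basis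

    catalan-next : ∀ {n⁺ : Fin (suc (suc m)) → ℕ} → n⁺ s ≡ suc (n s) → (∀ j → n⁺ (punchIn s j) ≡ n (punchIn s j)) →
                   Basis (Conf p (suc ∘ n⁺)) (catalanBasis ((s , n s) ∷ Ys))
    catalan-next {n⁺} n⁺-s n⁺-other = basis-⇄
      (⇄-head (Top.top-unit js length-js bₛ (n s) yₛ-bₛ shifted root) (Top.top-unit⁻¹ js length-js bₛ (n s) yₛ-bₛ shifted root)
        (Top.top-unit-inverse js length-js bₛ (n s) yₛ-bₛ shifted root)
        (span-cong (λ k → +-congˡ (-‿cong (*-congˡ (trans (*-congʳ (reflexive (∏α≡∏wall js))) (sym (Θ≈∏wall (TD ys 0) js k))))))
          (Top.top-relation js length-js bₛ (n s) yₛ-bₛ shifted root)))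
      (basis-≃ PL (walls≃ {n⁺} n⁺-s n⁺-other)
        (basis-walls basis₀ (θs-wall {n⁺} n⁺-s n⁺-other) θ-wall js (UniqueP.allFin⁺ (suc m)) (All.universal (λ _ → s≤s z≤n) _)))

-- The induction on vertices and size

sizeN-cong : ∀ {l} {f g : Fin l → ℕ} → (∀ i → f i ≡ g i) → sizeN f ≡ sizeN g
sizeN-cong {zero}  e = ≡.refl
sizeN-cong {suc l} e = ≡.cong₂ ℕ._+_ (e zero) (sizeN-cong (e ∘ suc))

sizeN-punchIn : ∀ {l} (n : Fin (suc l) → ℕ) s → sizeN n ≡ n s ℕ.+ sizeN (n ∘ punchIn s)
sizeN-punchIn         n zero    = ≡.refl
sizeN-punchIn {suc l} n (suc s) = ≡.trans (≡.cong (n zero ℕ.+_) (sizeN-punchIn (n ∘ suc) s)) (x+y+z (n zero) (n (suc s)) _)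
  where open Algebra.Properties.CommutativeSemigroup ℕP.+-commutativeSemigroup using () renaming (x∙yz≈y∙xz to x+y+z)

sizeN-zero : ∀ {l} (n : Fin l → ℕ) → sizeN n ≡ 0 → ∀ i → n i ≡ 0
sizeN-zero n e zero    = ℕP.m+n≡0⇒m≡0 (n zero) e
sizeN-zero n e (suc i) = sizeN-zero (n ∘ suc) (ℕP.m+n≡0⇒n≡0 (n zero) e) i

record Predecessor {l} (n : Fin (suc l) → ℕ) (N : ℕ) : Set where
  constructor predecessor
  field
    pred    : Fin (suc l) → ℕ
    at      : Fin (suc l)
    n-at    : n at ≡ suc (pred at)
    n-other : ∀ j → n (punchIn at j) ≡ pred (punchIn at j)
    size    : sizeN pred ≡ N

sizeN-suc : ∀ {l} (n : Fin (suc l) → ℕ) {N} → sizeN n ≡ suc N → Predecessor n N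
sizeN-suc n e = go (n zero) ≡.refl
  where
  go : ∀ x → n zero ≡ x → Predecessor n _
  go (suc x) n₀ = predecessor (λ { zero → x ; (suc i) → n (suc i) }) zero n₀ (λ _ → ≡.refl)
    (ℕP.suc-injective (≡.trans (≡.cong (ℕ._+ sizeN (n ∘ suc)) (≡.sym n₀)) e))
  go zero n₀ = lift-pred _ n e n₀
    where
    lift-pred : ∀ l (n : Fin (suc l) → ℕ) {N} → sizeN n ≡ suc N → n zero ≡ 0 → Predecessor n N
    lift-pred zero    n e n₀ = contradiction (≡.trans (≡.sym e) (≡.cong (ℕ._+ 0) n₀)) λ ()
    lift-pred (suc l) n e n₀ = shift (sizeN-suc (n ∘ suc) (≡.trans (≡.cong (ℕ._+ sizeN (n ∘ suc)) (≡.sym n₀)) e))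
      where
      shift : Predecessor (n ∘ suc) _ → Predecessor n _
      shift (predecessor n⁻ s n-s n-o size) = predecessor (λ { zero → 0 ; (suc i) → n⁻ i }) (suc s) n-s
        (λ { zero → n₀ ; (suc j) → n-o j }) size

module Catalan {c ℓ} (K : Field c ℓ) (char : CharZero K) (PL : ∀ N → PolyLike K N) (basisToFree : FreeBases.BasisToFree K PL) where
  private module K = Field K
  open Arrangements K using (IndFree; FreeWith)
  open Invariance K
  open Configurations K char
  open Braid K char PL basisToFree using (braid)
  open LinearAlgebra using (Basis)

  -- The list `Ys` records the order in which points were added and is therefore existential; the
  -- degrees depend on it only through its length `N`.
  CatalanClaim : ∀ l → (Fin (suc l) → K.Carrier) → (Fin (suc l) → ℕ) → ℕ → Set _
  CatalanClaim l p n N = IndFree (suc (suc l)) (Conf p (suc ∘ n)) × ∃ λ Ys → Diagram n N Ys ×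
    Basis (PL (suc (suc l))) (Conf p (suc ∘ n)) (CatalanPoints.catalanBasis char (PL (suc (suc l))) p Ys)

  claim-free : ∀ {l p n N} → CatalanClaim l p n N → FreeWith (Conf p (suc ∘ n)) (down (λ k → N ℕ.+ suc k) l (0 ∷ 1 ∷ []))
  claim-free {l} {p} (_ , Ys , D , basis) = basisToFree _ (CatalanPoints.catalan-homog char (PL (suc (suc l))) p {Ys} (Diagram.size D) l) basis

  catalan-zero : ∀ l p n → sizeN n ≡ 0 → CatalanClaim l p n 0
  catalan-zero l p n e = IndFree-≃ (conf-≃ (λ _ → K.refl) act≡) (proj₁ claim) , [] , diagram-empty n≡0 ,
      CatalanPoints.catalan-start char (PL (suc (suc l))) p n≡0 (proj₂ claim)
    where
    n≡0 = sizeN-zero n e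
    claim = braid (suc l) 0 (suc l) (ℕP.+-identityʳ _) p
    act≡ : ∀ i → act (suc l) i ≡ suc (n i)
    act≡ i = ≡.trans (act-< {a = suc l} {i} (FinP.toℕ<n i)) (≡.cong suc (≡.sym (n≡0 i)))

  -- With a single vertex there is nothing to collide with: the list of walls is empty, and neither
  -- arrangement nor basis changes.
  catalan-point : ∀ p n {N} (pr : Predecessor n N) → CatalanClaim zero p (Predecessor.pred pr) N → CatalanClaim zero p n (suc N)
  catalan-point p n (predecessor n⁻ s n-s n-o size) (ind , Ys , D , basis) =
    IndFree-≃ conf≃ ind , _ , diagram-suc s n-s n-o D , basis-≃ (PL 2) conf≃ basis
    where
    conf≃ : Conf p (suc ∘ n⁻) ≃ Conf p (suc ∘ n)
    conf≃ = Extension.walls-complete K char p (suc ∘ n⁻) s (suc ∘ n) (≡.cong suc n-s) (λ ()) (inj₁ (s≤s z≤n)) [] [] (λ ())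

  catalan-extend : ∀ m p n {N} (pr : Predecessor n N) → (∀ p n N → sizeN n ≡ N → CatalanClaim m p n N) →
                   CatalanClaim (suc m) p (Predecessor.pred pr) N → CatalanClaim (suc m) p n (suc N)
  catalan-extend m p n {N} (predecessor n⁻ s n-s n-o size) smaller (ind , Ys , D , basis) =
    IndFree-≃ (walls≃ {n} n-s n-o) (WallFree.indFree-walls PL basisToFree (basis₀ basis) (θs-wall {n} n-s n-o) θ-wall
      {N ℕ.+ 1} {down (λ k → suc N ℕ.+ suc k) m (0 ∷ 1 ∷ [])}
      (homog-TD {Ys} (Diagram.size D) 0) (catalan-homog {(s , n⁻ s) ∷ Ys} (≡.cong suc (Diagram.size D)) m) ind collapsed
      (allFin (suc m)) (UniqueP.allFin⁺ (suc m)) (All.universal (λ _ → s≤s z≤n) _))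
    , (s , n⁻ s) ∷ Ys , diagram-suc s n-s n-o D , catalan-next basis {n} n-s n-o
    where
    open CatalanStep char (PL (suc (suc (suc m)))) p n⁻ s D
    open CatalanPoints char (PL (suc (suc (suc m)))) p using (homog-TD; catalan-homog)
    open Extension K char p (suc ∘ n⁻) s
    collapsed : ∀ j → 0 < suc (n⁻ (punchIn s j)) → IndFree (suc (suc m)) (Conf (Collapse.p′ j) (Collapse.w′ j)) ×
      ∃ λ k → ∃ λ (e : Vec ℕ k) → FreeWith (Conf (Collapse.p′ j) (Collapse.w′ j)) e × toList e ≡ toList (down (λ k → suc N ℕ.+ suc k) m (0 ∷ 1 ∷ []))
    collapsed j _ = finish (smaller (Collapse.p′ j) n′ (suc N) size′)
      where
      n′ : Fin (suc m) → ℕ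
      -- A vertex of value n carries n + 1 points. Gluing n_s + 1 of them to n_j + 1 gives the value
      -- n_s + n_j + 1, so the size rises from `N` to `N + 1`.
      n′ i = if does (i Fin.≟ j) then suc (n⁻ s) ℕ.+ n⁻ (punchIn s i) else n⁻ (punchIn s i)
      n′-j : n′ j ≡ suc (n⁻ s) ℕ.+ n⁻ (punchIn s j)
      n′-j rewrite dec-true (j Fin.≟ j) ≡.refl = ≡.refl
      n′-≢ : ∀ {i} → i ≢ j → n′ i ≡ n⁻ (punchIn s i)
      n′-≢ {i} ne rewrite dec-false (i Fin.≟ j) ne = ≡.refl
      size′ : sizeN n′ ≡ suc N
      size′ = begin
        sizeN n′                                                                      ≡⟨ sizeN-punchIn n′ j ⟩
        n′ j ℕ.+ sizeN (n′ ∘ punchIn j)                                               ≡⟨ ≡.cong₂ ℕ._+_ n′-j (sizeN-cong (λ i → n′-≢ (FinP.punchInᵢ≢i j i))) ⟩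
        suc (n⁻ s) ℕ.+ n⁻ (punchIn s j) ℕ.+ sizeN (n⁻ ∘ punchIn s ∘ punchIn j)        ≡⟨ ℕP.+-assoc (suc (n⁻ s)) _ _ ⟩
        suc (n⁻ s) ℕ.+ (n⁻ (punchIn s j) ℕ.+ sizeN (n⁻ ∘ punchIn s ∘ punchIn j))      ≡⟨ ≡.cong (suc (n⁻ s) ℕ.+_) (sizeN-punchIn (n⁻ ∘ punchIn s) j) ⟨
        suc (n⁻ s) ℕ.+ sizeN (n⁻ ∘ punchIn s)                                         ≡⟨ ≡.cong suc (≡.trans (≡.sym (sizeN-punchIn n⁻ s)) size) ⟩
        suc N                                                                         ∎
        where open ≡.≡-Reasoning
      w′≡ : ∀ i → Dec (i ≡ j) → suc (n′ i) ≡ Collapse.w′ j i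
      w′≡ i (yes ≡.refl) = ≡.trans (≡.cong suc n′-j) (≡.trans (≡.sym (ℕP.+-suc (suc (n⁻ s)) _)) (≡.sym (Collapse.shift-j j _)))
      w′≡ i (no ne)      = ≡.trans (≡.cong suc (n′-≢ ne)) (≡.sym (Collapse.shift-≢ j ne _))
      conf≃ : Conf (Collapse.p′ j) (suc ∘ n′) ≃ Conf (Collapse.p′ j) (Collapse.w′ j)
      conf≃ = conf-≃ (λ _ → K.refl) (λ i → w′≡ i (i Fin.≟ j))
      finish : CatalanClaim m (Collapse.p′ j) n′ (suc N) → _
      finish claim = IndFree-≃ conf≃ (proj₁ claim) , _ , down (λ k → suc N ℕ.+ suc k) m (0 ∷ 1 ∷ []) ,
        FreeWith-≃ (down (λ k → suc N ℕ.+ suc k) m (0 ∷ 1 ∷ [])) conf≃ (claim-free {n = n′} claim) , ≡.refl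

  -- The induction is lexicographic, vertices before size: a restriction loses a vertex but has
  -- larger size and new offsets, so the claim for fewer vertices is needed for all `p`, `n` and
  -- `N`.
  catalan : ∀ l p n N → sizeN n ≡ N → CatalanClaim l p n N
  catalan l       p n zero    e = catalan-zero l p n e
  catalan zero    p n (suc N) e = catalan-point p n (sizeN-suc n e)
    (catalan zero p (Predecessor.pred (sizeN-suc n e)) N (Predecessor.size (sizeN-suc n e)))
  catalan (suc m) p n (suc N) e = catalan-extend m p n (sizeN-suc n e) (catalan m)
    (catalan (suc m) p (Predecessor.pred (sizeN-suc n e)) N (Predecessor.size (sizeN-suc n e)))

-- Identification with the cone

module Cone {c ℓ} (K : Field c ℓ) (char : CharZero K) where
  open Field K hiding (zero)
  open Arrangements K
  open Invariance K
  open Configurations K char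
  open ℤSolver commutativeRing

  -- The points x_i + a and x_j + b collide where x_i - x_j = b - a, and b - a runs through the
  -- integers from -n_i to n_j. For the converse, a = 0 serves when the integer is nonnegative and b
  -- = 0 when it is negative.
  cone-≃ : ∀ {l} (n : Fin l → ℕ) → Conf (λ _ → 0#) (suc ∘ n) ≃ coneArr n emptyGraph
  cone-≃ {l} n = ≼-by-≈ to ,≃ ≼-by-≈ from
    where
    neg-bound : ∀ {x k} → suc k ≤ x → ℤ.- (+ (x ℕ.+ 0)) ℤ.≤ -[1+ k ]
    neg-bound {x} {k} le = ℤP.neg-mono-≤ (+≤+ (≡.subst (suc k ≤_) (≡.sym (ℕP.+-identityʳ x)) le))
    pos-bound : ∀ {x k} → k ≤ x → + k ℤ.≤ + (x ℕ.+ 0)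
    pos-bound {x} {k} le = +≤+ (≡.subst (k ≤_) (≡.sym (ℕP.+-identityʳ x)) le)
    to : ∀ β → Conf (λ _ → 0#) (suc ∘ n) β → ∃ λ γ → coneArr n emptyGraph γ × β ≈F γ
    to β (isZ e) = β , lift (inj₁ e) , λ _ → refl
    to β (isP i j a b i≢j (s≤s a≤) (s≤s b≤) e) = go (ℕ.compare a b) a≤ b≤ e
      where
      go : ∀ {a b} → ℕ.Ordering a b → a ≤ n i → b ≤ n j → β ≈F (pt (λ _ → 0#) i a ⊖ pt (λ _ → 0#) j b) →
           ∃ λ γ → coneArr n emptyGraph γ × β ≈F γ
      go (ℕ.less a k) a≤ b≤ e = _ , lift (inj₂ (i , j , + suc k , i≢j , ℤP.≤-trans ℤP.neg-≤-pos (+≤+ z≤n) , pos-bound (ℕP.≤-trans (s≤s (ℕP.m≤n+m k a)) b≤) , λ _ → refl)) ,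
        λ { zero → trans (e zero) (trans (+-congˡ (-‿cong (+-congˡ (+-congˡ (natK-+ a k)))))
                     (solve 3 (λ a k u → con (+ 0) :+ a :- (con (+ 0) :+ (u :+ (a :+ k))) := :- (u :+ k)) refl (natK a) (natK k) 1#))
          ; (suc t) → e (suc t) }
      go (ℕ.equal a) a≤ b≤ e = _ , lift (inj₂ (i , j , + 0 , i≢j , ℤP.neg-≤-pos , +≤+ z≤n , λ _ → refl)) ,
        λ { zero → trans (e zero) (solve 1 (λ a → con (+ 0) :+ a :- (con (+ 0) :+ a) := :- con (+ 0)) refl (natK a)) ; (suc t) → e (suc t) }
      go (ℕ.greater b k) a≤ b≤ e = _ , lift (inj₂ (i , j , -[1+ k ] , i≢j , neg-bound (ℕP.≤-trans (s≤s (ℕP.m≤n+m k b)) a≤) , ℤ.-≤+ , λ _ → refl)) ,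
        λ { zero → trans (e zero) (trans (+-congʳ (+-congˡ (+-congˡ (natK-+ b k))))
                     (solve 3 (λ b k u → con (+ 0) :+ (u :+ (b :+ k)) :- (con (+ 0) :+ b) := :- :- (u :+ k)) refl (natK b) (natK k) 1#))
          ; (suc t) → e (suc t) }
    from : ∀ β → coneArr n emptyGraph β → ∃ λ γ → Conf (λ _ → 0#) (suc ∘ n) γ × β ≈F γ
    from β (lift (inj₁ e)) = β , isZ e , λ _ → refl
    from β (lift (inj₂ (i , j , + k , i≢j , _ , le , e))) = _ , isP i j 0 k i≢j (s≤s z≤n) (s≤s (≡.subst (k ≤_) (ℕP.+-identityʳ (n j)) (ℤP.drop‿+≤+ le))) (λ _ → refl) ,
      λ { zero → trans (e zero) (solve 1 (λ k → :- k := con (+ 0) :+ con (+ 0) :- (con (+ 0) :+ k)) refl (natK k)) ; (suc t) → e (suc t) }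
    from β (lift (inj₂ (i , j , -[1+ k ] , i≢j , le , _ , e))) = _ , isP i j (suc k) 0 i≢j
        (s≤s (≡.subst (suc k ≤_) (ℕP.+-identityʳ (n i)) (ℤP.drop‿+≤+ (ℤP.neg-cancel-≤ le)))) (s≤s z≤n) (λ _ → refl) ,
      λ { zero → trans (e zero) (solve 1 (λ k → :- :- k := con (+ 0) :+ k :- (con (+ 0) :+ con (+ 0))) refl (natK (suc k))) ; (suc t) → e (suc t) }

down-↭ : ∀ (f : ℕ → ℕ) m → toList (down f m (0 ∷ 1 ∷ [])) ↭ 0 ∷ 1 ∷ List.applyUpTo f m
down-↭ f zero    = ↭-refl
down-↭ f (suc m) = ↭-trans (↭-prep (f m) (down-↭ f m)) (↭-trans (↭P.∷↭∷ʳ (f m) _)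
  (↭-reflexive (≡.cong (λ xs → 0 ∷ 1 ∷ xs) (ListP.applyUpTo-∷ʳ f m))))

theorem2p9 : ∀ {c ℓ : Level} (K : Field c ℓ) → CharZero K →
    (l : ℕ) → 2 ≤ l → (n : Fin l → ℕ) →
    let open Arrangements K in
    (Σ ℕ λ m → Σ (Vec ℕ m) λ e →
    FreeWith (coneArr n emptyGraph) e × (toList e ↭ expList n))
    × IndFree (suc l) (coneArr n emptyGraph)
theorem2p9 K char (suc l) _ n =
  (_ , down (λ k → sizeN n ℕ.+ suc k) l (0 ∷ 1 ∷ []) , FreeWith-≃ (down (λ k → sizeN n ℕ.+ suc k) l (0 ∷ 1 ∷ [])) (cone-≃ n) (claim-free {n = n} claim)
    , down-↭ (λ k → sizeN n ℕ.+ suc k) l)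
  , IndFree-≃ (cone-≃ n) (proj₁ claim)
  where
  open Invariance K
  open Cone K char
  open Catalan K char (Instance.polyLike K) (FreeBases.freeWith K)
  claim : CatalanClaim l (λ _ → Field.0# K) n (sizeN n)
  claim = catalan l (λ _ → Field.0# K) n (sizeN n) ≡.refl
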